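{- Let $H$ be a digraph that has a homomorphism into a directed path. For every $\eta>0$ there exists $n_0=n_0(\eta,H)\in\mathbb N$ such that the following holds for all $n\ge n_0$ divisible by $|H|$. If $G$ is an $n$-vertex digraph with $\delta(G)\ge(1+\eta)n$, then $G$ contains an $H$-factor.
   Context: Digraphs have no loops and at most one edge in each direction between any pair of vertices; $xy$ denotes the edge directed from $x$ to $y$, and $|G|$ is the number of vertices. The minimum (total) degree $\delta(G)$ is the minimum over vertices $v$ of the number of edges incident to $v$ (in-degree plus out-degree). A homomorphism from $H$ into $F$ is a map $\phi:V(H)\to V(F)$ with $\phi(x)\phi(y)\in E(F)$ for every $xy\in E(H)$. A directed path is a path $v_1\dots v_k$ with $v_iv_{i+1}$ an edge for all $i\in[k-1]$. An $H$-factor in $G$ is a collection of vertex-disjoint copies of $H$ in $G$ covering all vertices of $G$. -}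

module Defs where

open import Data.Nat using (ℕ; suc; _+_)
open import Data.Bool using (Bool; true; false; if_then_else_)
open import Data.Fin using (Fin; toℕ)
open import Data.List using (map; allFin)
open import Data.Nat.ListAction using (sum)
open import Data.Product using (Σ; ∃; _×_; uncurry)
open import Function.Definitions using (Bijective)
open import Relation.Binary.PropositionalEquality using (_≡_)

-- A digraph on vertex set Fin n, given by its (Boolean) adjacency relation:
-- adj x y ≡ true  iff  xy is an edge. No loops. At most one edge in each
-- direction between a pair is automatic for a relation.
record Digraph (n : ℕ) : Set where
  field
    adj      : Fin n → Fin n → Bool
    loopless : ∀ x → adj x x ≡ false
open Digraph public

∣_∣ᵥ : ∀ {n} → Digraph n → ℕ
∣_∣ᵥ {n} _ = n

indicator : Bool → ℕ
indicator b = if b then 1 else 0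

outdeg indeg deg : ∀ {n} → Digraph n → Fin n → ℕ
outdeg {n} G v = sum (map (λ u → indicator (adj G v u)) (allFin n))
indeg  {n} G v = sum (map (λ u → indicator (adj G u v)) (allFin n))
deg G v = indeg G v + outdeg G v

IsHom : ∀ {h k} → Digraph h → Digraph k → (Fin h → Fin k) → Set
IsHom H F φ = ∀ x y → adj H x y ≡ true → adj F (φ x) (φ y) ≡ true

HomToDirectedPath : ∀ {h} → Digraph h → Set
HomToDirectedPath {h} H =
  Σ ℕ λ k → Σ (Fin h → Fin k) λ φ →
    ∀ x y → adj H x y ≡ true → toℕ (φ y) ≡ suc (toℕ (φ x))

-- An H-factor in G: m copies of H (each an edge-preserving map Fin h → Fin n)
-- such that the joint map (copy index, vertex of H) ↦ vertex of G is a
-- bijection: so copies are injective, vertex-disjoint and cover V(G).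
HasFactor : ∀ {h n} → Digraph h → Digraph n → Set
HasFactor {h} {n} H G =
  Σ ℕ λ m → Σ (Fin m → Fin h → Fin n) λ f →
    (∀ i → IsHom H G (f i)) × Bijective _≡_ _≡_ (uncurry f)

{-# OPTIONS --safe #-}
-- Write P for an integer with 1 / P ≤ η. Two vertices x, y of G always have linearly many common out-neighbours or
-- linearly many common in-neighbours, because their degrees add up to more than 2n. Hence, with H mapped into a path by φ, a
-- positive proportion of the (h−1)-tuples of vertices completes both x and y to a copy of H, x and y playing a source or a
-- sink of H. Combining h such exchanges with one more copy gives gadgets; choosing disjoint gadgets greedily, so as to
-- decrease an exponential potential that penalises every h-tuple absorbed by few of them, produces a small absorbing set.
--
-- The rest is covered almost completely by blown-up directed cycles. A leftover vertex v has more than n + n / P incident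
-- edges, so either most of its surplus goes to other leftover vertices, and then these contain a blown-up 2-cycle, or v fits
-- between many consecutive clusters A → B of the cycles. By the pigeonhole principle many leftover vertices Z then fit
-- between the same X ⊆ A and Y ⊆ B, and a thinner cycle through X → Z → Y together with thin cycles on the rest of the
-- clusters covers more vertices. A blown-up cycle with clusters of size h is tiled by placing vertex u of H, in the copy
-- starting at cluster o, at the u-th vertex of cluster o + φ u.

module Submission where

open import Defs
open import Data.Bool using (Bool; true; false; _∧_; not; if_then_else_)
open import Data.Fin as Fin using (Fin; zero; suc; toℕ; punchIn; punchOut)
import Data.Fin.Properties as Finₚ
import Data.Bool.Properties as Boolₚ
open import Data.Fin.Properties using (toℕ-injective; toℕ-fromℕ<; toℕ<n; punchIn-punchOut)
open import Data.List as List using (List; []; _∷_; _++_; map; concat; length; allFin; cartesianProductWith; [_])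
open import Data.List.Properties using (take++drop≡id; length-take; length-drop; length-zipWith; map-++; length-tabulate; map-tabulate; length-++; length-map; ++-assoc; ++-identityʳ; concat-++)
open import Data.List.Membership.Propositional using (_∈_)
open import Data.List.Membership.Propositional.Properties using (∈-++⁺ˡ; ∈-map⁺; ∈-++⁺ʳ; ∈-++⁻; ∈-cartesianProductWith⁺; ∈-cartesianProductWith⁻; ∈-allFin)
open import Data.List.Relation.Unary.Any using (here; there)
open import Data.List.Relation.Unary.All as All using (All; []; _∷_)
import Data.List.Relation.Unary.All.Properties as Allₚ
open import Data.List.Relation.Binary.Pointwise as Pointwise using (Pointwise; []; _∷_)
open import Data.List.Relation.Binary.Permutation.Propositional using (_↭_; ↭-refl; ↭-sym; ↭-trans; ↭-reflexive; prep; module PermutationReasoning)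
open import Data.List.Relation.Binary.Permutation.Propositional.Properties using (↭-length; ∈-resp-↭; ++⁺ˡ; ++⁺ʳ; shift; shifts; All-resp-↭; map⁺) renaming (++⁺ to ↭-++⁺; ++-comm to ↭-++-comm)
open import Data.Nat using (ℕ; zero; suc; _+_; _*_; _∸_; _^_; _≤_; _<_; _≥_; z≤n; s≤s; NonZero; >-nonZero)
open import Data.Nat.DivMod using (_/_; m≡m%n+[m/n]*n; m%n<n; m/n*n≤m)
open import Data.Nat.Divisibility using (_∣_; divides; quotient; ∣m+n∣m⇒∣n; 0∣⇒≡0)
open import Data.Nat.ListAction using (sum)
open import Data.Nat.ListAction.Properties using (sum-↭)
open import Data.Nat.Properties
open import Data.Nat.Tactic.RingSolver using (solve-∀)
open import Data.Product using (Σ; ∃; _×_; _,_; proj₁; proj₂; ∃₂; uncurry)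
import Data.Integer as ℤ
import Data.Integer.Properties as ℤₚ
import Data.Rational as ℚ
open ℚ using (ℚ; 0ℚ; 1ℚ)
import Data.Rational.Properties as ℚₚ
import Data.Rational.Unnormalised as ℚᵘ
import Data.Rational.Unnormalised.Properties as ℚᵘₚ
open import Data.Sum using (_⊎_; inj₁; inj₂)
open import Data.Vec as Vec using (Vec; []; _∷_; lookup; toList; insertAt; _[_]≔_)
import Data.Vec.Properties as Vecₚ
open import Data.Vec.Membership.Propositional.Properties using (∈-lookup; ∈-toList⁺)
open import Function using (_∘_; id; flip)
open import Relation.Binary.PropositionalEquality using (_≡_; _≢_; refl; sym; trans; cong; cong₂; subst; subst₂; module ≡-Reasoning)
open import Relation.Nullary using (Dec; yes; no; does; contradiction)
open import Relation.Nullary.Decidable using (_→-dec_; dec-true; dec-false)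

-- Two obstacles shape the argument. A gadget must exchange prescribed vertices, so copies of H
-- through them have to be counted. Since H has levels, it lies in a blow-up of a walk; walks are
-- plentiful because all in- and out-degrees are at least n / P, and cloning the vertices of a walk
-- loses only a constant factor. In the covering, the pigeonhole argument on clusters of width t
-- costs a factor exponential in t, so widths must stay bounded, while every round divides them by a
-- constant. Hence the number of rounds may depend on η but not on n. Yet each insertion ties up a
-- whole cycle, so a round with cycles of at most M clusters is only sure to shrink the leftover by
-- N / (κ M), and M grows by one in each round. A bounded number of rounds suffices because the
-- harmonic series diverges. Throughout, a share 1 / c is written as `N ≤ c * x`, and constants are
-- fixed before the digraph, so that they are uniform in it.

private
  variable
    A A′ A″ : Set

-- Finite sums, counting and averaging

∑ : List A → (A → ℕ) → ℕ
∑ xs f = sum (map f xs)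

count : (A → Bool) → List A → ℕ
count p xs = ∑ xs (λ x → indicator (p x))

∑-mono-∈ : ∀ (xs : List A) {f g} → (∀ x → x ∈ xs → f x ≤ g x) → ∑ xs f ≤ ∑ xs g
∑-mono-∈ []       h = z≤n
∑-mono-∈ (x ∷ xs) h = +-mono-≤ (h x (here refl)) (∑-mono-∈ xs (λ y y∈ → h y (there y∈)))

∑-mono : ∀ (xs : List A) {f g} → (∀ x → f x ≤ g x) → ∑ xs f ≤ ∑ xs g
∑-mono xs h = ∑-mono-∈ xs (λ x _ → h x)

∑-cong : ∀ (xs : List A) {f g} → (∀ x → f x ≡ g x) → ∑ xs f ≡ ∑ xs g
∑-cong []       h = refl
∑-cong (x ∷ xs) h = cong₂ _+_ (h x) (∑-cong xs h)

∑-++ : ∀ (xs ys : List A) f → ∑ (xs ++ ys) f ≡ ∑ xs f + ∑ ys f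
∑-++ []       ys f = refl
∑-++ (x ∷ xs) ys f = trans (cong (f x +_) (∑-++ xs ys f)) (sym (+-assoc (f x) _ _))

∑-↭ : ∀ {xs ys : List A} f → xs ↭ ys → ∑ xs f ≡ ∑ ys f
∑-↭ f p = sum-↭ (map⁺ f p)

∑-+ : ∀ (xs : List A) f g → ∑ xs (λ x → f x + g x) ≡ ∑ xs f + ∑ xs g
∑-+ []       f g = refl
∑-+ (x ∷ xs) f g rewrite ∑-+ xs f g = interchange (f x) (g x) _ _
  where
  interchange : ∀ a b c d → a + b + (c + d) ≡ a + c + (b + d)
  interchange = solve-∀

∑-*ˡ : ∀ (xs : List A) c f → ∑ xs (λ x → c * f x) ≡ c * ∑ xs f
∑-*ˡ []       c f = sym (*-zeroʳ c)
∑-*ˡ (x ∷ xs) c f rewrite ∑-*ˡ xs c f = sym (*-distribˡ-+ c (f x) _)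

∑-const : ∀ (xs : List A) c → ∑ xs (λ _ → c) ≡ length xs * c
∑-const []       c = refl
∑-const (x ∷ xs) c = cong (c +_) (∑-const xs c)

∑-swap : ∀ (xs : List A) (ys : List A′) (f : A → A′ → ℕ) → ∑ xs (λ x → ∑ ys (f x)) ≡ ∑ ys (λ y → ∑ xs (λ x → f x y))
∑-swap []       ys f = sym (trans (∑-const ys 0) (*-zeroʳ (length ys)))
∑-swap (x ∷ xs) ys f rewrite ∑-swap xs ys f = sym (∑-+ ys (f x) _)

∑-map : ∀ (xs : List A) (k : A → A′) f → ∑ (map k xs) f ≡ ∑ xs (λ x → f (k x))
∑-map []       k f = refl
∑-map (x ∷ xs) k f = cong (f (k x) +_) (∑-map xs k f)

∑-cartesian : ∀ (k : A → A′ → A″) as bs f →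
              ∑ (cartesianProductWith k as bs) f ≡ ∑ as (λ a → ∑ bs (λ b → f (k a b)))
∑-cartesian k []       bs f = refl
∑-cartesian k (a ∷ as) bs f =
  trans (∑-++ (map (k a) bs) _ f) (cong₂ _+_ (∑-map bs (k a) f) (∑-cartesian k as bs f))

∑-concat : ∀ (xss : List (List A)) f → ∑ (concat xss) f ≡ ∑ xss (λ xs → ∑ xs f)
∑-concat []         f = refl
∑-concat (xs ∷ xss) f = trans (∑-++ xs (concat xss) f) (cong (∑ xs f +_) (∑-concat xss f))

∈⇒≤∑ : ∀ {xs : List A} {x} f → x ∈ xs → f x ≤ ∑ xs f
∈⇒≤∑ {xs = x ∷ xs} f (here refl) = m≤m+n (f x) _
∈⇒≤∑ {xs = y ∷ xs} f (there x∈)  = ≤-trans (∈⇒≤∑ f x∈) (m≤n+m _ (f y))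

∑-<⇒∃< : ∀ (xs : List A) f g → ∑ xs f < ∑ xs g → ∃ λ x → x ∈ xs × f x < g x
∑-<⇒∃< (x ∷ xs) f g lt with f x <? g x
... | yes fx<gx = x , here refl , fx<gx
... | no  fx≮gx with ∑-<⇒∃< xs f g (+-cancelˡ-< (f x) _ _ (<-≤-trans lt (+-monoˡ-≤ _ (≮⇒≥ fx≮gx))))
...   | y , y∈ , lt′ = y , there y∈ , lt′

∑-≤⇒∃≤ : ∀ (xs : List A) f g → 0 < length xs → ∑ xs f ≤ ∑ xs g → ∃ λ x → x ∈ xs × f x ≤ g x
∑-≤⇒∃≤ xs f g 0<l le
  with ∑-<⇒∃< xs f (λ x → suc (g x))
         (subst (∑ xs f <_)
                (sym (trans (∑-+ xs (λ _ → 1) g) (cong (_+ ∑ xs g) (trans (∑-const xs 1) (*-identityʳ _)))))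
                (<-≤-trans (s≤s le) (+-monoˡ-≤ (∑ xs g) 0<l)))
... | x , x∈ , lt = x , x∈ , ≤-pred lt

indicator≤1 : ∀ b → indicator b ≤ 1
indicator≤1 true  = ≤-refl
indicator≤1 false = z≤n

indicator-mono : ∀ {a b} → (a ≡ true → b ≡ true) → indicator a ≤ indicator b
indicator-mono {false}         h = z≤n
indicator-mono {true}  {true}  h = ≤-refl
indicator-mono {true}  {false} h with () ← h refl

length≡count : ∀ (xs : List A) → length xs ≡ count (λ _ → true) xs
length≡count xs = sym (trans (∑-const xs 1) (*-identityʳ _))

count≤length : ∀ (p : A → Bool) xs → count p xs ≤ length xs
count≤length p xs = ≤-trans (∑-mono xs (λ x → indicator≤1 (p x))) (≤-reflexive (sym (length≡count xs)))

count-mono : ∀ {p q : A → Bool} xs → (∀ x → p x ≡ true → q x ≡ true) → count p xs ≤ count q xs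
count-mono xs h = ∑-mono xs (λ x → indicator-mono (h x))

markov : ∀ (xs : List A) f a b (p : A → Bool) → (∀ x → f x ≤ a + b * indicator (p x)) →
         ∑ xs f ≤ length xs * a + b * count p xs
markov xs f a b p h = ≤-trans (∑-mono xs h)
  (≤-reflexive (trans (∑-+ xs _ _) (cong₂ _+_ (∑-const xs a) (∑-*ˡ xs b _))))

infix 4 _≤ᵈ_

_≤ᵈ_ : ℕ → ℕ → Bool
a ≤ᵈ b = Data.Nat._≤ᵇ_ a b

≤ᵈ-true : ∀ {a b} → (a ≤ᵈ b) ≡ true → a ≤ b
≤ᵈ-true {a} {b} e = ≤ᵇ⇒≤ a b (subst Data.Bool.T (sym e) _)

≤ᵈ-false : ∀ {a b} → (a ≤ᵈ b) ≡ false → b < a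
≤ᵈ-false {a} {b} e = ≰⇒> λ le → subst Data.Bool.T e (≤⇒≤ᵇ le)

-- Values below M / (2d) contribute at most half of the total. The other half is carried by the
-- remaining entries, none of which exceeds M, so they form at least a 1 / (2d) share.
popular : ∀ (xs : List A) f M d → (∀ x → x ∈ xs → f x ≤ M) → 1 ≤ d → length xs * M ≤ d * ∑ xs f →
          length xs ≤ (d + d) * count (λ x → M ≤ᵈ (d + d) * f x) xs
-- The main argument cancels a factor M; for M = 0 every entry passes the test.
popular xs f zero d bd 1≤d le = ≤-trans (≤-reflexive (length≡count xs)) (m≤n*m (count (λ _ → true) xs) (d + d) ⦃ >-nonZero (≤-trans 1≤d (m≤m+n d d)) ⦄)
popular xs f M@(suc _) d bd 1≤d le = *-cancelʳ-≤ _ _ M (+-cancelˡ-≤ (l * M) _ _ main)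
  where
  l = length xs
  good : _ → Bool
  good x = M ≤ᵈ (d + d) * f x
  pt : ∀ x → x ∈ xs → (d + d) * f x ≤ M + ((d + d) * M) * indicator (good x)
  pt x x∈ with good x in e
  ... | true  = ≤-trans (*-monoʳ-≤ (d + d) (bd x x∈)) (≤-trans (≤-reflexive (sym (*-identityʳ _))) (m≤n+m _ M))
  ... | false = ≤-trans (<⇒≤ (≤ᵈ-false {M} e)) (m≤m+n M _)
  sm : (d + d) * ∑ xs f ≤ l * M + ((d + d) * M) * count good xs
  sm = begin
    (d + d) * ∑ xs f                               ≡⟨ ∑-*ˡ xs (d + d) f ⟨
    ∑ xs (λ x → (d + d) * f x)                     ≤⟨ ∑-mono-∈ xs pt ⟩
    ∑ xs (λ x → M + ((d + d) * M) * indicator (good x)) ≡⟨ ∑-+ xs _ _ ⟩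
    _                                              ≡⟨ cong₂ _+_ (∑-const xs M) (∑-*ˡ xs ((d + d) * M) _) ⟩
    l * M + ((d + d) * M) * count good xs          ∎
    where open ≤-Reasoning
  main : l * M + l * M ≤ l * M + ((d + d) * count good xs) * M
  main = begin
    l * M + l * M                          ≤⟨ +-mono-≤ le le ⟩
    d * ∑ xs f + d * ∑ xs f                ≡⟨ *-distribʳ-+ (∑ xs f) d d ⟨
    (d + d) * ∑ xs f                       ≤⟨ sm ⟩
    l * M + ((d + d) * M) * count good xs  ≡⟨ cong (l * M +_) (perm (d + d) M _) ⟩
    l * M + ((d + d) * count good xs) * M  ∎
    where
    open ≤-Reasoning
    perm : ∀ a b c → a * b * c ≡ a * c * b
    perm = solve-∀

∑-restrict : ∀ (xs : List A) f M (p : A → Bool) → (∀ x → x ∈ xs → p x ≡ true → M ≤ f x) → count p xs * M ≤ ∑ xs f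
∑-restrict xs f M p h = ≤-trans (≤-reflexive (trans (*-comm _ M) (sym (∑-*ˡ xs M _)))) (∑-mono-∈ xs pt)
  where
  pt : ∀ x → x ∈ xs → M * indicator (p x) ≤ f x
  pt x x∈ with p x in e
  ... | true  = ≤-trans (≤-reflexive (*-identityʳ M)) (h x x∈ e)
  ... | false = ≤-trans (≤-reflexive (*-zeroʳ M)) z≤n

pick : ∀ (p : A → Bool) xs w → w ≤ count p xs →
       ∃₂ λ ys zs → xs ↭ ys ++ zs × length ys ≡ w × All (λ x → p x ≡ true) ys
pick p xs       zero    _ = [] , xs , ↭-refl , refl , []
pick p (x ∷ xs) (suc w) le with p x in e
... | true with ys , zs , q , l , a ← pick p xs w (≤-pred le) = x ∷ ys , zs , prep x q , cong suc l , e ∷ a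
... | false with ys , zs , q , l , a ← pick p xs (suc w) le
      = ys , x ∷ zs , ↭-trans (prep x q) (↭-sym (shift x ys zs)) , l , a

not-count : ∀ (p : A → Bool) xs → count p xs + count (not ∘ p) xs ≡ length xs
not-count p []       = refl
not-count p (x ∷ xs) with p x
... | true  = cong suc (not-count p xs)
... | false = trans (+-suc _ _) (cong suc (not-count p xs))

-- Each test keeps a class with at least half of the entries, so it costs a factor 2. With
-- adjacencies to a fixed set as tests, the survivors have the same neighbours in that set, and one
-- representative speaks for all.
pigeonhole : ∀ (ts : List (A → Bool)) xs w → 2 ^ length ts * w ≤ length xs →
             ∃₂ λ ys zs → xs ↭ ys ++ zs × length ys ≡ w × (∀ t → t ∈ ts → ∀ x y → x ∈ ys → y ∈ ys → t x ≡ t y)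
pigeonhole {A = A} [] xs w le
  with ys , zs , q , l , _ ← pick (λ _ → true) xs w
         (≤-trans (≤-reflexive (sym (+-identityʳ w))) (≤-trans le (≤-reflexive (length≡count xs))))
  = ys , zs , q , l , λ _ ()
pigeonhole {A = A} (t ∷ ts) xs w le = by-majority (2 ^ length ts * w ≤? count t xs)
  where
  K = 2 ^ length ts * w
  R = ∃₂ λ ys zs → xs ↭ ys ++ zs × length ys ≡ w × (∀ s → s ∈ t ∷ ts → ∀ x y → x ∈ ys → y ∈ ys → s x ≡ s y)
  go : ∀ (f : A → Bool) → (∀ x y → f x ≡ true → f y ≡ true → t x ≡ t y) → K ≤ count f xs → R
  go f same le′
    with ys , zs , q , l , a ← pick f xs K le′
    with us , vs , q′ , l′ , c ← pigeonhole ts ys w (≤-reflexive (sym l))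
    = us , vs ++ zs , ↭-trans q (↭-trans (++⁺ʳ zs q′) (↭-reflexive (++-assoc us vs zs))) , l′ ,
      λ { s (here refl) x y x∈ y∈ → same x y (All.lookup a (∈-resp-↭ (↭-sym q′) (∈-++⁺ˡ x∈))) (All.lookup a (∈-resp-↭ (↭-sym q′) (∈-++⁺ˡ y∈)))
        ; s (there s∈) → c s s∈ }
  by-majority : Dec (K ≤ count t xs) → R
  by-majority (yes le′) = go t (λ x y a b → trans a (sym b)) le′
  by-majority (no  nle) = go (not ∘ t) same (+-cancelˡ-≤ (count t xs) _ _ (begin
      count t xs + K                   ≤⟨ +-monoˡ-≤ K (<⇒≤ (≰⇒> nle)) ⟩
      K + K                            ≡⟨ double (2 ^ length ts) w ⟩
      2 ^ length (t ∷ ts) * w          ≤⟨ le ⟩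
      length xs                        ≡⟨ not-count t xs ⟨
      count t xs + count (not ∘ t) xs  ∎))
    where
    open ≤-Reasoning
    double : ∀ a b → a * b + a * b ≡ 2 * a * b
    double = solve-∀
    same : ∀ x y → not (t x) ≡ true → not (t y) ≡ true → t x ≡ t y
    same x y a b with t x | t y
    ... | false | false = refl

-- Tuples and the cloning lemma

tuples : ∀ k → List A → List (Vec A k)
tuples zero    xs = [ [] ]
tuples (suc k) xs = cartesianProductWith _∷_ xs (tuples k xs)

∑-tuples-suc : ∀ {k} (xs : List A) (f : Vec A (suc k) → ℕ) →
               ∑ (tuples (suc k) xs) f ≡ ∑ xs (λ x → ∑ (tuples k xs) (λ w → f (x ∷ w)))
∑-tuples-suc {k = k} xs f = ∑-cartesian _∷_ xs (tuples k xs) f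

length-tuples : ∀ k (xs : List A) → length (tuples k xs) ≡ length xs ^ k
length-tuples zero    xs = refl
length-tuples (suc k) xs = begin
  length (tuples (suc k) xs)                 ≡⟨ length≡count (tuples (suc k) xs) ⟩
  ∑ (tuples (suc k) xs) (λ _ → 1)            ≡⟨ ∑-tuples-suc xs (λ _ → 1) ⟩
  ∑ xs (λ _ → ∑ (tuples k xs) (λ _ → 1))     ≡⟨ ∑-const xs _ ⟩
  length xs * ∑ (tuples k xs) (λ _ → 1)      ≡⟨ cong (length xs *_) (sym (length≡count (tuples k xs))) ⟩
  length xs * length (tuples k xs)           ≡⟨ cong (length xs *_) (length-tuples k xs) ⟩
  length xs ^ suc k                          ∎
  where open ≡-Reasoning

∑-tuples-insertAt : ∀ {k} (xs : List A) (j : Fin (suc k)) (f : Vec A (suc k) → ℕ) →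
                    ∑ (tuples (suc k) xs) f ≡ ∑ (tuples k xs) (λ r → ∑ xs (λ v → f (insertAt r j v)))
∑-tuples-insertAt {k = k} xs zero f =
  trans (∑-tuples-suc xs f) (∑-swap xs (tuples k xs) (λ x w → f (x ∷ w)))
∑-tuples-insertAt {k = suc k} xs (suc j) f = begin
  ∑ (tuples (2 + k) xs) f
    ≡⟨ ∑-tuples-suc xs f ⟩
  ∑ xs (λ x → ∑ (tuples (suc k) xs) (λ w → f (x ∷ w)))
    ≡⟨ ∑-cong xs (λ x → ∑-tuples-insertAt xs j (λ w → f (x ∷ w))) ⟩
  ∑ xs (λ x → ∑ (tuples k xs) (λ r → ∑ xs (λ v → f (x ∷ insertAt r j v))))
    ≡⟨ ∑-tuples-suc xs (λ r → ∑ xs (λ v → f (insertAt r (suc j) v))) ⟨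
  ∑ (tuples (suc k) xs) (λ r → ∑ xs (λ v → f (insertAt r (suc j) v))) ∎
  where open ≡-Reasoning

∈-tuples⁻ : ∀ {k} (xs : List A) {w : Vec A k} → w ∈ tuples k xs → All (_∈ xs) (toList w)
∈-tuples⁻ {k = zero}  xs {[]} w∈ = []
∈-tuples⁻ {k = suc k} xs w∈ with ∈-cartesianProductWith⁻ _∷_ xs (tuples k xs) w∈
... | _ , _ , x∈ , v∈ , refl = x∈ ∷ ∈-tuples⁻ xs v∈

∈-tuples⁺ : ∀ {k} {xs : List A} (w : Vec A k) → All (_∈ xs) (toList w) → w ∈ tuples k xs
∈-tuples⁺ []      []         = here refl
∈-tuples⁺ (x ∷ w) (x∈ ∷ w∈) = ∈-cartesianProductWith⁺ _∷_ x∈ (∈-tuples⁺ w w∈)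

insertAt-[]≔ : ∀ {k} (r : Vec A k) j v x → insertAt r j v [ j ]≔ x ≡ insertAt r j x
insertAt-[]≔ r       zero    v x = refl
insertAt-[]≔ (y ∷ r) (suc j) v x = cong (y ∷_) (insertAt-[]≔ r j v x)

-- Clone js g w f holds iff g holds at every tuple obtained from w by replacing
-- some of its entries w_j by entries f_u with js_u = j.
Clone : ∀ {k m} → Vec (Fin k) m → (Vec A k → Bool) → Vec A k → Vec A m → Bool
Clone []       g w []      = g w
Clone (j ∷ js) g w (x ∷ f) = Clone js (λ w′ → g w′ ∧ g (w′ [ j ]≔ x)) w f

∧-true : ∀ {a b} → a ∧ b ≡ true → a ≡ true × b ≡ true
∧-true {true} {true} _ = refl , refl

true-∧ : ∀ {a b} → a ≡ true → b ≡ true → a ∧ b ≡ true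
true-∧ refl refl = refl

indicator-∧ : ∀ a b → indicator (a ∧ b) ≡ indicator a * indicator b
indicator-∧ true  b = sym (+-identityʳ _)
indicator-∧ false b = refl

-- For fixed other coordinates r, the entries v and x at position j range independently over the
-- same admissible values, whence the square.
double-count : ∀ {k} (xs : List A) (j : Fin (suc k)) (g : Vec A (suc k) → Bool) →
  ∑ xs (λ x → count (λ w → g w ∧ g (w [ j ]≔ x)) (tuples (suc k) xs)) ≡
  ∑ (tuples k xs) (λ r → count (λ v → g (insertAt r j v)) xs * count (λ v → g (insertAt r j v)) xs)
double-count {k = k} xs j g = begin
  ∑ xs (λ x → ∑ (tuples (suc k) xs) (λ w → indicator (g w ∧ g (w [ j ]≔ x))))
    ≡⟨ ∑-swap xs (tuples (suc k) xs) (λ x w → indicator (g w ∧ g (w [ j ]≔ x))) ⟩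
  ∑ (tuples (suc k) xs) (λ w → ∑ xs (λ x → indicator (g w ∧ g (w [ j ]≔ x))))
    ≡⟨ ∑-tuples-insertAt xs j _ ⟩
  ∑ (tuples k xs) (λ r → ∑ xs (λ v → ∑ xs (λ x → indicator (g (insertAt r j v) ∧ g (insertAt r j v [ j ]≔ x)))))
    ≡⟨ ∑-cong (tuples k xs) square ⟩
  ∑ (tuples k xs) (λ r → count (λ v → g (insertAt r j v)) xs * count (λ v → g (insertAt r j v)) xs) ∎
  where
  open ≡-Reasoning
  square : ∀ r → ∑ xs (λ v → ∑ xs (λ x → indicator (g (insertAt r j v) ∧ g (insertAt r j v [ j ]≔ x)))) ≡
                 count (λ v → g (insertAt r j v)) xs * count (λ v → g (insertAt r j v)) xs
  square r = begin
    _ ≡⟨ ∑-cong xs (λ v → ∑-cong xs (λ x → trans (indicator-∧ (g (insertAt r j v)) _)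
           (trans (cong (λ z → indicator (g (insertAt r j v)) * indicator (g z)) (insertAt-[]≔ r j v x)) (*-comm (indicator (g (insertAt r j v))) _)))) ⟩
    ∑ xs (λ v → ∑ xs (λ x → indicator (g (insertAt r j x)) * indicator (g (insertAt r j v))))
      ≡⟨ ∑-cong xs (λ v → trans (∑-cong xs (λ x → *-comm (indicator (g (insertAt r j x))) _)) (trans (∑-*ˡ xs (indicator (g (insertAt r j v))) _) (*-comm _ P))) ⟩
    ∑ xs (λ v → P * indicator (g (insertAt r j v)))
      ≡⟨ ∑-*ˡ xs P _ ⟩
    P * P ∎
    where P = count (λ v → g (insertAt r j v)) xs

-- Supersaturation for blow-ups, one clone at a time: squaring the number of admissible entries at
-- position j keeps the proportion positive, so for many x the predicate `g w ∧ g (w [ j ]≔ x)` is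
-- dense, and the remaining clones are added to that predicate.
clone-dense : ∀ {k m} (js : Vec (Fin (suc k)) m) d → 1 ≤ d → ∃ λ c → 1 ≤ c ×
  ∀ {A : Set} (xs : List A) g → length xs ^ suc k ≤ d * count g (tuples (suc k) xs) →
  length xs ^ suc k * length xs ^ m ≤ c * ∑ (tuples (suc k) xs) (λ w → count (Clone js g w) (tuples m xs))
clone-dense {k = k} [] d 1≤d = d , 1≤d , λ xs g le →
  ≤-trans (≤-reflexive (*-identityʳ _))
    (≤-trans le (*-monoʳ-≤ d (≤-reflexive (∑-cong (tuples (suc k) xs) (λ w → sym (+-identityʳ _))))))
clone-dense {k = k} {m = suc m} (j ∷ js) d 1≤d = c , *-mono-≤ (≤-trans 1≤d₁ (m≤m+n d₁ d₁)) 1≤c′ , dense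
  where
  e d₁ : ℕ
  e  = d + d
  -- A 1 / e share of the tuples r has `p r ≥ N / e`; the share and the square of the bound together
  -- lose e · e² in `∑U`.
  d₁ = e * (e * e)
  1≤e : 1 ≤ e
  1≤e = ≤-trans 1≤d (m≤m+n d d)
  1≤d₁ : 1 ≤ d₁
  1≤d₁ = *-mono-≤ 1≤e (*-mono-≤ 1≤e 1≤e)
  ih = clone-dense js (d₁ + d₁) (≤-trans 1≤d₁ (m≤m+n d₁ d₁))
  c′ = proj₁ ih
  1≤c′ = proj₁ (proj₂ ih)
  c = (d₁ + d₁) * c′
  dense : ∀ {A : Set} (xs : List A) g → length xs ^ suc k ≤ d * count g (tuples (suc k) xs) →
    length xs ^ suc k * length xs ^ suc m ≤ c * ∑ (tuples (suc k) xs) (λ w → count (Clone (j ∷ js) g w) (tuples (suc m) xs))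
  dense {A} xs g le = begin
    N ^ suc k * N ^ suc m                  ≡⟨ shuffle (N ^ suc k) N (N ^ m) ⟩
    N * (N ^ suc k * N ^ m)                ≤⟨ *-monoˡ-≤ _ many-x ⟩
    ((d₁ + d₁) * #good) * (N ^ suc k * N ^ m) ≡⟨ *-assoc (d₁ + d₁) #good _ ⟩
    (d₁ + d₁) * (#good * (N ^ suc k * N ^ m)) ≤⟨ *-monoʳ-≤ (d₁ + d₁) (∑-restrict xs (λ x → c′ * T x) _ good (λ x _ ok → proj₂ (proj₂ ih) xs (gₓ x) (≤ᵈ-true ok))) ⟩
    (d₁ + d₁) * ∑ xs (λ x → c′ * T x)      ≡⟨ cong ((d₁ + d₁) *_) (∑-*ˡ xs c′ T) ⟩
    (d₁ + d₁) * (c′ * ∑ xs T)              ≡⟨ *-assoc (d₁ + d₁) c′ _ ⟨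
    c * ∑ xs T                             ≡⟨ cong (c *_) (∑-swap xs (tuples (suc k) xs) (λ x w → count (Clone js (gₓ x) w) (tuples m xs))) ⟩
    c * ∑ (tuples (suc k) xs) (λ w → ∑ xs (λ x → count (Clone js (gₓ x) w) (tuples m xs)))
      ≡⟨ cong (c *_) (∑-cong (tuples (suc k) xs) (λ w → ∑-tuples-suc xs (λ f → indicator (Clone (j ∷ js) g w f)))) ⟨
    c * ∑ (tuples (suc k) xs) (λ w → count (Clone (j ∷ js) g w) (tuples (suc m) xs)) ∎
    where
    open ≤-Reasoning
    N = length xs
    gₓ : A → Vec A (suc k) → Bool
    gₓ x w = g w ∧ g (w [ j ]≔ x)
    T U : A → ℕ
    T x = ∑ (tuples (suc k) xs) (λ w → count (Clone js (gₓ x) w) (tuples m xs))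
    U x = count (gₓ x) (tuples (suc k) xs)
    p : Vec A k → ℕ
    p r = count (λ v → g (insertAt r j v)) xs
    shuffle : ∀ a b c → a * (b * c) ≡ b * (a * c)
    shuffle = solve-∀
    many-r : N ^ k ≤ e * count (λ r → N ≤ᵈ e * p r) (tuples k xs)
    many-r = subst (_≤ e * count (λ r → N ≤ᵈ e * p r) (tuples k xs)) (length-tuples k xs)
      (popular (tuples k xs) p N d (λ r _ → count≤length _ xs) 1≤d
        (begin
          length (tuples k xs) * N ≡⟨ cong (_* N) (length-tuples k xs) ⟩
          N ^ k * N                ≡⟨ *-comm (N ^ k) N ⟩
          N ^ suc k                ≤⟨ le ⟩
          d * count g (tuples (suc k) xs) ≡⟨ cong (d *_) (∑-tuples-insertAt xs j _) ⟩
          d * ∑ (tuples k xs) p    ∎))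
    ∑U : N * N ^ suc k ≤ d₁ * ∑ xs U
    ∑U = begin
      N * (N * N ^ k)          ≡⟨ reorder N (N ^ k) ⟩
      N ^ k * (N * N)          ≤⟨ *-monoˡ-≤ (N * N) many-r ⟩
      (e * #r) * (N * N)       ≡⟨ *-assoc e #r _ ⟩
      e * (#r * (N * N))       ≤⟨ *-monoʳ-≤ e (∑-restrict (tuples k xs) (λ r → (e * e) * (p r * p r)) (N * N) _ (λ r _ ok →
                                    ≤-trans (*-mono-≤ (≤ᵈ-true {N} {e * p r} ok) (≤ᵈ-true {N} {e * p r} ok)) (≤-reflexive (sq e (p r))))) ⟩
      e * ∑ (tuples k xs) (λ r → (e * e) * (p r * p r)) ≡⟨ cong (e *_) (∑-*ˡ (tuples k xs) (e * e) _) ⟩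
      e * ((e * e) * ∑ (tuples k xs) (λ r → p r * p r)) ≡⟨ *-assoc e (e * e) _ ⟨
      d₁ * ∑ (tuples k xs) (λ r → p r * p r)            ≡⟨ cong (d₁ *_) (double-count xs j g) ⟨
      d₁ * ∑ xs U              ∎
      where
      #r = count (λ r → N ≤ᵈ e * p r) (tuples k xs)
      reorder : ∀ a b → a * (a * b) ≡ b * (a * a)
      reorder = solve-∀
      sq : ∀ a b → (a * b) * (a * b) ≡ (a * a) * (b * b)
      sq = solve-∀
    good : A → Bool
    good x = N ^ suc k ≤ᵈ (d₁ + d₁) * U x
    #good = count good xs
    many-x : N ≤ (d₁ + d₁) * #good
    many-x = popular xs U (N ^ suc k) d₁
      (λ x _ → ≤-trans (count≤length _ (tuples (suc k) xs)) (≤-reflexive (length-tuples (suc k) xs))) 1≤d₁ ∑U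

Choice : ∀ {k m} → Vec (Fin k) m → Vec A k → Vec A m → Vec A k → Set
Choice js w f w′ = ∀ i → lookup w′ i ≡ lookup w i ⊎ ∃ λ u → lookup js u ≡ i × lookup f u ≡ lookup w′ i

lookup-ext : ∀ {k} {v w : Vec A k} → (∀ i → lookup v i ≡ lookup w i) → v ≡ w
lookup-ext {v = []}    {[]}    h = refl
lookup-ext {v = x ∷ v} {y ∷ w} h = cong₂ _∷_ (h zero) (lookup-ext (h ∘ suc))

clone-sound : ∀ {k m} (js : Vec (Fin k) m) (g : Vec A k → Bool) w f → Clone js g w f ≡ true →
              ∀ w′ → Choice js w f w′ → g w′ ≡ true
clone-sound [] g w [] ok w′ ch = trans (cong g (lookup-ext original)) ok
  where
  original : ∀ i → lookup w′ i ≡ lookup w i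
  original i with ch i
  ... | inj₁ e = e
clone-sound {A = A} {k = k} (j ∷ js) g w (x ∷ f) ok w′ ch = at-j (ch j)
  where
  elsewhere : ∀ i → i ≢ j → lookup w′ i ≡ lookup w i ⊎ ∃ λ u → lookup js u ≡ i × lookup f u ≡ lookup w′ i
  elsewhere i i≢j with ch i
  ... | inj₁ e                = inj₁ e
  ... | inj₂ (zero  , e , _)  = contradiction (sym e) i≢j
  ... | inj₂ (suc u , e , e′) = inj₂ (u , e , e′)
  unreplaced : (lookup w′ j ≡ lookup w j ⊎ ∃ λ u → lookup js u ≡ j × lookup f u ≡ lookup w′ j) → g w′ ≡ true
  unreplaced c = proj₁ (∧-true (clone-sound js _ w f ok w′ choice))
    where
    choice : Choice js w f w′
    choice i with i Fin.≟ j
    ... | yes refl = c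
    ... | no  i≢j  = elsewhere i i≢j
  at-j : (lookup w′ j ≡ lookup w j ⊎ ∃ λ u → lookup (j ∷ js) u ≡ j × lookup (x ∷ f) u ≡ lookup w′ j) → g w′ ≡ true
  at-j (inj₁ e)                = unreplaced (inj₁ e)
  at-j (inj₂ (suc u , e , e′)) = unreplaced (inj₂ (u , e , e′))
  at-j (inj₂ (zero  , _ , e))  = trans (cong g (sym restore)) (proj₂ (∧-true (clone-sound js _ w f ok w″ choice)))
    where
    -- Here w′ uses the clone x at position j. With the original entry put back, w″ is reached by
    -- the remaining clones alone, and the second conjunct at w″ is `g w′`.
    w″ = w′ [ j ]≔ lookup w j
    restore : w″ [ j ]≔ x ≡ w′
    restore = lookup-ext eq
      where
      eq : ∀ i → lookup (w″ [ j ]≔ x) i ≡ lookup w′ i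
      eq i with i Fin.≟ j
      ... | yes refl = trans (Vecₚ.lookup∘update j w″ x) e
      ... | no  i≢j  = trans (Vecₚ.lookup∘update′ i≢j w″ x) (Vecₚ.lookup∘update′ i≢j w′ _)
    choice : Choice js w f w″
    choice i with i Fin.≟ j
    ... | yes refl = inj₁ (Vecₚ.lookup∘update j w′ _)
    ... | no  i≢j rewrite Vecₚ.lookup∘update′ i≢j w′ (lookup w j) = elsewhere i i≢j

-- Interchangeable vertices

module _ (E : A → A → Bool) where

  chain : ∀ {k} → A → Vec A k → Bool
  chain v []      = true
  chain v (x ∷ w) = E v x ∧ chain x w

  -- In the application the root of H sits on a prescribed vertex outside the walk. D marks the
  -- vertices to which that vertex points, and a supplies the other vertices of H on the level of
  -- the root.
  forked : ∀ {k} → (A → Bool) → Vec A (2 + k) → Bool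
  forked D (a ∷ b ∷ w) = D b ∧ (E a b ∧ chain b w)

  chain-edge : ∀ {k} v (w : Vec A k) → chain v w ≡ true → ∀ (i j : Fin (suc k)) → toℕ j ≡ suc (toℕ i) →
               E (lookup (v ∷ w) i) (lookup (v ∷ w) j) ≡ true
  chain-edge v (x ∷ w) ok zero    (suc zero) e = proj₁ (∧-true ok)
  chain-edge v (x ∷ w) ok (suc i) (suc j)    e = chain-edge x w (proj₂ (∧-true {E v x} ok)) i j (suc-injective e)

  forked-edge : ∀ {k} D (w : Vec A (2 + k)) → forked D w ≡ true → ∀ i j → toℕ j ≡ suc (toℕ i) →
                E (lookup w i) (lookup w j) ≡ true
  forked-edge D (a ∷ b ∷ w) ok = chain-edge a (b ∷ w) (proj₂ (∧-true {D b} ok))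

  forked-second : ∀ {k} D (w : Vec A (2 + k)) → forked D w ≡ true → D (lookup w (suc zero)) ≡ true
  forked-second D (a ∷ b ∷ w) ok = proj₁ (∧-true ok)

  chain-count : ∀ P (xs : List A) → (∀ v → length xs ≤ P * count (E v) xs) →
                ∀ k v → length xs ^ k ≤ P ^ k * count (chain {k} v) (tuples k xs)
  chain-count P xs out zero    v = ≤-refl
  chain-count P xs out (suc k) v = begin
    N * N ^ k                                    ≤⟨ *-monoˡ-≤ (N ^ k) (out v) ⟩
    P * count (E v) xs * N ^ k                   ≡⟨ *-assoc P _ _ ⟩
    P * (count (E v) xs * N ^ k)                 ≤⟨ *-monoʳ-≤ P (∑-restrict xs (λ x → P ^ k * F x) (N ^ k) (E v) step) ⟩
    P * ∑ xs (λ x → P ^ k * F x)                 ≡⟨ cong (P *_) (∑-*ˡ xs (P ^ k) F) ⟩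
    P * (P ^ k * ∑ xs F)                         ≡⟨ *-assoc P (P ^ k) _ ⟨
    P ^ suc k * ∑ xs F                           ≡⟨ cong (P ^ suc k *_) (∑-tuples-suc xs (λ w → indicator (chain {suc k} v w))) ⟨
    P ^ suc k * count (chain v) (tuples (suc k) xs) ∎
    where
    open ≤-Reasoning
    N = length xs
    F : A → ℕ
    F x = ∑ (tuples k xs) (λ w → indicator (E v x ∧ chain x w))
    step : ∀ x → x ∈ xs → E v x ≡ true → N ^ k ≤ P ^ k * F x
    step x _ e = ≤-trans (chain-count P xs out k x) (*-monoʳ-≤ (P ^ k) (count-mono (tuples k xs) (λ w → true-∧ e)))

  forked-count : ∀ P (xs : List A) D → (∀ v → length xs ≤ P * count (E v) xs) →
                 (∀ v → length xs ≤ P * count (λ u → E u v) xs) → length xs ≤ P * count D xs →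
                 ∀ k → length xs ^ (2 + k) ≤ P ^ (2 + k) * count (forked D) (tuples (2 + k) xs)
  forked-count P xs D out inn manyD k = begin
    N * (N * N ^ k)                        ≤⟨ *-monoˡ-≤ (N * N ^ k) manyD ⟩
    P * count D xs * (N * N ^ k)           ≡⟨ *-assoc P _ _ ⟩
    P * (count D xs * (N * N ^ k))         ≤⟨ *-monoʳ-≤ P (∑-restrict xs (λ b → P ^ suc k * F b) (N * N ^ k) D (λ b _ → at b)) ⟩
    P * ∑ xs (λ b → P ^ suc k * F b)       ≡⟨ cong (P *_) (∑-*ˡ xs (P ^ suc k) F) ⟩
    P * (P ^ suc k * ∑ xs F)               ≡⟨ *-assoc P (P ^ suc k) _ ⟨
    P ^ (2 + k) * ∑ xs F                   ≡⟨ cong (P ^ (2 + k) *_) (∑-swap xs xs (λ b a → f a b)) ⟩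
    P ^ (2 + k) * ∑ xs (λ a → ∑ xs (f a))  ≡⟨ cong (P ^ (2 + k) *_) (trans (∑-tuples-suc xs g) (∑-cong xs (λ a → ∑-tuples-suc xs (λ w → g (a ∷ w))))) ⟨
    P ^ (2 + k) * count (forked D) (tuples (2 + k) xs) ∎
    where
    open ≤-Reasoning
    N = length xs
    g : Vec A (2 + k) → ℕ
    g w = indicator (forked D w)
    f : A → A → ℕ
    f a b = ∑ (tuples k xs) (λ w → indicator (D b ∧ (E a b ∧ chain b w)))
    F : A → ℕ
    F b = ∑ xs (λ a → f a b)
    at : ∀ b → D b ≡ true → N * N ^ k ≤ P ^ suc k * F b
    at b d = begin
      N * N ^ k                               ≤⟨ *-monoˡ-≤ (N ^ k) (inn b) ⟩
      P * count (λ a → E a b) xs * N ^ k      ≡⟨ *-assoc P _ _ ⟩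
      P * (count (λ a → E a b) xs * N ^ k)    ≤⟨ *-monoʳ-≤ P (∑-restrict xs (λ a → P ^ k * f a b) (N ^ k) (λ a → E a b)
                                                   (λ a _ e → ≤-trans (chain-count P xs out k b) (*-monoʳ-≤ (P ^ k) (count-mono (tuples k xs) (λ w c → true-∧ d (true-∧ e c)))))) ⟩
      P * ∑ xs (λ a → P ^ k * f a b)          ≡⟨ cong (P *_) (∑-*ˡ xs (P ^ k) _) ⟩
      P * (P ^ k * F b)                       ≡⟨ *-assoc P (P ^ k) _ ⟨
      P ^ suc k * F b                         ∎

argmin : ∀ {m} (f : Fin (suc m) → ℕ) → ∃ λ r → ∀ u → f r ≤ f u
argmin {zero}  f = zero , λ { zero → ≤-refl }
argmin {suc m} f with r , min ← argmin (f ∘ suc) with ≤-total (f zero) (f (suc r))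
... | inj₁ le = zero  , λ { zero → ≤-refl ; (suc u) → ≤-trans le (min u) }
... | inj₂ le = suc r , λ { zero → le     ; (suc u) → min u }

data PunchView {m} (r : Fin (suc m)) : Fin (suc m) → Set where
  hole  : PunchView r r
  other : ∀ u → PunchView r (punchIn r u)

punchView : ∀ {m} (r a : Fin (suc m)) → PunchView r a
punchView r a with r Fin.≟ a
... | yes refl = hole
... | no  r≢a  = subst (PunchView r) (punchIn-punchOut r≢a) (other (punchOut r≢a))

module _ {h} (EH : Fin (suc h) → Fin (suc h) → Bool) (lev : Fin (suc h) → ℕ) (K : ℕ)
         (lev≤K : ∀ u → lev u ≤ K) (lev-edge : ∀ u v → EH u v ≡ true → lev v ≡ suc (lev u)) where

  root : Fin (suc h)
  root = proj₁ (argmin lev)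

  root-min : ∀ u → lev root ≤ lev u
  root-min = proj₂ (argmin lev)

  -- S lists the images of all vertices but the root. The level of the root is minimal, so all its
  -- edges leave it, and the vertex placed there is felt only through D.
  CompletesRoot : (A → A → Bool) → (A → Bool) → Vec A h → Set
  CompletesRoot E D S =
    (∀ u v → EH (punchIn root u) (punchIn root v) ≡ true → E (lookup S u) (lookup S v) ≡ true) ×
    (∀ v → EH root (punchIn root v) ≡ true → D (lookup S v) ≡ true)

  completesRoot⇒hom : ∀ (E : A → A → Bool) D S x → CompletesRoot E D S → (∀ u → D u ≡ true → E x u ≡ true) →
                      ∀ a b → EH a b ≡ true → E (lookup (insertAt S root x) a) (lookup (insertAt S root x) b) ≡ true
  completesRoot⇒hom E D S x (inner , fromRoot) D⇒ a b e with punchView root a | punchView root b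
  ... | _       | hole    = contradiction (subst (_≤ lev a) (lev-edge a root e) (root-min a)) (<-irrefl refl)
  ... | hole    | other v rewrite Vecₚ.insertAt-lookup S root x | Vecₚ.insertAt-punchIn S root x v = D⇒ _ (fromRoot v e)
  ... | other u | other v rewrite Vecₚ.insertAt-punchIn S root x u | Vecₚ.insertAt-punchIn S root x v = inner u v e

  -- Each vertex of H other than the root gets its own clone of the walk's vertex on its layer.
  -- Whether these clones complete the root does not depend on the walk they came from, so each S is
  -- counted at most N ^ (2 + K) times, and that factor cancels.
  completesRoot-dense : ∀ P → 1 ≤ P → ∃ λ c → 1 ≤ c × ∀ {A : Set} (xs : List A) E D (ψ : Vec A h → Bool) → 1 ≤ length xs →
    (∀ v → length xs ≤ P * count (E v) xs) → (∀ v → length xs ≤ P * count (λ u → E u v) xs) →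
    length xs ≤ P * count D xs → (∀ S → CompletesRoot E D S → ψ S ≡ true) →
    length xs ^ h ≤ c * count ψ (tuples h xs)
  completesRoot-dense P 1≤P = proj₁ dense , proj₁ (proj₂ dense) , λ xs E D ψ 1≤N out inn manyD sound →
    let N = length xs in
    *-cancelˡ-≤ (N ^ (2 + K)) ⦃ m^n≢0 N (2 + K) ⦃ >-nonZero 1≤N ⦄ ⦄ (begin
      N ^ (2 + K) * N ^ h
        ≤⟨ proj₂ (proj₂ dense) xs (forked E D) (forked-count E P xs D out inn manyD K) ⟩
      proj₁ dense * ∑ (tuples (2 + K) xs) (λ w → count (Clone js (forked E D) w) (tuples h xs))
        ≤⟨ *-monoʳ-≤ (proj₁ dense) (∑-mono (tuples (2 + K) xs) (λ w → count-mono (tuples h xs) (λ S ok → sound S (completes E D w S ok)))) ⟩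
      proj₁ dense * ∑ (tuples (2 + K) xs) (λ w → count ψ (tuples h xs))
        ≡⟨ cong (proj₁ dense *_) (trans (∑-const (tuples (2 + K) xs) _) (cong (_* count ψ (tuples h xs)) (length-tuples (2 + K) xs))) ⟩
      proj₁ dense * (N ^ (2 + K) * count ψ (tuples h xs))
        ≡⟨ shuffle (proj₁ dense) (N ^ (2 + K)) _ ⟩
      N ^ (2 + K) * (proj₁ dense * count ψ (tuples h xs)) ∎)
    where
    open ≤-Reasoning
    shuffle : ∀ a b c → a * (b * c) ≡ b * (a * c)
    shuffle = solve-∀
    layer : Fin (suc h) → Fin (2 + K)
    -- Levels relative to the root put its out-neighbours on layer 1, where `forked` imposes D; the
    -- length 2 + K provides this layer for every K.
    layer u = Fin.fromℕ< {lev u ∸ lev root} (s≤s (m≤n⇒m≤1+n (≤-trans (m∸n≤m (lev u) (lev root)) (lev≤K u))))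
    toℕ-layer : ∀ u → toℕ (layer u) ≡ lev u ∸ lev root
    toℕ-layer u = toℕ-fromℕ< _
    js : Vec (Fin (2 + K)) h
    js = Vec.tabulate (λ u → layer (punchIn root u))
    dense = clone-dense js (P ^ (2 + K)) (m^n>0 P ⦃ >-nonZero 1≤P ⦄ (2 + K))
    js-layer : ∀ u → lookup js u ≡ layer (punchIn root u)
    js-layer = Vecₚ.lookup∘tabulate _
    completes : ∀ {A : Set} (E : A → A → Bool) D w S → Clone js (forked E D) w S ≡ true → CompletesRoot E D S
    completes {A} E D w S ok = inner , fromRoot
      where
      step : ∀ {a b} → EH a b ≡ true → toℕ (layer b) ≡ suc (toℕ (layer a))
      step {a} {b} e = trans (toℕ-layer b) (trans (cong (_∸ lev root) (lev-edge a b e))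
                         (trans (+-∸-assoc 1 (root-min a)) (cong suc (sym (toℕ-layer a)))))
      -- The ends of an edge of H lie on different layers, so both fit into one walk, which is
      -- forked again by the choice of the clones.
      replace : Fin h → Fin h → Vec A (2 + K)
      replace u v = w [ layer (punchIn root u) ]≔ lookup S u [ layer (punchIn root v) ]≔ lookup S v
      choice : ∀ u v → Choice js w S (replace u v)
      choice u v i with i Fin.≟ layer (punchIn root v)
      ... | yes refl = inj₂ (v , js-layer v , sym (Vecₚ.lookup∘update i (w [ layer (punchIn root u) ]≔ lookup S u) _))
      ... | no  i≢ with i Fin.≟ layer (punchIn root u)
      ...   | yes refl = inj₂ (u , js-layer u , sym (trans (Vecₚ.lookup∘update′ i≢ (w [ i ]≔ lookup S u) _) (Vecₚ.lookup∘update i w _)))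
      ...   | no  i≢′  = inj₁ (trans (Vecₚ.lookup∘update′ i≢ (w [ layer (punchIn root u) ]≔ lookup S u) _) (Vecₚ.lookup∘update′ i≢′ w _))
      holds : ∀ u v → forked E D (replace u v) ≡ true
      holds u v = clone-sound js (forked E D) w S ok (replace u v) (choice u v)
      inner : ∀ u v → EH (punchIn root u) (punchIn root v) ≡ true → E (lookup S u) (lookup S v) ≡ true
      inner u v e = subst₂ (λ a b → E a b ≡ true) at-u (Vecₚ.lookup∘update lv (w [ lu ]≔ lookup S u) _)
                      (forked-edge E D (replace u v) (holds u v) lu lv (step e))
        where
        lu = layer (punchIn root u)
        lv = layer (punchIn root v)
        lu≢lv : lu ≢ lv
        lu≢lv eq = <-irrefl (cong toℕ eq) (≤-reflexive (sym (step e)))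
        at-u : lookup (replace u v) lu ≡ lookup S u
        at-u = trans (Vecₚ.lookup∘update′ lu≢lv (w [ lu ]≔ lookup S u) _) (Vecₚ.lookup∘update lu w _)
      fromRoot : ∀ v → EH root (punchIn root v) ≡ true → D (lookup S v) ≡ true
      fromRoot v e = subst (λ a → D a ≡ true) at-v (forked-second E D (replace v v) (holds v v))
        where
        lv = layer (punchIn root v)
        second : lv ≡ suc zero
        second = toℕ-injective (trans (step e) (cong suc (trans (toℕ-layer root) (n∸n≡0 (lev root)))))
        at-v : lookup (replace v v) (suc zero) ≡ lookup S v
        at-v = subst (λ i → lookup (replace v v) i ≡ lookup S v) second (Vecₚ.lookup∘update lv (w [ lv ]≔ lookup S v) _)

-- Consequences of the degree condition

degreeIn : ∀ {n} → Digraph n → Fin n → List (Fin n) → ℕ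
degreeIn G v xs = count (λ u → adj G u v) xs + count (adj G v) xs

-- A degree of (1 + 1 / P) |xs| with denominators cleared. It is imposed on all vertices of G, also
-- outside `xs`, because gadgets chosen inside `xs` have to absorb arbitrary vertices.
record Dense {n} (P : ℕ) (G : Digraph n) (xs : List (Fin n)) : Set where
  constructor mkDense
  field min-degree : ∀ v → suc P * length xs ≤ P * degreeIn G v xs
open Dense public

module _ {n} {G : Digraph n} {P} {xs : List (Fin n)} (dense : Dense P G xs) where

  private
    N = length xs

  dense⇒out : ∀ v → N ≤ P * count (adj G v) xs
  dense⇒out v = +-cancelʳ-≤ (P * N) N _ (begin
    N + P * N                                                    ≤⟨ min-degree dense v ⟩
    P * degreeIn G v xs                                          ≡⟨ *-distribˡ-+ P (count (λ u → adj G u v) xs) _ ⟩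
    P * count (λ u → adj G u v) xs + P * count (adj G v) xs      ≤⟨ +-monoˡ-≤ _ (*-monoʳ-≤ P (count≤length (λ u → adj G u v) xs)) ⟩
    P * N + P * count (adj G v) xs                               ≡⟨ +-comm (P * N) _ ⟩
    P * count (adj G v) xs + P * N                               ∎)
    where open ≤-Reasoning

  dense⇒in : ∀ v → N ≤ P * count (λ u → adj G u v) xs
  dense⇒in v = +-cancelʳ-≤ (P * N) N _ (begin
    N + P * N                                                    ≤⟨ min-degree dense v ⟩
    P * degreeIn G v xs                                          ≡⟨ *-distribˡ-+ P (count (λ u → adj G u v) xs) _ ⟩
    P * count (λ u → adj G u v) xs + P * count (adj G v) xs      ≤⟨ +-monoʳ-≤ (P * count (λ u → adj G u v) xs) (*-monoʳ-≤ P (count≤length (adj G v) xs)) ⟩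
    P * count (λ u → adj G u v) xs + P * N                       ∎)
    where open ≤-Reasoning

count-∧ : ∀ (p q : A → Bool) xs → count p xs + count q xs ≤ length xs + count (λ x → p x ∧ q x) xs
count-∧ p q xs = begin
  count p xs + count q xs                            ≡⟨ ∑-+ xs _ _ ⟨
  ∑ xs (λ x → indicator (p x) + indicator (q x))     ≤⟨ ∑-mono xs (λ x → incl (p x) (q x)) ⟩
  ∑ xs (λ x → 1 + indicator (p x ∧ q x))             ≡⟨ ∑-+ xs _ _ ⟩
  ∑ xs (λ _ → 1) + count (λ x → p x ∧ q x) xs        ≡⟨ cong (_+ count (λ x → p x ∧ q x) xs) (sym (length≡count xs)) ⟩
  length xs + count (λ x → p x ∧ q x) xs             ∎
  where
  open ≤-Reasoning
  incl : ∀ a b → indicator a + indicator b ≤ 1 + indicator (a ∧ b)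
  incl true  b     = ≤-refl
  incl false true  = ≤-refl
  incl false false = z≤n

-- The degrees of x and y add up to more than 2N, so the out-degrees or the in-degrees add up to more than N.
common-neighbours : ∀ {n} {G : Digraph n} {P} {xs : List (Fin n)} → Dense P G xs → ∀ x y →
  length xs ≤ P * count (λ u → adj G x u ∧ adj G y u) xs ⊎ length xs ≤ P * count (λ u → adj G u x ∧ adj G u y) xs
common-neighbours {G = G} {P} {xs} dense x y with length xs ≤? P * count (λ u → adj G x u ∧ adj G y u) xs
... | yes le = inj₁ le
... | no nle = inj₂ (+-cancelˡ-≤ (P * N + P * N + N) _ _ (begin
  P * N + P * N + N + N                  ≡⟨ arith₁ P N ⟩
  suc P * N + suc P * N                  ≤⟨ +-mono-≤ (min-degree dense x) (min-degree dense y) ⟩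
  P * (ix + ox) + P * (iy + oy)          ≡⟨ arith₂ P ix ox iy oy ⟩
  P * (ox + oy) + P * (ix + iy)          ≤⟨ +-mono-≤ (*-monoʳ-≤ P (count-∧ (adj G x) (adj G y) xs)) (*-monoʳ-≤ P (count-∧ (λ u → adj G u x) (λ u → adj G u y) xs)) ⟩
  P * (N + co) + P * (N + ci)            ≡⟨ arith₃ P N co ci ⟩
  P * N + P * N + P * co + P * ci        ≤⟨ +-monoˡ-≤ (P * ci) (+-monoʳ-≤ (P * N + P * N) (<⇒≤ (≰⇒> nle))) ⟩
  P * N + P * N + N + P * ci             ∎))
  where
  open ≤-Reasoning
  N  = length xs
  ix = count (λ u → adj G u x) xs
  ox = count (adj G x) xs
  iy = count (λ u → adj G u y) xs
  oy = count (adj G y) xs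
  co = count (λ u → adj G x u ∧ adj G y u) xs
  ci = count (λ u → adj G u x ∧ adj G u y) xs
  arith₁ : ∀ P N → P * N + P * N + N + N ≡ (1 + P) * N + (1 + P) * N
  arith₁ = solve-∀
  arith₂ : ∀ P a b c d → P * (a + b) + P * (c + d) ≡ P * (b + d) + P * (a + c)
  arith₂ = solve-∀
  arith₃ : ∀ P N a b → P * (N + a) + P * (N + b) ≡ P * N + P * N + P * a + P * b
  arith₃ = solve-∀

-- Copies of H and the exchange of two vertices

does-true : ∀ {X : Set} (d : Dec X) → does d ≡ true → X
does-true (yes x) _ = x

module _ {h n} (H : Digraph h) (G : Digraph n) where

  IsCopy : Vec (Fin n) h → Set
  IsCopy v = IsHom H G (lookup v)

  isCopy? : ∀ v → Dec (IsCopy v)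
  isCopy? v = Finₚ.all? λ a → Finₚ.all? λ b → (adj H a b Boolₚ.≟ true) →-dec (adj G (lookup v a) (lookup v b) Boolₚ.≟ true)

  copyᵇ : Vec (Fin n) h → Bool
  copyᵇ v = does (isCopy? v)

  copyᵇ⇒ : ∀ {v} → copyᵇ v ≡ true → IsCopy v
  copyᵇ⇒ {v} e = does-true (isCopy? v) e

  ⇒copyᵇ : ∀ {v} → IsCopy v → copyᵇ v ≡ true
  ⇒copyᵇ {v} c = dec-true (isCopy? v) c

exchanges : ∀ {h n} (H : Digraph (suc h)) (G : Digraph n) → Fin (suc h) → Fin n → Fin n → Vec (Fin n) h → Bool
exchanges H G z x y S = copyᵇ H G (insertAt S z x) ∧ copyᵇ H G (insertAt S z y)

module _ {h} (H : Digraph (suc h)) (path : HomToDirectedPath H) where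

  private
    K = proj₁ path
    φ = proj₁ (proj₂ path)

    lev lev′ : Fin (suc h) → ℕ
    lev  u = toℕ (φ u)
    lev′ u = K ∸ toℕ (φ u)

    lev≤ : ∀ u → lev u ≤ K
    lev≤ u = <⇒≤ (toℕ<n (φ u))

    lev′≤ : ∀ u → lev′ u ≤ K
    lev′≤ u = m∸n≤m K (toℕ (φ u))

    lev-edge : ∀ u v → adj H u v ≡ true → lev v ≡ suc (lev u)
    lev-edge = proj₂ (proj₂ path)

    lev′-edge : ∀ u v → flip (adj H) u v ≡ true → lev′ v ≡ suc (lev′ u)
    lev′-edge u v e = trans (+-∸-assoc 1 {K} {suc (lev v)} (subst (_≤ K) (lev-edge v u e) (lev≤ u)))
                            (cong suc (cong (K ∸_) (sym (lev-edge v u e))))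

    out-root in-root : Fin (suc h)
    out-root = root (adj H) lev K lev≤ lev-edge
    in-root  = root (flip (adj H)) lev′ K lev′≤ lev′-edge

  exchange-out : ∀ P → 1 ≤ P → ∃ λ c → 1 ≤ c × ∀ {n} (G : Digraph n) xs → 1 ≤ length xs → Dense P G xs → ∀ x y →
                 length xs ≤ P * count (λ u → adj G x u ∧ adj G y u) xs →
                 length xs ^ h ≤ c * count (exchanges H G out-root x y) (tuples h xs)
  exchange-out P 1≤P = proj₁ dns , proj₁ (proj₂ dns) , λ {n} → count-both {n}
    where
    dns = completesRoot-dense (adj H) lev K lev≤ lev-edge P 1≤P
    count-both : ∀ {n} (G : Digraph n) xs → 1 ≤ length xs → Dense P G xs → ∀ x y →
                 length xs ≤ P * count (λ u → adj G x u ∧ adj G y u) xs →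
                 length xs ^ h ≤ proj₁ dns * count (exchanges H G out-root x y) (tuples h xs)
    count-both {n} G xs 1≤N dense x y common =
      proj₂ (proj₂ dns) xs (adj G) D (exchanges H G out-root x y) 1≤N (dense⇒out dense) (dense⇒in dense) common
        (λ S ok → true-∧ (copy S ok x (λ u d → proj₁ (∧-true d))) (copy S ok y (λ u d → proj₂ (∧-true {adj G x u} d))))
      where
      D : Fin n → Bool
      D u = adj G x u ∧ adj G y u
      copy : ∀ S → CompletesRoot (adj H) lev K lev≤ lev-edge (adj G) D S → ∀ z → (∀ u → D u ≡ true → adj G z u ≡ true) →
             copyᵇ H G (insertAt S out-root z) ≡ true
      copy S ok z D⇒ = ⇒copyᵇ H G {insertAt S out-root z} (completesRoot⇒hom (adj H) lev K lev≤ lev-edge (adj G) D S z ok D⇒)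

  -- The mirror image of `exchange-out`: the edges of H and of G are reversed and levels are counted
  -- from the top, so the root becomes a vertex with maximal φ.
  exchange-in : ∀ P → 1 ≤ P → ∃ λ c → 1 ≤ c × ∀ {n} (G : Digraph n) xs → 1 ≤ length xs → Dense P G xs → ∀ x y →
                length xs ≤ P * count (λ u → adj G u x ∧ adj G u y) xs →
                length xs ^ h ≤ c * count (exchanges H G in-root x y) (tuples h xs)
  exchange-in P 1≤P = proj₁ dns , proj₁ (proj₂ dns) , λ {n} → count-both {n}
    where
    dns = completesRoot-dense (flip (adj H)) lev′ K lev′≤ lev′-edge P 1≤P
    count-both : ∀ {n} (G : Digraph n) xs → 1 ≤ length xs → Dense P G xs → ∀ x y →
                 length xs ≤ P * count (λ u → adj G u x ∧ adj G u y) xs →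
                 length xs ^ h ≤ proj₁ dns * count (exchanges H G in-root x y) (tuples h xs)
    count-both {n} G xs 1≤N dense x y common =
      proj₂ (proj₂ dns) xs (flip (adj G)) D (exchanges H G in-root x y) 1≤N (dense⇒in dense) (dense⇒out dense) common
        (λ S ok → true-∧ (copy S ok x (λ u d → proj₁ (∧-true d))) (copy S ok y (λ u d → proj₂ (∧-true {adj G u x} d))))
      where
      D : Fin n → Bool
      D u = adj G u x ∧ adj G u y
      copy : ∀ S → CompletesRoot (flip (adj H)) lev′ K lev′≤ lev′-edge (flip (adj G)) D S → ∀ z → (∀ u → D u ≡ true → adj G u z ≡ true) →
             copyᵇ H G (insertAt S in-root z) ≡ true
      copy S ok z D⇒ = ⇒copyᵇ H G {insertAt S in-root z}
        (λ a b → completesRoot⇒hom (flip (adj H)) lev′ K lev′≤ lev′-edge (flip (adj G)) D S z ok D⇒ b a)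

  -- Exchange x for itself: the common out-neighbours of x and x are its out-neighbours, and summing
  -- over x counts whole copies of H.
  copies-dense : ∀ P → 1 ≤ P → ∃ λ c → 1 ≤ c × ∀ {n} (G : Digraph n) xs → 1 ≤ length xs → Dense P G xs →
                 length xs ^ suc h ≤ c * count (copyᵇ H G) (tuples (suc h) xs)
  copies-dense P 1≤P = proj₁ ex , proj₁ (proj₂ ex) , λ {n} → dns {n}
    where
    ex = exchange-out P 1≤P
    c = proj₁ ex
    dns : ∀ {n} (G : Digraph n) xs → 1 ≤ length xs → Dense P G xs →
          length xs ^ suc h ≤ c * count (copyᵇ H G) (tuples (suc h) xs)
    dns {n} G xs 1≤N dense = begin
      length xs ^ suc h                           ≡⟨ ∑-const xs (length xs ^ h) ⟨
      ∑ xs (λ _ → length xs ^ h)                  ≤⟨ ∑-mono xs at ⟩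
      ∑ xs (λ x → c * ∑ (tuples h xs) (f x))      ≡⟨ ∑-*ˡ xs c _ ⟩
      c * ∑ xs (λ x → ∑ (tuples h xs) (f x))      ≡⟨ cong (c *_) (∑-swap xs (tuples h xs) f) ⟩
      c * ∑ (tuples h xs) (λ S → ∑ xs (λ x → f x S)) ≡⟨ cong (c *_) (∑-tuples-insertAt xs out-root _) ⟨
      c * count (copyᵇ H G) (tuples (suc h) xs)   ∎
      where
      open ≤-Reasoning
      f : Fin n → Vec (Fin n) h → ℕ
      f x S = indicator (copyᵇ H G (insertAt S out-root x))
      at : ∀ x → length xs ^ h ≤ c * ∑ (tuples h xs) (f x)
      at x = ≤-trans (proj₂ (proj₂ ex) G xs 1≤N dense x x
                       (≤-trans (dense⇒out dense x) (*-monoʳ-≤ P (count-mono xs (λ u e → true-∧ e e)))))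
                     (*-monoʳ-≤ c (count-mono (tuples h xs) (λ S e → proj₁ (∧-true e))))

  -- Whether x and y share out- or in-neighbours varies with the pair, hence so does z. This is why
  -- a gadget records a root for each of its parts.
  exchange : ∀ P → 1 ≤ P → ∃ λ c → 1 ≤ c × ∀ {n} (G : Digraph n) xs → 1 ≤ length xs → Dense P G xs → ∀ x y →
             ∃ λ z → length xs ^ h ≤ c * count (exchanges H G z x y) (tuples h xs)
  exchange P 1≤P = c₁ + c₂ , ≤-trans (proj₁ (proj₂ out)) (m≤m+n c₁ c₂) , either
    where
    out = exchange-out P 1≤P
    inn = exchange-in P 1≤P
    c₁ = proj₁ out
    c₂ = proj₁ inn
    either : ∀ {n} (G : Digraph n) xs → 1 ≤ length xs → Dense P G xs → ∀ x y →
             ∃ λ z → length xs ^ h ≤ (c₁ + c₂) * count (exchanges H G z x y) (tuples h xs)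
    either G xs 1≤N dense x y with common-neighbours dense x y
    ... | inj₁ co = out-root , ≤-trans (proj₂ (proj₂ out) G xs 1≤N dense x y co) (*-monoˡ-≤ (count (exchanges H G out-root x y) (tuples h xs)) (m≤m+n c₁ c₂))
    ... | inj₂ ci = in-root  , ≤-trans (proj₂ (proj₂ inn) G xs 1≤N dense x y ci) (*-monoˡ-≤ (count (exchanges H G in-root x y) (tuples h xs)) (m≤n+m c₂ c₁))

-- Gadgets

∑-tuples-++ : ∀ a b (xs : List A) (f : Vec A (a + b) → ℕ) →
              ∑ (tuples (a + b) xs) f ≡ ∑ (tuples a xs) (λ u → ∑ (tuples b xs) (λ v → f (u Vec.++ v)))
∑-tuples-++ zero    b xs f = sym (+-identityʳ _)
∑-tuples-++ (suc a) b xs f = begin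
  ∑ (tuples (suc a + b) xs) f                                         ≡⟨ ∑-tuples-suc xs f ⟩
  ∑ xs (λ x → ∑ (tuples (a + b) xs) (λ w → f (x ∷ w)))                ≡⟨ ∑-cong xs (λ x → ∑-tuples-++ a b xs (λ w → f (x ∷ w))) ⟩
  _                                                                   ≡⟨ ∑-tuples-suc xs (λ u → ∑ (tuples b xs) (λ v → f (u Vec.++ v))) ⟨
  ∑ (tuples (suc a) xs) (λ u → ∑ (tuples b xs) (λ v → f (u Vec.++ v))) ∎
  where open ≡-Reasoning

∑-tuples-concat : ∀ b k (xs : List A) (f : Vec A (b * k) → ℕ) →
                  ∑ (tuples (b * k) xs) f ≡ ∑ (tuples b (tuples k xs)) (λ w → f (Vec.concat w))
∑-tuples-concat zero    k xs f = refl
∑-tuples-concat (suc b) k xs f = begin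
  ∑ (tuples (k + b * k) xs) f                                             ≡⟨ ∑-tuples-++ k (b * k) xs f ⟩
  ∑ (tuples k xs) (λ u → ∑ (tuples (b * k) xs) (λ v → f (u Vec.++ v)))    ≡⟨ ∑-cong (tuples k xs) (λ u → ∑-tuples-concat b k xs (λ v → f (u Vec.++ v))) ⟩
  _                                                                       ≡⟨ ∑-tuples-suc (tuples k xs) (λ w → f (Vec.concat w)) ⟨
  ∑ (tuples (suc b) (tuples k xs)) (λ w → f (Vec.concat w))               ∎
  where open ≡-Reasoning

remove : ∀ {x : A} {xs} → x ∈ xs → ∃ λ ys → xs ↭ x ∷ ys
remove {xs = y ∷ xs} (here refl) = xs , ↭-refl
remove {xs = y ∷ xs} (there x∈) with ys , p ← remove x∈ = y ∷ ys , ↭-trans (prep y p) (_↭_.swap y _ ↭-refl)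

module _ {n : ℕ} where

  occurrences : Fin n → List (Fin n) → ℕ
  occurrences x xs = count (λ y → does (x Fin.≟ y)) xs

  distinct : List (Fin n) → Bool
  distinct []       = true
  distinct (x ∷ xs) = (occurrences x xs ≤ᵈ 0) ∧ distinct xs

  -- Multiplicities are sums, invariant under `↭` and additive over `++`, so the property passes to
  -- what remains after vertices are split off.
  Simple : List (Fin n) → Set
  Simple xs = ∀ y → occurrences y xs ≤ 1

  -- A union bound over the at most M² pairs of coordinates.
  collisions : ∀ (xs : List (Fin n)) → Simple xs → ∀ M →
               length xs * count (λ w → not (distinct (toList w))) (tuples M xs) ≤ M * M * length xs ^ M
  collisions xs simple zero    = ≤-reflexive (*-zeroʳ (length xs))
  collisions xs simple (suc M) = begin
    N * count (λ w → not (distinct (toList w))) (tuples (suc M) xs)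
      ≡⟨ cong (N *_) (∑-tuples-suc xs (λ w → indicator (not (distinct (toList w))))) ⟩
    N * ∑ xs (λ x → ∑ (tuples M xs) (λ w → indicator (not ((occurrences x (toList w) ≤ᵈ 0) ∧ distinct (toList w)))))
      ≤⟨ *-monoʳ-≤ N (∑-mono xs (λ x → ∑-mono (tuples M xs) (λ w → split (occurrences x (toList w)) (distinct (toList w))))) ⟩
    N * ∑ xs (λ x → ∑ (tuples M xs) (λ w → occurrences x (toList w) + bad w))
      ≡⟨ cong (N *_) (trans (∑-cong xs (λ x → ∑-+ (tuples M xs) (λ w → occurrences x (toList w)) bad)) (∑-+ xs _ _)) ⟩
    N * (∑ xs (λ x → ∑ (tuples M xs) (λ w → occurrences x (toList w))) + ∑ xs (λ x → ∑ (tuples M xs) bad))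
      ≤⟨ *-monoʳ-≤ N (+-mono-≤ hit (≤-reflexive (∑-const xs _))) ⟩
    N * (N ^ M * M + N * ∑ (tuples M xs) bad)
      ≡⟨ *-distribˡ-+ N (N ^ M * M) _ ⟩
    N * (N ^ M * M) + N * (N * ∑ (tuples M xs) bad)
      ≤⟨ +-monoʳ-≤ (N * (N ^ M * M)) (*-monoʳ-≤ N (collisions xs simple M)) ⟩
    N * (N ^ M * M) + N * (M * M * N ^ M)
      ≤⟨ m≤m+n _ (N * N ^ M * (1 + M)) ⟩
    N * (N ^ M * M) + N * (M * M * N ^ M) + N * N ^ M * (1 + M)
      ≡⟨ arith N (N ^ M) M ⟩
    suc M * suc M * N ^ suc M ∎
    where
    open ≤-Reasoning
    N = length xs
    bad : Vec (Fin n) M → ℕ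
    bad w = indicator (not (distinct (toList w)))
    split : ∀ o b → indicator (not ((o ≤ᵈ 0) ∧ b)) ≤ o + indicator (not b)
    split zero    b = ≤-refl
    split (suc o) b = s≤s z≤n
    arith : ∀ N X M → N * (X * M) + N * (M * M * X) + N * X * (1 + M) ≡ (1 + M) * (1 + M) * (N * X)
    arith = solve-∀
    hit : ∑ xs (λ x → ∑ (tuples M xs) (λ w → occurrences x (toList w))) ≤ N ^ M * M
    hit = begin
      ∑ xs (λ x → ∑ (tuples M xs) (λ w → occurrences x (toList w)))
        ≡⟨ ∑-swap xs (tuples M xs) _ ⟩
      ∑ (tuples M xs) (λ w → ∑ xs (λ x → occurrences x (toList w)))
        ≤⟨ ∑-mono (tuples M xs) one ⟩
      ∑ (tuples M xs) (λ _ → M)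
        ≡⟨ trans (∑-const (tuples M xs) M) (cong (_* M) (length-tuples M xs)) ⟩
      N ^ M * M ∎
      where
      flip-≟ : ∀ x y → indicator (does (x Fin.≟ y)) ≡ indicator (does (y Fin.≟ x))
      flip-≟ x y with x Fin.≟ y | y Fin.≟ x
      ... | yes _ | yes _ = refl
      ... | no  _ | no  _ = refl
      ... | yes e | no ¬e = contradiction (sym e) ¬e
      ... | no ¬e | yes e = contradiction (sym e) ¬e
      one : ∀ (w : Vec (Fin n) M) → ∑ xs (λ x → occurrences x (toList w)) ≤ M
      one w = begin
        ∑ xs (λ x → occurrences x (toList w))                          ≡⟨ ∑-swap xs (toList w) _ ⟩
        ∑ (toList w) (λ y → ∑ xs (λ x → indicator (does (x Fin.≟ y)))) ≤⟨ ∑-mono (toList w) (λ y → ≤-trans (≤-reflexive (∑-cong xs (λ x → flip-≟ x y))) (simple y)) ⟩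
        ∑ (toList w) (λ _ → 1)                                         ≡⟨ length≡count (toList w) ⟨
        length (toList w)                                              ≡⟨ Vecₚ.length-toList w ⟩
        M                                                              ∎

  occurs : ∀ {x : Fin n} {xs} → x ∈ xs → 1 ≤ occurrences x xs
  occurs {x} {xs} x∈ = ≤-trans (≤-reflexive (sym (cong indicator (dec-true (x Fin.≟ x) refl)))) (∈⇒≤∑ (λ y → indicator (does (x Fin.≟ y))) x∈)

  distinct-⊆ : ∀ (ys xs : List (Fin n)) → distinct ys ≡ true → All (_∈ xs) ys → ∃ λ zs → xs ↭ ys ++ zs
  distinct-⊆ []       xs d []         = xs , ↭-refl
  distinct-⊆ (y ∷ ys) xs d (y∈ ∷ ys⊆) = proj₁ rest , ↭-trans p (prep y (proj₂ rest))
    where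
    xs′ = proj₁ (remove y∈)
    p   = proj₂ (remove y∈)
    fresh : occurrences y ys ≤ 0
    fresh = ≤ᵈ-true {occurrences y ys} {0} (proj₁ (∧-true d))
    stays : ∀ {x} → x ∈ ys → x ∈ xs′
    stays x∈ with ∈-resp-↭ p (All.lookup ys⊆ x∈)
    ... | here refl  = contradiction (≤-trans (occurs x∈) fresh) λ ()
    ... | there x∈′ = x∈′
    rest = distinct-⊆ ys xs′ (proj₂ (∧-true {occurrences y ys ≤ᵈ 0} d)) (All.tabulate stays)

simple-allFin : ∀ n → Simple (allFin n)
simple-allFin (suc n) zero    = s≤s (≤-reflexive (none n))
  where
  none : ∀ n → occurrences {suc n} zero (List.tabulate suc) ≡ 0
  none n = go n (λ ())
    where
    go : ∀ k {f : Fin k → Fin (suc n)} → (∀ {i} → zero ≢ f i) → occurrences zero (List.tabulate f) ≡ 0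
    go zero    ne = refl
    go (suc k) {f} ne rewrite dec-false (zero Fin.≟ f zero) ne = go k ne
simple-allFin (suc n) (suc y) = subst (_≤ 1) (sym (shift-occ y)) (simple-allFin n y)
  where
  shift-occ : ∀ y → occurrences (suc y) (List.tabulate suc) ≡ occurrences y (allFin n)
  shift-occ y = trans (cong (occurrences (suc y)) (sym (map-tabulate id suc))) (trans (∑-map (allFin n) suc _) (∑-cong (allFin n) (λ x → cong indicator (same x))))
    where
    same : ∀ x → does (suc y Fin.≟ suc x) ≡ does (y Fin.≟ x)
    same x with y Fin.≟ x
    ... | yes _ = refl
    ... | no  _ = refl

-- The core is a copy of H, and each of its vertices y_u can be exchanged for q_u in the copy insertAt part_u root_u y_u:
-- the gadget tiles itself by the latter copies, and together with q₀, …, q_h by the exchanged copies and the core.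
record Gadget (h n : ℕ) : Set where
  constructor gadget
  field
    roots : Vec (Fin (suc h)) (suc h)
    core  : Vec (Fin n) (suc h)
    parts : Vec (Vec (Fin n) h) (suc h)
open Gadget public

support : ∀ {h n} → Gadget h n → List (Fin n)
support g = toList (core g Vec.++ Vec.concat (parts g))

gadgetSize : ℕ → ℕ
gadgetSize h = suc h + suc h * h

gadgets : ∀ {n} h → List (Fin n) → List (Gadget h n)
gadgets h xs = cartesianProductWith (λ r cp → gadget r (proj₁ cp) (proj₂ cp)) (tuples (suc h) (allFin (suc h)))
                 (cartesianProductWith _,_ (tuples (suc h) xs) (tuples (suc h) (tuples h xs)))

∑-gadgets : ∀ {n} h (xs : List (Fin n)) f → ∑ (gadgets h xs) f ≡
  ∑ (tuples (suc h) (allFin (suc h))) (λ r → ∑ (tuples (suc h) xs) (λ c → ∑ (tuples (suc h) (tuples h xs)) (λ p → f (gadget r c p))))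
∑-gadgets h xs f = trans (∑-cartesian (λ r cp → gadget r (proj₁ cp) (proj₂ cp)) (tuples (suc h) (allFin (suc h)))
                            (cartesianProductWith _,_ (tuples (suc h) xs) (tuples (suc h) (tuples h xs))) f)
  (∑-cong (tuples (suc h) (allFin (suc h))) (λ r → ∑-cartesian _,_ (tuples (suc h) xs) (tuples (suc h) (tuples h xs)) (λ cp → f (gadget r (proj₁ cp) (proj₂ cp)))))

module _ {h n} (H : Digraph (suc h)) (G : Digraph n) where

  fits : ∀ {k} → Vec (Fin (suc h)) k → Vec (Fin n) k → Vec (Fin n) k → Vec (Vec (Fin n) h) k → Bool
  fits []       []       []       []       = true
  fits (z ∷ zs) (y ∷ ys) (q ∷ qs) (S ∷ Ss) = exchanges H G z y q S ∧ fits zs ys qs Ss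

  absorbs : Vec (Fin n) (suc h) → Gadget h n → Bool
  absorbs Q g = distinct (support g) ∧ (copyᵇ H G (core g) ∧ fits (roots g) (core g) Q (parts g))

  fits-dense : ∀ c (xs : List (Fin n)) →
    (∀ x y → ∃ λ z → length xs ^ h ≤ c * count (exchanges H G z x y) (tuples h xs)) →
    ∀ {k} (ys qs : Vec (Fin n) k) → ∃ λ zs → (length xs ^ h) ^ k ≤ c ^ k * count (fits zs ys qs) (tuples k (tuples h xs))
  fits-dense c xs ex []       []       = [] , ≤-refl
  fits-dense c xs ex {suc k} (y ∷ ys) (q ∷ qs) = z ∷ zs , (begin
    M * M ^ k                                                         ≤⟨ *-monoˡ-≤ (M ^ k) (proj₂ (ex y q)) ⟩
    c * count (exchanges H G z y q) (tuples h xs) * M ^ k             ≡⟨ *-assoc c _ _ ⟩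
    c * (count (exchanges H G z y q) (tuples h xs) * M ^ k)           ≤⟨ *-monoʳ-≤ c (∑-restrict (tuples h xs) (λ S → c ^ k * F S) (M ^ k) (exchanges H G z y q) step) ⟩
    c * ∑ (tuples h xs) (λ S → c ^ k * F S)                           ≡⟨ cong (c *_) (∑-*ˡ (tuples h xs) (c ^ k) F) ⟩
    c * (c ^ k * ∑ (tuples h xs) F)                                   ≡⟨ *-assoc c (c ^ k) _ ⟨
    c ^ suc k * ∑ (tuples h xs) F                                     ≡⟨ cong (c ^ suc k *_) (∑-tuples-suc (tuples h xs) (λ w → indicator (fits (z ∷ zs) (y ∷ ys) (q ∷ qs) w))) ⟨
    c ^ suc k * count (fits (z ∷ zs) (y ∷ ys) (q ∷ qs)) (tuples (suc k) (tuples h xs)) ∎)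
    where
    open ≤-Reasoning
    M = length xs ^ h
    z = proj₁ (ex y q)
    ih = fits-dense c xs ex ys qs
    zs = proj₁ ih
    F : Vec (Fin n) h → ℕ
    F S = ∑ (tuples k (tuples h xs)) (λ Ss → indicator (exchanges H G z y q S ∧ fits zs ys qs Ss))
    step : ∀ S → S ∈ tuples h xs → exchanges H G z y q S ≡ true → M ^ k ≤ c ^ k * F S
    step S _ e = ≤-trans (proj₂ ih) (*-monoʳ-≤ (c ^ k) (count-mono (tuples k (tuples h xs)) (λ w → true-∧ e)))

^-gadgetSize : ∀ N h → N ^ gadgetSize h ≡ N ^ suc h * (N ^ h) ^ suc h
^-gadgetSize N h = trans (^-distribˡ-+-* N (suc h) (suc h * h))
  (cong (N ^ suc h *_) (trans (cong (N ^_) (*-comm (suc h) h)) (sym (^-*-assoc N h (suc h)))))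

length-gadgets : ∀ {n} h (xs : List (Fin n)) → length (gadgets h xs) ≡ suc h ^ suc h * length xs ^ gadgetSize h
length-gadgets h xs = begin
  length (gadgets h xs)
    ≡⟨ length≡count (gadgets h xs) ⟩
  ∑ (gadgets h xs) (λ _ → 1)
    ≡⟨ ∑-gadgets h xs (λ _ → 1) ⟩
  ∑ Z (λ _ → ∑ Cs (λ _ → ∑ Q (λ _ → 1)))
    ≡⟨ trans (∑-const Z _) (cong (length Z *_) (trans (∑-const Cs _) (cong (length Cs *_) (sym (length≡count Q))))) ⟩
  length Z * (length Cs * length Q)
    ≡⟨ cong₂ _*_ (trans (length-tuples (suc h) (allFin (suc h))) (cong (_^ suc h) (length-tabulate id)))
        (trans (cong₂ _*_ (length-tuples (suc h) xs) (trans (length-tuples (suc h) (tuples h xs)) (cong (_^ suc h) (length-tuples h xs)))) (sym (^-gadgetSize (length xs) h))) ⟩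
  suc h ^ suc h * length xs ^ gadgetSize h ∎
  where
  open ≡-Reasoning
  Z = tuples (suc h) (allFin (suc h))
  Cs = tuples (suc h) xs
  Q = tuples (suc h) (tuples h xs)

module _ {h} (H : Digraph (suc h)) (path : HomToDirectedPath H) where

  private
    m M Zn : ℕ
    m  = suc h
    M  = gadgetSize h
    Zn = m ^ m

  -- For each core among the many copies of H, some root vector suits a positive share of the parts.
  -- It depends on the core and on Q, so gadgets are enumerated with all `Zn` root vectors, and the
  -- share drops by that factor. Supports with a repeated vertex are an O(1 / N) share.
  gadgets-dense : ∀ P → 1 ≤ P → ∃₂ λ d N₀ → 1 ≤ d × 1 ≤ N₀ × ∀ {n} (G : Digraph n) xs → N₀ ≤ length xs → Simple xs → Dense P G xs →
                  ∀ Q → length (gadgets h xs) ≤ d * count (absorbs H G Q) (gadgets h xs)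
  gadgets-dense P 1≤P = Zn * (c + c) , N₀ , *-mono-≤ 1≤Zn (≤-trans 1≤c (m≤m+n c c)) , *-mono-≤ (≤-trans 1≤c (m≤m+n c c)) (*-mono-≤ 1≤Zn (s≤s z≤n)) , λ {n} → dns {n}
    where
    cp = copies-dense H path P 1≤P
    ex = exchange H path P 1≤P
    c₁ = proj₁ cp
    c₂ = proj₁ ex
    c N₀ : ℕ
    c = c₁ * c₂ ^ m
    1≤c : 1 ≤ c
    1≤c = *-mono-≤ (proj₁ (proj₂ cp)) (m^n>0 c₂ ⦃ >-nonZero (proj₁ (proj₂ ex)) ⦄ m)
    1≤Zn : 1 ≤ Zn
    1≤Zn = m^n>0 m m
    -- From this length on, collisions spoil at most half of the N ^ M / c suitable gadgets that are
    -- guaranteed.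
    N₀ = (c + c) * (Zn * (M * M))
    dns : ∀ {n} (G : Digraph n) xs → N₀ ≤ length xs → Simple xs → Dense P G xs →
          ∀ Q → length (gadgets h xs) ≤ (Zn * (c + c)) * count (absorbs H G Q) (gadgets h xs)
    dns {n} G xs N₀≤N simple dense Q = begin
      length (gadgets h xs)                                ≡⟨ length-gadgets h xs ⟩
      Zn * N ^ M                                           ≤⟨ *-monoʳ-≤ Zn (*-cancelˡ-≤ N ⦃ >-nonZero 1≤N ⦄ main) ⟩
      Zn * ((c + c) * Y)                                   ≡⟨ *-assoc Zn (c + c) Y ⟨
      Zn * (c + c) * Y                                     ∎
      where
      open ≤-Reasoning
      N = length xs
      1≤N : 1 ≤ N
      1≤N = ≤-trans (*-mono-≤ (≤-trans 1≤c (m≤m+n c c)) (*-mono-≤ 1≤Zn (s≤s z≤n))) N₀≤N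
      Z = tuples m (allFin m)
      Cs = tuples m xs
      R = tuples m (tuples h xs)
      exch : ∀ x y → ∃ λ z → N ^ h ≤ c₂ * count (exchanges H G z x y) (tuples h xs)
      exch = proj₂ (proj₂ ex) G xs 1≤N dense
      suits : Gadget h n → Bool
      suits g = copyᵇ H G (core g) ∧ fits H G (roots g) (core g) Q (parts g)
      X Y W : ℕ
      X = count suits (gadgets h xs)
      Y = count (absorbs H G Q) (gadgets h xs)
      W = count (λ g → not (distinct (support g))) (gadgets h xs)
      X≤Y+W : X ≤ Y + W
      X≤Y+W = ≤-trans (∑-mono (gadgets h xs) (λ g → cases (suits g) (distinct (support g)))) (≤-reflexive (∑-+ (gadgets h xs) _ _))
        where
        cases : ∀ a b → indicator a ≤ indicator (b ∧ a) + indicator (not b)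
        cases a     true  = m≤m+n _ 0
        cases true  false = ≤-refl
        cases false false = z≤n
      few-collisions : N * W ≤ Zn * (M * M * N ^ M)
      few-collisions = begin
        N * W                                                      ≡⟨ cong (N *_) (∑-gadgets h xs _) ⟩
        N * ∑ Z (λ _ → ∑ Cs (λ u → ∑ R (λ p → bad (u Vec.++ Vec.concat p))))
          ≡⟨ cong (N *_) (∑-cong Z (λ _ → sym (trans (∑-tuples-++ m (m * h) xs bad) (∑-cong Cs (λ u → ∑-tuples-concat m h xs (λ v → bad (u Vec.++ v))))))) ⟩
        N * ∑ Z (λ _ → ∑ (tuples M xs) bad)                        ≡⟨ cong (N *_) (trans (∑-const Z _) (cong (_* ∑ (tuples M xs) bad) #Z)) ⟩
        N * (Zn * ∑ (tuples M xs) bad)                             ≡⟨ shuffle N Zn _ ⟩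
        Zn * (N * ∑ (tuples M xs) bad)                             ≤⟨ *-monoʳ-≤ Zn (collisions xs simple M) ⟩
        Zn * (M * M * N ^ M)                                       ∎
        where
        bad : Vec (Fin n) M → ℕ
        bad w = indicator (not (distinct (toList w)))
        #Z : length Z ≡ Zn
        #Z = trans (length-tuples m (allFin m)) (cong (_^ m) (length-tabulate id))
        shuffle : ∀ a b c → a * (b * c) ≡ b * (a * c)
        shuffle = solve-∀
      many-suit : N ^ M ≤ c * X
      many-suit = begin
        N ^ M                                                      ≡⟨ ^-gadgetSize N h ⟩
        N ^ m * (N ^ h) ^ m                                        ≤⟨ *-monoˡ-≤ ((N ^ h) ^ m) (proj₂ (proj₂ cp) G xs 1≤N dense) ⟩
        c₁ * count (copyᵇ H G) Cs * (N ^ h) ^ m                     ≡⟨ *-assoc c₁ _ _ ⟩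
        c₁ * (count (copyᵇ H G) Cs * (N ^ h) ^ m)                   ≤⟨ *-monoʳ-≤ c₁ (∑-restrict Cs (λ u → c₂ ^ m * F u) ((N ^ h) ^ m) (copyᵇ H G) (λ u _ → at u)) ⟩
        c₁ * ∑ Cs (λ u → c₂ ^ m * F u)                              ≡⟨ cong (c₁ *_) (∑-*ˡ Cs (c₂ ^ m) F) ⟩
        c₁ * (c₂ ^ m * ∑ Cs F)                                      ≡⟨ *-assoc c₁ (c₂ ^ m) _ ⟨
        c * ∑ Cs F                                                  ≡⟨ cong (c *_) (trans (∑-swap Cs Z (λ u r → ∑ R (λ p → f r u p))) (sym (∑-gadgets h xs (λ g → indicator (suits g))))) ⟩
        c * X                                                      ∎
        where
        f : Vec (Fin m) m → Vec (Fin n) m → Vec (Vec (Fin n) h) m → ℕ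
        f r u p = indicator (suits (gadget r u p))
        F : Vec (Fin n) m → ℕ
        F u = ∑ Z (λ r → ∑ R (λ p → f r u p))
        at : ∀ u → copyᵇ H G u ≡ true → (N ^ h) ^ m ≤ c₂ ^ m * F u
        at u e = let zs , le = fits-dense H G c₂ xs exch u Q in
          ≤-trans le (*-monoʳ-≤ (c₂ ^ m) (≤-trans (count-mono R (λ p → true-∧ e))
            (∈⇒≤∑ (λ r → ∑ R (λ p → f r u p)) (∈-tuples⁺ zs (All.tabulate λ {x} _ → ∈-allFin x)))))
      main : N * N ^ M ≤ N * ((c + c) * Y)
      main = +-cancelʳ-≤ (N * N ^ M) _ _ (begin
        N * N ^ M + N * N ^ M                                      ≤⟨ +-mono-≤ (*-monoʳ-≤ N bound) (*-monoʳ-≤ N bound) ⟩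
        N * (c * (Y + W)) + N * (c * (Y + W))                      ≡⟨ arith₁ N c Y W ⟩
        N * ((c + c) * Y) + (c + c) * (N * W)                      ≤⟨ +-monoʳ-≤ (N * ((c + c) * Y)) (*-monoʳ-≤ (c + c) few-collisions) ⟩
        N * ((c + c) * Y) + (c + c) * (Zn * (M * M * N ^ M))       ≡⟨ cong (N * ((c + c) * Y) +_) (arith₂ (c + c) Zn (M * M) (N ^ M)) ⟩
        N * ((c + c) * Y) + N₀ * N ^ M                             ≤⟨ +-monoʳ-≤ (N * ((c + c) * Y)) (*-monoˡ-≤ (N ^ M) N₀≤N) ⟩
        N * ((c + c) * Y) + N * N ^ M                              ∎)
        where
        bound : N ^ M ≤ c * (Y + W)
        bound = ≤-trans many-suit (*-monoʳ-≤ c X≤Y+W)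
        arith₁ : ∀ N c Y W → N * (c * (Y + W)) + N * (c * (Y + W)) ≡ N * ((c + c) * Y) + (c + c) * (N * W)
        arith₁ = solve-∀
        arith₂ : ∀ a b d e → a * (b * (d * e)) ≡ a * (b * d) * e
        arith₂ = solve-∀

-- Greedy selection of gadgets

bernoulli : ∀ e k → e ^ k * (e + k) ≤ e * suc e ^ k
bernoulli e zero    = ≤-reflexive (trans (+-identityʳ _) (trans (+-identityʳ e) (sym (*-identityʳ e))))
bernoulli e (suc k) = begin
  e * e ^ k * (e + suc k)                          ≡⟨ arith₁ e (e ^ k) k ⟩
  e * (e ^ k * (e + k)) + e ^ k * e                ≤⟨ +-monoʳ-≤ (e * (e ^ k * (e + k))) (*-monoʳ-≤ (e ^ k) (m≤m+n e k)) ⟩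
  e * (e ^ k * (e + k)) + e ^ k * (e + k)          ≡⟨ +-comm (e * (e ^ k * (e + k))) _ ⟩
  suc e * (e ^ k * (e + k))                        ≤⟨ *-monoʳ-≤ (suc e) (bernoulli e k) ⟩
  suc e * (e * suc e ^ k)                          ≡⟨ arith₂ (suc e) e (suc e ^ k) ⟩
  e * suc e ^ suc k                                ∎
  where
  open ≤-Reasoning
  arith₁ : ∀ e x k → e * x * (e + (1 + k)) ≡ e * (x * (e + k)) + x * e
  arith₁ = solve-∀
  arith₂ : ∀ a e x → a * (e * x) ≡ e * (a * x)
  arith₂ = solve-∀

-- Bernoulli with k = 3e gives (1 + 1 / e) ^ (3e) ≥ 1 + 3. In `often` one factor 2 of the 4 pays for
-- the hits of Q, and the other leaves exponential growth.
growth : ∀ e → 1 ≤ e → 4 * e ^ (3 * e) ≤ suc e ^ (3 * e)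
growth e 1≤e = *-cancelˡ-≤ e ⦃ >-nonZero 1≤e ⦄ (≤-trans (≤-reflexive (arith e (e ^ (3 * e)))) (bernoulli e (3 * e)))
  where
  arith : ∀ e x → e * (4 * x) ≡ x * (e + 3 * e)
  arith = solve-∀

n<2^n : ∀ n → n < 2 ^ n
n<2^n zero    = s≤s z≤n
n<2^n (suc n) = +-mono-≤ (m^n>0 2 n) (≤-trans (n<2^n n) (m≤m+n _ 0))

linear<exponential : ∀ c u → 3 * c ≤ u → c * suc u ≤ 2 ^ u
linear<exponential c u le = subst (λ v → c * suc v ≤ 2 ^ v) (m∸n+n≡m le) (go (u ∸ 3 * c))
  where
  open ≤-Reasoning
  go : ∀ k → c * suc (k + 3 * c) ≤ 2 ^ (k + 3 * c)
  go zero = begin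
    c * suc (3 * c)                      ≤⟨ m≤m+n _ (1 + 2 * c + c * c * c) ⟩
    c * suc (3 * c) + (1 + 2 * c + c * c * c) ≡⟨ arith c ⟩
    suc c * (suc c * suc c)              ≤⟨ *-mono-≤ (n<2^n c) (*-mono-≤ (n<2^n c) (n<2^n c)) ⟩
    2 ^ c * (2 ^ c * 2 ^ c)              ≡⟨ cube c ⟨
    2 ^ (3 * c)                          ∎
    where
    arith : ∀ c → c * (1 + 3 * c) + (1 + 2 * c + c * c * c) ≡ (1 + c) * ((1 + c) * (1 + c))
    arith = solve-∀
    cube : ∀ c → 2 ^ (3 * c) ≡ 2 ^ c * (2 ^ c * 2 ^ c)
    cube c = trans (^-distribˡ-+-* 2 c (c + (c + 0))) (cong (2 ^ c *_)
               (trans (^-distribˡ-+-* 2 c (c + 0)) (cong (λ z → 2 ^ c * 2 ^ z) (+-identityʳ c))))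
  go (suc k) = begin
    c * suc (suc k + 3 * c)              ≡⟨ arith c (k + 3 * c) ⟩
    c * suc (k + 3 * c) + c * 1          ≤⟨ +-monoʳ-≤ (c * suc (k + 3 * c)) (*-monoʳ-≤ c (s≤s z≤n)) ⟩
    c * suc (k + 3 * c) + c * suc (k + 3 * c) ≤⟨ +-mono-≤ (go k) (go k) ⟩
    2 ^ (k + 3 * c) + 2 ^ (k + 3 * c)    ≡⟨ cong (2 ^ (k + 3 * c) +_) (+-identityʳ _) ⟨
    2 ^ (suc k + 3 * c)                  ∎
    where
    arith : ∀ c x → c * (1 + (1 + x)) ≡ c * (1 + x) + c * 1
    arith = solve-∀

n<[1+n/d]*d : ∀ n d .⦃ _ : NonZero d ⦄ → n < suc (n / d) * d
n<[1+n/d]*d n d = subst (_< suc (n / d) * d) (sym (m≡m%n+[m/n]*n n d)) (+-monoˡ-< (n / d * d) (m%n<n n d))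

m*d≤n⇒m≤n/d : ∀ m d n .⦃ _ : NonZero d ⦄ → m * d ≤ n → m ≤ n / d
m*d≤n⇒m≤n/d m d n le = ≤-pred (*-cancelʳ-< d m (suc (n / d)) (≤-<-trans le (n<[1+n/d]*d n d)))

^-distribʳ-* : ∀ s a b → (a * b) ^ s ≡ a ^ s * b ^ s
^-distribʳ-* zero    a b = refl
^-distribʳ-* (suc s) a b = trans (cong (a * b *_) (^-distribʳ-* s a b)) (shuffle a b (a ^ s) (b ^ s))
  where
  shuffle : ∀ a b c d → a * b * (c * d) ≡ a * c * (b * d)
  shuffle = solve-∀

-- With u = n / D / m and c = m D one has n < c (1 + u) ≤ 2 ^ u once u ≥ 3c; take m-th powers and
-- use u m ≤ n / D.
polynomial<exponential : ∀ D m .⦃ _ : NonZero D ⦄ .⦃ _ : NonZero m ⦄ →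
                         ∃ λ n₀ → ∀ n → n₀ ≤ n → n ^ m < 2 ^ (n / D)
polynomial<exponential D m = 3 * c * m * D , λ n le → begin-strict
  n ^ m                    <⟨ ^-monoˡ-< m (n<c[1+u] n) ⟩
  (c * suc (n / D / m)) ^ m ≤⟨ ^-monoˡ-≤ m (linear<exponential c (n / D / m) (u-large n le)) ⟩
  (2 ^ (n / D / m)) ^ m    ≡⟨ ^-*-assoc 2 (n / D / m) m ⟩
  2 ^ (n / D / m * m)      ≤⟨ ^-monoʳ-≤ 2 (m/n*n≤m (n / D) m) ⟩
  2 ^ (n / D)              ∎
  where
  open ≤-Reasoning
  c = m * D
  u-large : ∀ n → 3 * c * m * D ≤ n → 3 * c ≤ n / D / m
  u-large n le = m*d≤n⇒m≤n/d (3 * c) m (n / D) (m*d≤n⇒m≤n/d (3 * c * m) D n le)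
  n<c[1+u] : ∀ n → n < c * suc (n / D / m)
  n<c[1+u] n = begin-strict
    n                          <⟨ n<[1+n/d]*d n D ⟩
    suc (n / D) * D            ≤⟨ *-monoˡ-≤ D (n<[1+n/d]*d (n / D) m) ⟩
    suc (n / D / m) * m * D    ≡⟨ trans (*-assoc (suc (n / D / m)) m D) (*-comm (suc (n / D / m)) c) ⟩
    c * suc (n / D / m)        ∎

degreeIn-++ : ∀ {n} (G : Digraph n) v us xs → degreeIn G v (us ++ xs) ≡ degreeIn G v us + degreeIn G v xs
degreeIn-++ G v us xs = trans (cong₂ _+_ (∑-++ us xs _) (∑-++ us xs _)) (interchange (count (λ u → adj G u v) us) _ _ _)
  where
  interchange : ∀ a b c d → a + b + (c + d) ≡ a + c + (b + d)
  interchange = solve-∀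

degreeIn-↭ : ∀ {n} (G : Digraph n) v {us xs} → us ↭ xs → degreeIn G v us ≡ degreeIn G v xs
degreeIn-↭ G v p = cong₂ _+_ (∑-↭ _ p) (∑-↭ _ p)

degreeIn≤ : ∀ {n} (G : Digraph n) v us → degreeIn G v us ≤ length us + length us
degreeIn≤ G v us = +-mono-≤ (count≤length (λ u → adj G u v) us) (count≤length (adj G v) us)

-- Deleting at most N / (4p) vertices costs a vertex at most N / (2p) incident edges, half of its
-- surplus N / p; so p becomes p + p.
dense-rest : ∀ {n} {G : Digraph n} {p as us xs} → Dense p G as → as ↭ us ++ xs →
             4 * p * length us ≤ length as → Dense (p + p) G xs
dense-rest {G = G} {p} {as} {us} {xs} dense perm few .min-degree v = +-cancelʳ-≤ N _ _ (begin
  suc (p + p) * length xs + N                                      ≤⟨ +-monoˡ-≤ N (*-monoʳ-≤ (suc (p + p)) xs≤N) ⟩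
  suc (p + p) * N + N                                              ≡⟨ arith₁ p N ⟩
  suc p * N + suc p * N                                            ≤⟨ +-mono-≤ big big ⟩
  p * (U + X) + p * (U + X)                                        ≤⟨ +-mono-≤ (*-monoʳ-≤ p (+-monoˡ-≤ X (degreeIn≤ G v us))) (*-monoʳ-≤ p (+-monoˡ-≤ X (degreeIn≤ G v us))) ⟩
  p * (l + l + X) + p * (l + l + X)                                ≡⟨ arith₂ p l X ⟩
  (p + p) * X + 4 * p * l                                          ≤⟨ +-monoʳ-≤ ((p + p) * X) few ⟩
  (p + p) * X + N                                                  ∎)
  where
  open ≤-Reasoning
  N = length as
  l = length us
  U = degreeIn G v us
  X = degreeIn G v xs
  xs≤N : length xs ≤ N
  xs≤N = ≤-trans (m≤n+m _ l) (≤-reflexive (sym (trans (↭-length perm) (length-++ us))))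
  big : suc p * N ≤ p * (U + X)
  big = ≤-trans (min-degree dense v) (≤-reflexive (cong (p *_) (trans (degreeIn-↭ G v perm) (degreeIn-++ G v us xs))))
  arith₁ : ∀ p N → (1 + (p + p)) * N + N ≡ (1 + p) * N + (1 + p) * N
  arith₁ = solve-∀
  arith₂ : ∀ p l X → p * (l + l + X) + p * (l + l + X) ≡ (p + p) * X + 4 * p * l
  arith₂ = solve-∀

length-rest : ∀ {as us xs : List A} {p} → 1 ≤ p → as ↭ us ++ xs → 4 * p * length us ≤ length as → length as ≤ 2 * length xs
length-rest {as = as} {us} {xs} {p} 1≤p perm few = *-cancelˡ-≤ 2 (+-cancelˡ-≤ N _ _ (begin
  N + 2 * N                        ≤⟨ m≤m+n _ N ⟩
  N + 2 * N + N                    ≡⟨ arith₁ N ⟩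
  4 * N                            ≡⟨ cong (4 *_) (trans (↭-length perm) (length-++ us)) ⟩
  4 * (length us + length xs)      ≡⟨ *-distribˡ-+ 4 (length us) _ ⟩
  4 * length us + 4 * length xs    ≤⟨ +-monoˡ-≤ (4 * length xs) (≤-trans (*-monoˡ-≤ (length us) (*-monoʳ-≤ 4 1≤p)) few) ⟩
  N + 4 * length xs                ≡⟨ arith₂ N (length xs) ⟩
  N + 2 * (2 * length xs)          ∎))
  where
  open ≤-Reasoning
  N = length as
  arith₁ : ∀ N → N + 2 * N + N ≡ 4 * N
  arith₁ = solve-∀
  arith₂ : ∀ N x → N + 4 * x ≡ N + 2 * (2 * x)
  arith₂ = solve-∀

simple-rest : ∀ {n} {as : List (Fin n)} us {xs} → Simple as → as ↭ us ++ xs → Simple xs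
simple-rest us {xs} simple perm y = ≤-trans (m≤n+m _ (occurrences y us))
  (≤-trans (≤-reflexive (sym (trans (∑-↭ _ perm) (∑-++ us xs _)))) (simple y))

support⊆ : ∀ {n h} {xs : List (Fin n)} {g : Gadget h n} → g ∈ gadgets h xs → All (_∈ xs) (support g)
support⊆ {h = h} {xs} g∈
  with _ , _ , _ , cp∈ , refl ← ∈-cartesianProductWith⁻ _ (tuples (suc h) (allFin (suc h))) _ g∈
  with c , p , c∈ , p∈ , refl ← ∈-cartesianProductWith⁻ _,_ (tuples (suc h) xs) (tuples (suc h) (tuples h xs)) cp∈
  = subst (All (_∈ xs)) (sym (Vecₚ.toList-++ c (Vec.concat p))) (Allₚ.++⁺ (∈-tuples⁻ xs c∈) (inside p (∈-tuples⁻ (tuples h xs) p∈)))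
  where
  inside : ∀ {k} (p : Vec (Vec _ h) k) → All (_∈ tuples h xs) (toList p) → All (_∈ xs) (toList (Vec.concat p))
  inside []      []         = []
  inside (S ∷ p) (S∈ ∷ p∈) = subst (All (_∈ xs)) (sym (Vecₚ.toList-++ S (Vec.concat p))) (Allₚ.++⁺ (∈-tuples⁻ xs S∈) (inside p p∈))

module _ {h n} (H : Digraph (suc h)) (G : Digraph n) where

  private
    m M : ℕ
    m = suc h
    M = gadgetSize h
    Qs = tuples m (allFin n)

  Absorbing : Gadget h n → Set
  Absorbing g = ∃ λ Q → absorbs H G Q g ≡ true

  supports : List (Gadget h n) → List (Fin n)
  supports gs = concat (map support gs)

  length-supports : ∀ gs → length (supports gs) ≡ length gs * M
  length-supports []       = refl
  length-supports (g ∷ gs) = trans (length-++ (support g)) (cong₂ _+_ (Vecₚ.length-toList (core g Vec.++ Vec.concat (parts g))) (length-supports gs))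

  -- Two to the number of gadgets that fail to absorb Q. Doubling at failures instead of halving at
  -- hits keeps weights integral, and a tuple absorbed too rarely would alone exceed the bound on
  -- the potential.
  weight : Vec (Fin n) m → List (Gadget h n) → ℕ
  weight Q []       = 1
  weight Q (g ∷ gs) = if absorbs H G Q g then weight Q gs else 2 * weight Q gs

  weight-hits : ∀ Q gs → weight Q gs * 2 ^ count (absorbs H G Q) gs ≡ 2 ^ length gs
  weight-hits Q []       = refl
  weight-hits Q (g ∷ gs) with absorbs H G Q g
  ... | true  = trans (shuffle (weight Q gs) (2 ^ count (absorbs H G Q) gs)) (cong (2 *_) (weight-hits Q gs))
    where
    shuffle : ∀ a b → a * (2 * b) ≡ 2 * (a * b)
    shuffle = solve-∀
  ... | false = trans (*-assoc 2 (weight Q gs) _) (cong (2 *_) (weight-hits Q gs))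

  potential : List (Gadget h n) → ℕ
  potential gs = ∑ Qs (λ Q → weight Q gs)

  potential-drop : ∀ g gs → potential (g ∷ gs) + ∑ Qs (λ Q → weight Q gs * indicator (absorbs H G Q g)) ≡ 2 * potential gs
  potential-drop g gs = trans (sym (∑-+ Qs _ _)) (trans (∑-cong Qs pt) (∑-*ˡ Qs 2 _))
    where
    pt : ∀ Q → weight Q (g ∷ gs) + weight Q gs * indicator (absorbs H G Q g) ≡ 2 * weight Q gs
    pt Q with absorbs H G Q g
    ... | true  = cong (weight Q gs +_) (*-comm (weight Q gs) 1)
    ... | false = trans (cong (2 * weight Q gs +_) (*-zeroʳ (weight Q gs))) (+-identityʳ _)

  Q∈Qs : ∀ Q → Q ∈ Qs
  Q∈Qs Q = ∈-tuples⁺ Q (All.tabulate λ {x} _ → ∈-allFin x)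

  weight>0 : ∀ Q gs → 0 < weight Q gs
  weight>0 Q []       = s≤s z≤n
  weight>0 Q (g ∷ gs) with absorbs H G Q g
  ... | true  = weight>0 Q gs
  ... | false = ≤-trans (weight>0 Q gs) (m≤m+n _ _)

  gain : Gadget h n → List (Gadget h n) → ℕ
  gain g gs = ∑ Qs (λ Q → weight Q gs * indicator (absorbs H G Q g))

  gain>0⇒absorbing : ∀ g gs → 0 < gain g gs → Absorbing g
  gain>0⇒absorbing g gs pos = Q , positive (absorbs H G Q g) refl
    where
    witness = ∑-<⇒∃< Qs (λ _ → 0) (λ Q → weight Q gs * indicator (absorbs H G Q g))
                (≤-<-trans (≤-reflexive (trans (∑-const Qs 0) (*-zeroʳ (length Qs)))) pos)
    Q = proj₁ witness
    positive : ∀ b → absorbs H G Q g ≡ b → absorbs H G Q g ≡ true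
    positive true  e = e
    positive false e = contradiction (≤-trans (proj₂ (proj₂ witness)) (≤-reflexive (trans (cong (λ b → weight Q gs * indicator b) e) (*-zeroʳ (weight Q gs))))) λ ()

  -- Each Q is absorbed by a 1 / d share of Ω, so the average gain over Ω is at least
  -- `potential gs / d`. A gadget g that reaches it multiplies the potential by at most 2 - 1 / d,
  -- where a useless one would double it.
  greedy-step : ∀ d gs (Ω : List (Gadget h n)) → Fin n → 0 < length Ω →
                (∀ Q → length Ω ≤ d * count (absorbs H G Q) Ω) →
                ∃ λ g → g ∈ Ω × Absorbing g × d * potential (g ∷ gs) + potential gs ≤ (d + d) * potential gs
  greedy-step d gs Ω v 0<Ω dns = g , proj₁ (proj₂ chosen) , absorbing , drop
    where
    open ≤-Reasoning
    average : ∑ Ω (λ _ → potential gs) ≤ ∑ Ω (λ g → d * gain g gs)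
    average = begin
      ∑ Ω (λ _ → potential gs)                                        ≡⟨ ∑-swap Ω Qs (λ _ Q → weight Q gs) ⟩
      ∑ Qs (λ Q → ∑ Ω (λ _ → weight Q gs))                            ≤⟨ ∑-mono Qs at ⟩
      ∑ Qs (λ Q → ∑ Ω (λ g → d * (weight Q gs * indicator (absorbs H G Q g)))) ≡⟨ ∑-swap Qs Ω _ ⟩
      ∑ Ω (λ g → ∑ Qs (λ Q → d * (weight Q gs * indicator (absorbs H G Q g)))) ≡⟨ ∑-cong Ω (λ g → ∑-*ˡ Qs d _) ⟩
      ∑ Ω (λ g → d * gain g gs)                                          ∎
      where
      shuffle : ∀ a b c → a * b * c ≡ a * (c * b)
      shuffle = solve-∀
      at : ∀ Q → ∑ Ω (λ _ → weight Q gs) ≤ ∑ Ω (λ g → d * (weight Q gs * indicator (absorbs H G Q g)))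
      at Q = begin
        ∑ Ω (λ _ → weight Q gs)                                       ≡⟨ ∑-const Ω _ ⟩
        length Ω * weight Q gs                                        ≤⟨ *-monoˡ-≤ (weight Q gs) (dns Q) ⟩
        d * count (absorbs H G Q) Ω * weight Q gs                     ≡⟨ shuffle d (count (absorbs H G Q) Ω) (weight Q gs) ⟩
        d * (weight Q gs * count (absorbs H G Q) Ω)                   ≡⟨ cong (d *_) (∑-*ˡ Ω (weight Q gs) _) ⟨
        d * ∑ Ω (λ g → weight Q gs * indicator (absorbs H G Q g))     ≡⟨ ∑-*ˡ Ω d _ ⟨
        ∑ Ω (λ g → d * (weight Q gs * indicator (absorbs H G Q g)))   ∎
    chosen = ∑-≤⇒∃≤ Ω (λ _ → potential gs) (λ g → d * gain g gs) 0<Ω average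
    g = proj₁ chosen
    good : potential gs ≤ d * gain g gs
    good = proj₂ (proj₂ chosen)
    absorbing : Absorbing g
    absorbing = gain>0⇒absorbing g gs (n≢0⇒n>0 (λ eq → <⇒≱ (weight>0 Q₀ gs)
      (≤-trans (∈⇒≤∑ (λ Q → weight Q gs) (Q∈Qs Q₀)) (≤-trans good (≤-reflexive (trans (cong (d *_) eq) (*-zeroʳ d)))))))
      -- The vertex v supplies a tuple, so the potential is positive and the gain of g cannot
      -- vanish.
      where Q₀ = Vec.replicate m v
    drop : d * potential (g ∷ gs) + potential gs ≤ (d + d) * potential gs
    drop = begin
      d * potential (g ∷ gs) + potential gs  ≤⟨ +-monoʳ-≤ (d * potential (g ∷ gs)) good ⟩
      d * potential (g ∷ gs) + d * gain g gs    ≡⟨ *-distribˡ-+ d (potential (g ∷ gs)) _ ⟨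
      d * (potential (g ∷ gs) + gain g gs)      ≡⟨ cong (d *_) (potential-drop g gs) ⟩
      d * (2 * potential gs)                 ≡⟨ arith d (potential gs) ⟩
      (d + d) * potential gs                 ∎
      where
      arith : ∀ d x → d * (2 * x) ≡ (d + d) * x
      arith = solve-∀

  record Selection (d i : ℕ) : Set where
    field
      chosen    : List (Gadget h n)
      rest      : List (Fin n)
      #chosen   : length chosen ≡ i
      partition : allFin n ↭ supports chosen ++ rest
      absorbing : All Absorbing chosen
      small     : d ^ i * potential chosen ≤ (d + d ∸ 1) ^ i * n ^ m

  -- The density of the remaining vertices is derived each time from all of `allFin n`, so it stays
  -- at p + p however many gadgets are removed, as long as their supports take at most n / (4p)
  -- vertices.
  greedy : ∀ p d N₀ → 1 ≤ p → 1 ≤ d → 1 ≤ N₀ → Dense p G (allFin n) → 2 * N₀ ≤ n →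
           (∀ xs → N₀ ≤ length xs → Simple xs → Dense (p + p) G xs →
             ∀ Q → length (gadgets h xs) ≤ d * count (absorbs H G Q) (gadgets h xs)) →
           ∀ i → 4 * p * (i * M) ≤ n → Selection d i
  greedy p d N₀ 1≤p 1≤d 1≤N₀ dense large dns zero _ = record
    { chosen = [] ; rest = allFin n ; #chosen = refl ; partition = ↭-refl ; absorbing = []
    ; small = +-monoˡ-≤ 0 (≤-reflexive (trans (∑-const Qs 1) (trans (*-identityʳ _) (trans (length-tuples m (allFin n)) (cong (_^ m) (length-tabulate {n = n} id)))))) }
  greedy p d N₀ 1≤p 1≤d 1≤N₀ dense large dns (suc i) le = record
    { chosen = g ∷ gs ; rest = proj₁ split ; #chosen = cong suc (#chosen S)
    ; partition = ↭-trans perm (↭-trans (++⁺ˡ (supports gs) (proj₂ split)) (↭-trans (shifts (supports gs) (support g)) (↭-reflexive (sym (++-assoc (support g) (supports gs) _)))))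
    ; absorbing = proj₁ (proj₂ (proj₂ step)) ∷ absorbing S
    ; small = begin
        d * d ^ i * potential (g ∷ gs)           ≡⟨ shuffle d (d ^ i) _ ⟩
        d ^ i * (d * potential (g ∷ gs))         ≤⟨ *-monoʳ-≤ (d ^ i) drop ⟩
        d ^ i * (e * potential gs)               ≡⟨ shuffle′ (d ^ i) e _ ⟩
        e * (d ^ i * potential gs)               ≤⟨ *-monoʳ-≤ e (small S) ⟩
        e * (e ^ i * n ^ m)                      ≡⟨ *-assoc e (e ^ i) _ ⟨
        e * e ^ i * n ^ m                        ∎ }
    where
    open ≤-Reasoning
    open Selection
    e = d + d ∸ 1
    shuffle : ∀ a b c → a * b * c ≡ b * (a * c)
    shuffle = solve-∀
    shuffle′ : ∀ a b c → a * (b * c) ≡ b * (a * c)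
    shuffle′ = solve-∀
    S = greedy p d N₀ 1≤p 1≤d 1≤N₀ dense large dns i (≤-trans (*-monoʳ-≤ (4 * p) (m≤n+m (i * M) M)) le)
    gs = chosen S
    xs = rest S
    perm = partition S
    few : 4 * p * length (supports gs) ≤ length (allFin n)
    few = begin
      4 * p * length (supports gs)  ≡⟨ cong (4 * p *_) (trans (length-supports gs) (cong (_* M) (#chosen S))) ⟩
      4 * p * (i * M)               ≤⟨ *-monoʳ-≤ (4 * p) (m≤n+m (i * M) M) ⟩
      4 * p * (suc i * M)           ≤⟨ le ⟩
      n                             ≡⟨ length-tabulate id ⟨
      length (allFin n)             ∎
    N₀≤xs : N₀ ≤ length xs
    N₀≤xs = *-cancelˡ-≤ 2 (≤-trans large (≤-trans (≤-reflexive (sym (length-tabulate {n = n} id))) (length-rest {us = supports gs} 1≤p perm few)))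
    0<Ω : 0 < length (gadgets h xs)
    0<Ω = subst (0 <_) (sym (length-gadgets h xs)) (*-mono-≤ (m^n>0 m m) (m^n>0 (length xs) ⦃ >-nonZero (≤-trans 1≤N₀ N₀≤xs) ⦄ M))
    step = greedy-step d gs (gadgets h xs) (Fin.fromℕ< {0} (≤-trans 1≤N₀ (≤-trans (m≤m+n N₀ _) large))) 0<Ω
             (dns xs N₀≤xs (simple-rest (supports gs) (simple-allFin n) perm) (dense-rest dense perm few))
    g = proj₁ step
    g∈ = proj₁ (proj₂ step)
    split : ∃ λ ys → xs ↭ support g ++ ys
    split = distinct-⊆ (support g) xs (proj₁ (∧-true (proj₂ (proj₁ (proj₂ (proj₂ step)))))) (support⊆ g∈)
    drop : d * potential (g ∷ gs) ≤ e * potential gs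
    drop = +-cancelʳ-≤ (potential gs) _ _ (≤-trans (proj₂ (proj₂ (proj₂ step))) (≤-reflexive
      (trans (cong (_* potential gs) (sym (m∸n+n≡m {d + d} (≤-trans 1≤d (m≤m+n d d))))) (trans (*-distribʳ-+ (potential gs) e 1) (cong (e * potential gs +_) (+-identityʳ _))))))

module _ {h} (H : Digraph (suc h)) where

  Absorbers : ℕ → ℕ → ℕ → Set
  Absorbers p D n₀ = ∀ {n} (G : Digraph n) → n₀ ≤ n → Dense p G (allFin n) →
    ∃₂ λ gs xs → allFin n ↭ supports H G gs ++ xs × All (Absorbing H G) gs ×
      Dense (p + p) G xs × n ≤ 2 * length xs × (∀ Q s → s * D ≤ n → s ≤ count (absorbs H G Q) gs)

  -- For s = n / D, B s gadgets are chosen. If Q is absorbed at most s times, its weight is at least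
  -- 2 ^ (B s - s), while the potential is at most ((2d - 1) / d) ^ (B s) · n ^ m. With e = 2d - 1,
  -- the bound (1 + 1 / e) ^ (3 e s) ≥ 4 ^ s then forces 2 ^ s ≤ n ^ m, which fails for large n.
  absorbers-from : ∀ p d N₀ → 1 ≤ p → 1 ≤ d → 1 ≤ N₀ →
    (∀ {n} (G : Digraph n) xs → N₀ ≤ length xs → Simple xs → Dense (p + p) G xs →
       ∀ Q → length (gadgets h xs) ≤ d * count (absorbs H G Q) (gadgets h xs)) →
    ∃₂ λ D n₀ → 1 ≤ D × Absorbers p D n₀
  absorbers-from p d N₀ 1≤p 1≤d 1≤N₀ dns = D , 2 * N₀ + proj₁ beats , 1≤D , λ {n} → select {n}
    where
    open ≤-Reasoning
    open Selection
    e B m M D : ℕ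
    e  = d + d ∸ 1
    1≤e : 1 ≤ e
    1≤e = ∸-monoˡ-≤ {2} {d + d} 1 (+-mono-≤ 1≤d 1≤d)
    1+e : suc e ≡ d + d
    1+e = m+[n∸m]≡n {1} {d + d} (≤-trans 1≤d (m≤m+n d d))
    B = 3 * e
    m = suc h
    M = gadgetSize h
    -- B s gadgets with M vertices each then occupy at most n / (4p) vertices, as `dense-rest`
    -- demands.
    D = 4 * p * (B * M)
    1≤D : 1 ≤ D
    1≤D = *-mono-≤ {1} {4 * p} (*-mono-≤ {1} {4} (s≤s z≤n) 1≤p) (*-mono-≤ {1} {B} (*-mono-≤ {1} {3} (s≤s z≤n) 1≤e) (s≤s z≤n))
    instance
      D≢0 : NonZero D
      D≢0 = >-nonZero 1≤D
    beats = polynomial<exponential D m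
    select : Absorbers p D (2 * N₀ + proj₁ beats)
    select {n} G large dense =
      chosen S , rest S , partition S , absorbing S , dense-rest dense (partition S) few ,
      ≤-trans (≤-reflexive (sym (length-tabulate {n = n} id))) (length-rest {us = supports H G (chosen S)} 1≤p (partition S) few) ,
      λ Q s′ le → ≤-trans (m*d≤n⇒m≤n/d s′ D n le) (≮⇒≥ (λ lt → <⇒≱ (proj₂ beats n (≤-trans (m≤n+m _ (2 * N₀)) large)) (often Q (<⇒≤ lt))))
      where
      s = n / D
      used : 4 * p * (B * s * M) ≤ n
      used = ≤-trans (≤-reflexive (arith (4 * p) B s M)) (m/n*n≤m n D)
        where
        arith : ∀ q B s M → q * (B * s * M) ≡ s * (q * (B * M))
        arith = solve-∀
      S = greedy H G p d N₀ 1≤p 1≤d 1≤N₀ dense (≤-trans (m≤m+n (2 * N₀) _) large) (dns G) (B * s) used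
      few : 4 * p * length (supports H G (chosen S)) ≤ length (allFin n)
      few = ≤-trans (≤-reflexive (cong (4 * p *_) (trans (length-supports H G (chosen S)) (cong (_* M) (#chosen S)))))
              (≤-trans used (≤-reflexive (sym (length-tabulate id))))
      often : ∀ Q → count (absorbs H G Q) (chosen S) ≤ s → 2 ^ s ≤ n ^ m
      often Q few-hits = *-cancelˡ-≤ (2 ^ s) ⦃ m^n≢0 2 s ⦄ (*-cancelˡ-≤ (e ^ (B * s)) ⦃ m^n≢0 e (B * s) ⦃ >-nonZero 1≤e ⦄ ⦄ (begin
        e ^ (B * s) * (2 ^ s * 2 ^ s)                          ≡⟨ cong₂ _*_ (^-*-assoc e B s) (^-distribʳ-* s 2 2) ⟨
        (e ^ B) ^ s * 4 ^ s                                    ≡⟨ trans (*-comm _ (4 ^ s)) (sym (^-distribʳ-* s 4 (e ^ B))) ⟩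
        (4 * e ^ B) ^ s                                        ≤⟨ ^-monoˡ-≤ s (growth e 1≤e) ⟩
        (suc e ^ B) ^ s                                        ≡⟨ trans (^-*-assoc (suc e) B s) (cong (_^ (B * s)) (trans 1+e (cong (d +_) (sym (+-identityʳ d))))) ⟩
        (2 * d) ^ (B * s)                                      ≡⟨ ^-distribʳ-* (B * s) 2 d ⟩
        2 ^ (B * s) * d ^ (B * s)                              ≡⟨ cong (λ z → 2 ^ z * d ^ (B * s)) (#chosen S) ⟨
        2 ^ length (chosen S) * d ^ (B * s)                    ≡⟨ cong (_* d ^ (B * s)) (weight-hits H G Q (chosen S)) ⟨
        weight H G Q (chosen S) * 2 ^ count (absorbs H G Q) (chosen S) * d ^ (B * s)
          ≤⟨ *-monoˡ-≤ (d ^ (B * s)) (*-mono-≤ (∈⇒≤∑ (λ Q → weight H G Q (chosen S)) (Q∈Qs H G Q)) (^-monoʳ-≤ 2 few-hits)) ⟩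
        potential H G (chosen S) * 2 ^ s * d ^ (B * s)         ≡⟨ arith₁ (potential H G (chosen S)) (2 ^ s) (d ^ (B * s)) ⟩
        d ^ (B * s) * potential H G (chosen S) * 2 ^ s         ≤⟨ *-monoˡ-≤ (2 ^ s) (small S) ⟩
        e ^ (B * s) * n ^ m * 2 ^ s                            ≡⟨ arith₂ (e ^ (B * s)) (n ^ m) (2 ^ s) ⟩
        e ^ (B * s) * (2 ^ s * n ^ m)                          ∎))
        where
        arith₁ : ∀ a b c → a * b * c ≡ c * a * b
        arith₁ = solve-∀
        arith₂ : ∀ a b c → a * b * c ≡ a * (c * b)
        arith₂ = solve-∀

  absorbers : HomToDirectedPath H → ∀ p → 1 ≤ p → ∃₂ λ D n₀ → 1 ≤ D × Absorbers p D n₀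
  absorbers path p 1≤p = absorbers-from p (proj₁ gd) (proj₁ (proj₂ gd)) 1≤p (proj₁ (proj₂ (proj₂ gd)))
                           (proj₁ (proj₂ (proj₂ (proj₂ gd)))) (proj₂ (proj₂ (proj₂ (proj₂ gd))))
    where gd = gadgets-dense H path (p + p) (≤-trans 1≤p (m≤m+n p p))

-- Tilings and absorption

concat-↭ : ∀ {xss yss : List (List A)} → xss ↭ yss → concat xss ↭ concat yss
concat-↭ _↭_.refl             = ↭-refl
concat-↭ (prep xs p)          = ++⁺ˡ xs (concat-↭ p)
concat-↭ (_↭_.swap xs ys p)   = ↭-trans (++⁺ˡ xs (++⁺ˡ ys (concat-↭ p))) (shifts xs ys)
concat-↭ (_↭_.trans p q)      = ↭-trans (concat-↭ p) (concat-↭ q)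

++-interchange : ∀ (as bs cs ds : List A) → (as ++ bs) ++ (cs ++ ds) ↭ (as ++ cs) ++ (bs ++ ds)
++-interchange as bs cs ds =
  ↭-trans (↭-reflexive (++-assoc as bs (cs ++ ds)))
    (↭-trans (++⁺ˡ as (shifts bs cs)) (↭-reflexive (sym (++-assoc as cs (bs ++ ds)))))

insertAt-↭ : ∀ {k} (S : Vec A k) z x → toList (insertAt S z x) ↭ x ∷ toList S
insertAt-↭ S       zero    x = ↭-refl
insertAt-↭ (y ∷ S) (suc z) x = ↭-trans (prep y (insertAt-↭ S z x)) (_↭_.swap y x ↭-refl)

module _ {h n} (H : Digraph h) (G : Digraph n) where

  Tileable : List (Fin n) → Set
  Tileable xs = ∃ λ (ts : List (Vec (Fin n) h)) → All (IsCopy H G) ts × concat (map toList ts) ↭ xs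

  tileable-[] : Tileable []
  tileable-[] = [] , [] , ↭-refl

  tileable-copy : ∀ v → IsCopy H G v → Tileable (toList v)
  tileable-copy v c = v ∷ [] , c ∷ [] , ↭-reflexive (++-identityʳ (toList v))

  tileable-++ : ∀ {xs ys} → Tileable xs → Tileable ys → Tileable (xs ++ ys)
  tileable-++ (ts , cs , p) (us , ds , q) = ts ++ us , Allₚ.++⁺ cs ds ,
    ↭-trans (↭-reflexive (trans (cong concat (map-++ toList ts us)) (sym (concat-++ (map toList ts) (map toList us))))) (↭-++⁺ p q)

  tileable-↭ : ∀ {xs ys} → xs ↭ ys → Tileable xs → Tileable ys
  tileable-↭ p (ts , cs , q) = ts , cs , ↭-trans q p

  tileable-concat : ∀ {xss} → All Tileable xss → Tileable (concat xss)
  tileable-concat []       = tileable-[]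
  tileable-concat (t ∷ ts) = tileable-++ t (tileable-concat ts)

module _ {h n} (H : Digraph (suc h)) (G : Digraph n) where

  fits⇒tileable : ∀ {k} (zs : Vec (Fin (suc h)) k) ys qs Ss → fits H G zs ys qs Ss ≡ true →
    Tileable H G (toList ys ++ toList (Vec.concat Ss)) × Tileable H G (toList qs ++ toList (Vec.concat Ss))
  fits⇒tileable []       []       []       []       ok = tileable-[] H G , tileable-[] H G
  fits⇒tileable (z ∷ zs) (y ∷ ys) (q ∷ qs) (S ∷ Ss) ok =
    attach y ys (copyᵇ⇒ H G {insertAt S z y} (proj₁ (∧-true exch))) (proj₁ ih) , attach q qs (copyᵇ⇒ H G {insertAt S z q} (proj₂ (∧-true {copyᵇ H G (insertAt S z y)} exch))) (proj₂ ih)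
    where
    exch = proj₁ (∧-true {exchanges H G z y q S} ok)
    ih = fits⇒tileable zs ys qs Ss (proj₂ (∧-true {exchanges H G z y q S} ok))
    attach : ∀ x xs → IsCopy H G (insertAt S z x) → Tileable H G (toList xs ++ toList (Vec.concat Ss)) →
             Tileable H G (x ∷ toList xs ++ toList (S Vec.++ Vec.concat Ss))
    attach x xs c t = tileable-↭ H G
      (prep x (↭-trans (shifts (toList S) (toList xs)) (++⁺ˡ (toList xs) (↭-reflexive (sym (Vecₚ.toList-++ S (Vec.concat Ss)))))))
      (tileable-++ H G (tileable-↭ H G (insertAt-↭ S z x) (tileable-copy H G (insertAt S z x) c)) t)

  absorbs⇒tileable : ∀ Q g → absorbs H G Q g ≡ true → Tileable H G (support g) × Tileable H G (support g ++ toList Q)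
  absorbs⇒tileable Q g ok =
    subst (Tileable H G) (sym (Vecₚ.toList-++ (core g) (Vec.concat (parts g)))) (proj₁ lanes) ,
    tileable-↭ H G
      (↭-trans (++⁺ˡ (toList (core g)) (↭-++-comm (toList Q) _))
        (↭-reflexive (trans (sym (++-assoc (toList (core g)) _ (toList Q))) (cong (_++ toList Q) (sym (Vecₚ.toList-++ (core g) (Vec.concat (parts g))))))))
      (tileable-++ H G (tileable-copy H G (core g) (copyᵇ⇒ H G {core g} (proj₁ (∧-true {copyᵇ H G (core g)} (proj₂ split))))) (proj₂ lanes))
    where
    split = ∧-true {distinct (support g)} ok
    lanes = fits⇒tileable (roots g) (core g) Q (parts g) (proj₂ (∧-true {copyᵇ H G (core g)} (proj₂ split)))

  -- Each tuple uses up one gadget, which lowers the count of any other tuple by at most one. The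
  -- gadgets left over tile themselves.
  absorb : ∀ Qs gs → All (Absorbing H G) gs → (∀ Q → length Qs ≤ count (absorbs H G Q) gs) →
           Tileable H G (supports H G gs ++ concat (map toList Qs))
  absorb [] gs valid _ = tileable-↭ H G (↭-reflexive (sym (++-identityʳ _)))
    (tileable-concat H G (Allₚ.map⁺ (All.map (λ { {g} (Q , ok) → proj₁ (absorbs⇒tileable Q g ok) }) valid)))
  absorb (Q ∷ Qs) gs valid many with pick (absorbs H G Q) gs 1 (≤-trans (s≤s z≤n) (many Q))
  ... | g ∷ [] , gs′ , p , refl , ok ∷ [] = tileable-↭ H G
      (↭-trans (++-interchange (support g) (toList Q) (supports H G gs′) (concat (map toList Qs)))
        (++⁺ʳ (toList Q ++ concat (map toList Qs)) (↭-sym (concat-↭ (map⁺ support p)))))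
      (tileable-++ H G (proj₂ (absorbs⇒tileable Q g ok)) (absorb Qs gs′ (All.tail (All-resp-↭ p valid)) fewer))
    where
    fewer : ∀ Q′ → length Qs ≤ count (absorbs H G Q′) gs′
    fewer Q′ = ≤-pred (≤-trans (many Q′) (≤-trans (≤-reflexive (∑-↭ _ p)) (+-monoˡ-≤ _ (indicator≤1 (absorbs H G Q′ g)))))

-- Blown-up cycles

rotate : List A → List A
rotate []       = []
rotate (x ∷ xs) = xs ++ [ x ]

rotate-↭ : ∀ (xs : List A) → rotate xs ↭ xs
rotate-↭ []       = ↭-refl
rotate-↭ (x ∷ xs) = ↭-++-comm xs [ x ]

rotate-map : ∀ (f : A → A′) xs → rotate (map f xs) ≡ map f (rotate xs)
rotate-map f []       = refl
rotate-map f (x ∷ xs) = sym (map-++ f xs [ x ])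

rotate-pointwise : ∀ {R : A → A′ → Set} {xs ys} → Pointwise R xs ys → Pointwise R (rotate xs) (rotate ys)
rotate-pointwise []       = []
rotate-pointwise (r ∷ rs) = Pointwise.++⁺ rs (r ∷ [])

rotate^ : ℕ → List A → List A
rotate^ zero    xs = xs
rotate^ (suc k) xs = rotate^ k (rotate xs)

rotate^-↭ : ∀ k (xs : List A) → rotate^ k xs ↭ xs
rotate^-↭ zero    xs = ↭-refl
rotate^-↭ (suc k) xs = ↭-trans (rotate^-↭ k (rotate xs)) (rotate-↭ xs)

rotate^-pointwise : ∀ {R : A → A′ → Set} k {xs ys} → Pointwise R xs ys → Pointwise R (rotate^ k xs) (rotate^ k ys)
rotate^-pointwise zero    p = p
rotate^-pointwise (suc k) p = rotate^-pointwise k (rotate-pointwise p)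

Cyclic : (A → A → Set) → List A → Set
Cyclic R xs = Pointwise R xs (rotate xs)

cyclic-rotate : ∀ {R : A → A → Set} {x xs} → Cyclic R (x ∷ xs) → Cyclic R (xs ++ [ x ])
cyclic-rotate {xs = []}     p       = p
cyclic-rotate {xs = y ∷ xs} (r ∷ p) = Pointwise.++⁺ p (r ∷ [])

cyclic-++ : ∀ {R : A → A → Set} ps {qs} → Cyclic R (ps ++ qs) → Cyclic R (qs ++ ps)
cyclic-++ {R = R} []       {qs} p = subst (Cyclic R) (sym (++-identityʳ qs)) p
cyclic-++ {R = R} (x ∷ ps) {qs} p = subst (Cyclic R) (++-assoc qs [ x ] ps)
  (cyclic-++ ps (subst (Cyclic R) (++-assoc ps qs [ x ]) (cyclic-rotate p)))

cyclic-mono : ∀ {R : A → A → Set} {S : A′ → A′ → Set} {T : A′ → A → Set} →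
              (∀ {a b x y} → T a x → T b y → R x y → S a b) →
              ∀ {as xs} → Pointwise T as xs → Cyclic R xs → Cyclic S as
cyclic-mono mono t c = zip t c (rotate-pointwise t)
  where
  zip : ∀ {as xs ys bs} → Pointwise _ as xs → Pointwise _ xs ys → Pointwise _ bs ys → Pointwise _ as bs
  zip []       []       []       = []
  zip (t ∷ ts) (r ∷ rs) (u ∷ us) = mono t u r ∷ zip ts rs us

-- Position o of spin φ vs takes its u-th entry from position o + φ u of vs, cyclically.
spin : ∀ {k} → (Fin k → ℕ) → List (Vec A k) → List (Vec A k)
spin {k = zero}  φ vs = vs
spin {k = suc k} φ vs = List.zipWith _∷_ (rotate^ (φ zero) (map Vec.head vs)) (spin (φ ∘ suc) (map Vec.tail vs))

length-spin : ∀ {k} (φ : Fin k → ℕ) (vs : List (Vec A k)) → length (spin φ vs) ≡ length vs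
spin-heads : ∀ {k} (φ : Fin (suc k) → ℕ) (vs : List (Vec A (suc k))) →
             length (rotate^ (φ zero) (map Vec.head vs)) ≡ length (spin (φ ∘ suc) (map Vec.tail vs))
length-spin {k = zero}  φ vs = refl
length-spin {k = suc k} φ vs = trans (length-zipWith Vec._∷_ (rotate^ (φ zero) (map Vec.head vs)) (spin (φ ∘ suc) (map Vec.tail vs)))
  (trans (cong (Data.Nat._⊓ length (spin (φ ∘ suc) (map Vec.tail vs))) (spin-heads φ vs))
    (trans (⊓-idem _) (trans (length-spin (φ ∘ suc) (map Vec.tail vs)) (length-map Vec.tail vs))))
spin-heads φ vs = trans (↭-length (rotate^-↭ (φ zero) (map Vec.head vs)))
  (trans (length-map Vec.head vs) (sym (trans (length-spin (φ ∘ suc) (map Vec.tail vs)) (length-map Vec.tail vs))))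

zipWith-∷-↭ : ∀ {k} (xs : List A) (vs : List (Vec A k)) → length xs ≡ length vs →
              concat (map toList (List.zipWith _∷_ xs vs)) ↭ xs ++ concat (map toList vs)
zipWith-∷-↭ []       []       e = ↭-refl
zipWith-∷-↭ (x ∷ xs) (v ∷ vs) e = prep x (↭-trans (++⁺ˡ (toList v) (zipWith-∷-↭ xs vs (suc-injective e))) (shifts (toList v) xs))

spin-↭ : ∀ {k} (φ : Fin k → ℕ) (vs : List (Vec A k)) → concat (map toList (spin φ vs)) ↭ concat (map toList vs)
spin-↭ {k = zero}  φ vs = ↭-refl
spin-↭ {k = suc k} φ vs =
  ↭-trans (zipWith-∷-↭ _ (spin (φ ∘ suc) (map Vec.tail vs)) (spin-heads φ vs))
    (↭-trans (↭-++⁺ (rotate^-↭ (φ zero) (map Vec.head vs)) (spin-↭ (φ ∘ suc) (map Vec.tail vs)))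
      (↭-trans (↭-sym (zipWith-∷-↭ (map Vec.head vs) (map Vec.tail vs) (trans (length-map Vec.head vs) (sym (length-map Vec.tail vs)))))
        (↭-reflexive (cong (concat ∘ map toList) (rejoin vs)))))
  where
  rejoin : ∀ (vs : List (Vec _ (suc k))) → List.zipWith _∷_ (map Vec.head vs) (map Vec.tail vs) ≡ vs
  rejoin []             = refl
  rejoin ((x ∷ v) ∷ vs) = cong ((x ∷ v) ∷_) (rejoin vs)

column : ∀ {k} → Fin k → List (Vec A k) → List A
column u = map (λ v → lookup v u)

column-spin : ∀ {k} (φ : Fin k → ℕ) (vs : List (Vec A k)) u → column u (spin φ vs) ≡ rotate^ (φ u) (column u vs)
column-spin {k = suc k} φ vs zero = trans (firsts _ (spin (φ ∘ suc) (map Vec.tail vs)) (spin-heads φ vs)) (cong (rotate^ (φ zero)) (heads vs))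
  where
  firsts : ∀ xs (vs : List (Vec _ k)) → length xs ≡ length vs → column zero (List.zipWith _∷_ xs vs) ≡ xs
  firsts []       []       e = refl
  firsts (x ∷ xs) (v ∷ vs) e = cong (x ∷_) (firsts xs vs (suc-injective e))
  heads : ∀ (vs : List (Vec _ (suc k))) → map Vec.head vs ≡ column zero vs
  heads []             = refl
  heads ((x ∷ v) ∷ vs) = cong (x ∷_) (heads vs)
column-spin {k = suc k} φ vs (suc u) = trans (seconds _ (spin (φ ∘ suc) (map Vec.tail vs)) (spin-heads φ vs))
  (trans (column-spin (φ ∘ suc) (map Vec.tail vs) u) (cong (rotate^ (φ (suc u))) (tails vs)))
  where
  seconds : ∀ xs (vs : List (Vec _ k)) → length xs ≡ length vs → column (suc u) (List.zipWith _∷_ xs vs) ≡ column u vs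
  seconds []       []       e = refl
  seconds (x ∷ xs) (v ∷ vs) e = cong (lookup v u ∷_) (seconds xs vs (suc-injective e))
  tails : ∀ (vs : List (Vec _ (suc k))) → column u (map Vec.tail vs) ≡ column (suc u) vs
  tails []             = refl
  tails ((x ∷ v) ∷ vs) = cong (lookup v u ∷_) (tails vs)

module _ {n} (G : Digraph n) where

  Complete : List (Fin n) → List (Fin n) → Set
  Complete X Y = ∀ {x y} → x ∈ X → y ∈ Y → adj G x y ≡ true

  toVecs : ∀ {w} (cs : List (List (Fin n))) → All (λ c → length c ≡ w) cs → ∃ λ (vs : List (Vec (Fin n) w)) → map toList vs ≡ cs
  toVecs []       []          = [] , refl
  toVecs (c ∷ cs) (refl ∷ ls) with vs , e ← toVecs cs ls = Vec.fromList c ∷ vs , cong₂ _∷_ (Vecₚ.toList∘fromList c) e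

  module _ {h} (H : Digraph h) (path : HomToDirectedPath H) where

    -- An edge u v of H raises φ by one, so column v is rotated by one step more than column u, and
    -- `Cyclic` supplies the edges. Any cycle length will do: a copy may wind around several times,
    -- since each vertex of H draws on a column of its own.
    cycle-tileable : ∀ cs → All (λ c → length c ≡ h) cs → Cyclic Complete cs → Tileable H G (concat cs)
    cycle-tileable cs widths cyc = spin φ vs , All.tabulate copy , ↭-trans (spin-↭ φ vs) (↭-reflexive (cong concat vs≡cs))
      where
      φ : Fin h → ℕ
      φ u = toℕ (proj₁ (proj₂ path) u)
      vs = proj₁ (toVecs cs widths)
      vs≡cs = proj₂ (toVecs cs widths)
      cyc-vs : Cyclic (λ v w → ∀ i j → adj G (lookup v i) (lookup w j) ≡ true) vs
      cyc-vs = cyclic-mono {T = λ v c → toList v ≡ c} (λ { refl refl com i j → com (∈-toList⁺ (∈-lookup i _)) (∈-toList⁺ (∈-lookup j _)) })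
                 (aligned vs vs≡cs) cyc
        where
        aligned : ∀ vs {cs} → map toList vs ≡ cs → Pointwise (λ v c → toList v ≡ c) vs cs
        aligned []       refl = []
        aligned (v ∷ vs) refl = refl ∷ aligned vs refl
      edges : ∀ u v → adj H u v ≡ true → Pointwise (λ x y → adj G x y ≡ true) (column u (spin φ vs)) (column v (spin φ vs))
      edges u v e rewrite column-spin φ vs u | column-spin φ vs v | proj₂ (proj₂ path) u v e | rotate-map (λ w → lookup w v) vs =
        rotate^-pointwise (φ u) (Pointwise.map⁺ _ _ (Pointwise.map (λ com → com u v) cyc-vs))
      diagonal : ∀ u v (ts : List (Vec (Fin n) h)) → Pointwise (λ x y → adj G x y ≡ true) (column u ts) (column v ts) →
                 All (λ t → adj G (lookup t u) (lookup t v) ≡ true) ts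
      diagonal u v []       []       = []
      diagonal u v (t ∷ ts) (r ∷ rs) = r ∷ diagonal u v ts rs
      copy : ∀ {t} → t ∈ spin φ vs → IsCopy H G t
      copy t∈ u v e = All.lookup (diagonal u v (spin φ vs) (edges u v e)) t∈

arcs : List A → List (A × A)
arcs xs = List.zip xs (rotate xs)

arc-split : ∀ (x : A) xs e {a b} → (a , b) ∈ List.zip (x ∷ xs) (xs ++ [ e ]) →
            (∃₂ λ ps qs → x ∷ xs ≡ ps ++ a ∷ b ∷ qs) ⊎ (∃ λ ps → x ∷ xs ≡ ps ++ [ a ] × b ≡ e)
arc-split x []       e (here refl) = inj₂ ([] , refl , refl)
arc-split x (y ∷ ys) e (here refl) = inj₁ ([] , ys , refl)
arc-split x (y ∷ ys) e (there i) with arc-split y ys e i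
... | inj₁ (ps , qs , eq) = inj₁ (x ∷ ps , qs , cong (x ∷_) eq)
... | inj₂ (ps , eq , eb) = inj₂ (x ∷ ps , cong (x ∷_) eq , eb)

rotate-to-arc : ∀ {R : A → A → Set} xs {a b} → 2 ≤ length xs → Cyclic R xs → (a , b) ∈ arcs xs →
                ∃ λ rest → Cyclic R (a ∷ b ∷ rest) × xs ↭ a ∷ b ∷ rest
rotate-to-arc (x ∷ xs) {a} {b} 2≤ cyc i with arc-split x xs x i
... | inj₁ (ps , qs , eq) = qs ++ ps , cyclic-++ ps (subst (Cyclic _) eq cyc) ,
                            ↭-trans (↭-reflexive eq) (↭-++-comm ps (a ∷ b ∷ qs))
... | inj₂ ([] , refl , _) = contradiction 2≤ λ { (s≤s ()) }
... | inj₂ (p ∷ ps , refl , refl) = ps , cyclic-++ (p ∷ ps) cyc , ↭-++-comm (p ∷ ps) [ a ]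

∑-zip : ∀ (xs : List A) (ys : List A′) f g → length xs ≡ length ys →
        ∑ (List.zip xs ys) (λ p → f (proj₁ p) + g (proj₂ p)) ≡ ∑ xs f + ∑ ys g
∑-zip []       []       f g e = refl
∑-zip (x ∷ xs) (y ∷ ys) f g e = trans (cong (f x + g y +_) (∑-zip xs ys f g (suc-injective e))) (interchange (f x) (g y) _ _)
  where
  interchange : ∀ a b c d → a + b + (c + d) ≡ a + c + (b + d)
  interchange = solve-∀

∑-arcs : ∀ (xs : List A) f g → ∑ (arcs xs) (λ p → f (proj₁ p) + g (proj₂ p)) ≡ ∑ xs f + ∑ xs g
∑-arcs xs f g = trans (∑-zip xs (rotate xs) f g (sym (↭-length (rotate-↭ xs)))) (cong (∑ xs f +_) (∑-↭ g (rotate-↭ xs)))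

All-length-concat : ∀ {w} {cs : List (List A)} → All (λ c → length c ≡ w) cs → length (concat cs) ≡ length cs * w
All-length-concat []            = refl
All-length-concat {cs = c ∷ cs} (refl ∷ ls) = trans (length-++ c) (cong (length c +_) (All-length-concat ls))

-- Systems of blown-up cycles of bounded length

module _ {n} (G : Digraph n) where

  -- The bound M on the number of clusters limits how many vertices are tied up when a cycle is cut
  -- for an insertion.
  record Fat (w M : ℕ) (cs : List (List (Fin n))) : Set where
    field
      cyclic  : Cyclic (Complete G) cs
      widths  : All (λ c → length c ≡ w) cs
      long    : 2 ≤ length cs
      bounded : length cs ≤ M
  open Fat public

  System : Set
  System = List (List (List (Fin n)))

  vertices : System → List (Fin n)
  vertices F = concat (map concat F)

  vertices-++ : ∀ F F′ → vertices (F ++ F′) ≡ vertices F ++ vertices F′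
  vertices-++ F F′ = trans (cong concat (map-++ concat F F′)) (sym (concat-++ (map concat F) (map concat F′)))

  vertices-↭ : ∀ {F F′} → F ↭ F′ → vertices F ↭ vertices F′
  vertices-↭ p = concat-↭ (map⁺ concat p)

  fat-weaken : ∀ {w M cs} → Fat w M cs → Fat w (suc M) cs
  fat-weaken f = record { cyclic = cyclic f ; widths = widths f ; long = long f ; bounded = m≤n⇒m≤1+n (bounded f) }

  _⊑_ : List (Fin n) → List (Fin n) → Set
  X ⊑ Y = ∀ {x} → x ∈ X → x ∈ Y

  cyclic-⊑ : ∀ {as xs} → Pointwise _⊑_ as xs → Cyclic (Complete G) xs → Cyclic (Complete G) as
  cyclic-⊑ = cyclic-mono {T = _⊑_} (λ p q com {x} {y} x∈ y∈ → com (p x∈) (q y∈))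

  take-⊑ : ∀ w cs → Pointwise _⊑_ (map (List.take w) cs) cs
  take-⊑ w []       = []
  take-⊑ w (c ∷ cs) = (λ {x} i → subst (x ∈_) (take++drop≡id w c) (∈-++⁺ˡ i)) ∷ take-⊑ w cs

  drop-⊑ : ∀ w cs → Pointwise _⊑_ (map (List.drop w) cs) cs
  drop-⊑ w []       = []
  drop-⊑ w (c ∷ cs) = (λ {x} i → subst (x ∈_) (take++drop≡id w c) (∈-++⁺ʳ (List.take w c) i)) ∷ drop-⊑ w cs

  take-widths : ∀ {w r cs} → All (λ (c : List (Fin n)) → length c ≡ w + r) cs → All (λ c → length c ≡ w) (map (List.take w) cs)
  take-widths {w} {r} ls = Allₚ.map⁺ (All.map (λ {c} e → trans (length-take w c) (m≤n⇒m⊓n≡m (≤-trans (m≤m+n w r) (≤-reflexive (sym e))))) ls)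

  drop-widths : ∀ {w r cs} → All (λ (c : List (Fin n)) → length c ≡ w + r) cs → All (λ c → length c ≡ r) (map (List.drop w) cs)
  drop-widths {w} {r} ls = Allₚ.map⁺ (All.map (λ {c} e → trans (length-drop w c) (trans (cong (_∸ w) e) (m+n∸m≡n w r))) ls)

  take-drop-↭ : ∀ w (cs : List (List (Fin n))) → concat cs ↭ concat (map (List.take w) cs) ++ concat (map (List.drop w) cs)
  take-drop-↭ w []       = ↭-refl
  take-drop-↭ w (c ∷ cs) = ↭-trans (↭-++⁺ (↭-reflexive (sym (take++drop≡id w c))) (take-drop-↭ w cs))
                             (++-interchange (List.take w c) (List.drop w c) _ _)

  split-cycle : ∀ {w M} q {cs} → Fat (q * w) M cs → ∃ λ F → All (Fat w M) F × concat cs ↭ vertices F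
  split-cycle zero    {cs} f = [] , [] , ↭-reflexive (empty (widths f))
    where
    empty : ∀ {cs : List (List (Fin n))} → All (λ c → length c ≡ 0) cs → concat cs ≡ []
    empty []                  = refl
    empty {[] ∷ cs} (_ ∷ ls) = empty ls
  split-cycle {w} (suc q) {cs} f with F , fats , p ← split-cycle q {map (List.drop w) cs} record
      { cyclic = cyclic-⊑ (drop-⊑ w cs) (cyclic f) ; widths = drop-widths (widths f)
      ; long = subst (2 ≤_) (sym (length-map _ cs)) (long f) ; bounded = subst (_≤ _) (sym (length-map _ cs)) (bounded f) }
    = map (List.take w) cs ∷ F ,
      record { cyclic = cyclic-⊑ (take-⊑ w cs) (cyclic f) ; widths = take-widths (widths f)
             ; long = subst (2 ≤_) (sym (length-map _ cs)) (long f) ; bounded = subst (_≤ _) (sym (length-map _ cs)) (bounded f) } ∷ fats ,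
      ↭-trans (take-drop-↭ w cs) (++⁺ˡ (concat (map (List.take w) cs)) p)

  split-system : ∀ {w M} q {F} → All (Fat (q * w) M) F → ∃ λ F′ → All (Fat w M) F′ × vertices F ↭ vertices F′
  split-system q []       = [] , [] , ↭-refl
  split-system q (f ∷ fs) with F₁ , f₁ , p ← split-cycle q f with F₂ , f₂ , r ← split-system q fs
    = F₁ ++ F₂ , Allₚ.++⁺ f₁ f₂ , ↭-trans (↭-++⁺ p r) (↭-reflexive (sym (vertices-++ F₁ F₂)))

  -- Only a slice of width w is lengthened, by a detour through Z; the rest of the cycle keeps its
  -- arc from the first cluster to the second and is cut into q slices of the old length.
  insert : ∀ {w M} q {X R Y S Z : List (Fin n)} {rest} →
           Fat (suc q * w) M ((X ++ R) ∷ (Y ++ S) ∷ rest) → length X ≡ w → length Y ≡ w → length Z ≡ w →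
           Complete G X Z → Complete G Z Y →
           ∃ λ F → All (Fat w (suc M)) F × Z ++ concat ((X ++ R) ∷ (Y ++ S) ∷ rest) ↭ vertices F
  insert {w} {M} q {X} {R} {Y} {S} {Z} {rest} f lX lY lZ X→Z Z→Y =
    inserted ∷ proj₁ others , fat-inserted ∷ All.map fat-weaken (proj₁ (proj₂ others)) , perm
    where
    inserted remainder : List (List (Fin n))
    inserted = X ∷ Z ∷ Y ∷ map (List.take w) rest
    remainder = R ∷ S ∷ map (List.drop w) rest
    thin : Cyclic (Complete G) (X ∷ Y ∷ map (List.take w) rest)
    thin = cyclic-⊑ (∈-++⁺ˡ ∷ ∈-++⁺ˡ ∷ take-⊑ w rest) (cyclic f)
    longer : Cyclic (Complete G) (X ∷ Y ∷ map (List.take w) rest) → Cyclic (Complete G) inserted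
    longer (_ ∷ c) = X→Z ∷ Z→Y ∷ c
    rest-widths = All.tail (All.tail (widths f))
    leftover : ∀ {P Q : List (Fin n)} → length (P ++ Q) ≡ suc q * w → length P ≡ w → length Q ≡ q * w
    leftover {P} {Q} e refl = +-cancelˡ-≡ (length P) _ _ (trans (sym (length-++ P)) e)
    fat-inserted : Fat w (suc M) inserted
    fat-inserted = record
      { cyclic = longer thin ; widths = lX ∷ lZ ∷ lY ∷ take-widths rest-widths ; long = s≤s (s≤s z≤n)
      ; bounded = s≤s (subst (λ l → suc (suc l) ≤ M) (sym (length-map _ rest)) (bounded f)) }
    others = split-cycle q {remainder} record
      { cyclic = cyclic-⊑ (∈-++⁺ʳ X ∷ ∈-++⁺ʳ Y ∷ drop-⊑ w rest) (cyclic f)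
      ; widths = leftover {X} (All.head (widths f)) lX ∷ leftover {Y} (All.head (All.tail (widths f))) lY ∷ drop-widths rest-widths
      ; long = s≤s (s≤s z≤n) ; bounded = subst (λ l → suc (suc l) ≤ M) (sym (length-map _ rest)) (bounded f) }
    perm : Z ++ concat ((X ++ R) ∷ (Y ++ S) ∷ rest) ↭ vertices (inserted ∷ proj₁ others)
    perm = begin
      Z ++ ((X ++ R) ++ ((Y ++ S) ++ concat rest))
        ↭⟨ ++⁺ˡ Z (++⁺ˡ (X ++ R) (↭-trans (++⁺ˡ (Y ++ S) (take-drop-↭ w rest)) (++-interchange Y S _ _))) ⟩
      Z ++ ((X ++ R) ++ ((Y ++ T) ++ (S ++ D)))
        ↭⟨ ++⁺ˡ Z (++-interchange X R (Y ++ T) (S ++ D)) ⟩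
      Z ++ ((X ++ (Y ++ T)) ++ (R ++ (S ++ D)))
        ≡⟨ cong (Z ++_) (++-assoc X (Y ++ T) _) ⟩
      Z ++ (X ++ ((Y ++ T) ++ (R ++ (S ++ D))))
        ↭⟨ shifts Z X ⟩
      X ++ (Z ++ ((Y ++ T) ++ (R ++ (S ++ D))))
        ≡⟨ trans (cong (X ++_) (sym (++-assoc Z (Y ++ T) _))) (sym (++-assoc X (Z ++ (Y ++ T)) _)) ⟩
      concat inserted ++ concat remainder
        ↭⟨ ++⁺ˡ (concat inserted) (proj₂ (proj₂ others)) ⟩
      concat inserted ++ vertices (proj₁ others) ∎
      where
      open PermutationReasoning
      T = concat (map (List.take w) rest)
      D = concat (map (List.drop w) rest)

-- Enlarging a cycle system

length-zip-rotate : ∀ (xs : List A) → length (arcs xs) ≡ length xs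
length-zip-rotate xs = trans (length-zipWith _,_ xs (rotate xs)) (trans (cong (length xs Data.Nat.⊓_) (↭-length (rotate-↭ xs))) (⊓-idem _))

module _ {n} (G : Digraph n) where

  slot : Fin n → List (Fin n) × List (Fin n) → ℕ
  slot v (X , Y) = count (λ u → adj G u v) X + count (adj G v) Y

  allArcs : System G → List (List (Fin n) × List (Fin n))
  allArcs F = concat (map arcs F)

  -- Each cluster begins one arc and ends one arc, so every edge from a cluster into v and every
  -- edge from v into a cluster is counted once. A large degree thus becomes room between
  -- consecutive clusters.
  ∑-slots : ∀ v F → ∑ (allArcs F) (slot v) ≡ degreeIn G v (vertices G F)
  ∑-slots v []       = refl
  ∑-slots v (cs ∷ F) = trans (∑-++ (arcs cs) (allArcs F) (slot v)) (trans (cong₂ _+_ one (∑-slots v F)) (sym (degreeIn-++ G v (concat cs) (vertices G F))))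
    where
    one : ∑ (arcs cs) (slot v) ≡ degreeIn G v (concat cs)
    one = trans (∑-arcs cs (count (λ u → adj G u v)) (count (adj G v)))
                (sym (cong₂ _+_ (∑-concat cs _) (∑-concat cs _)))

  length-allArcs : ∀ {t M F} → All (Fat G t M) F → length (allArcs F) * t ≡ length (vertices G F)
  length-allArcs []                       = refl
  length-allArcs {t} {F = cs ∷ F} (f ∷ fs) = begin
    length (arcs cs ++ allArcs F) * t             ≡⟨ cong (_* t) (length-++ (arcs cs)) ⟩
    (length (arcs cs) + length (allArcs F)) * t   ≡⟨ *-distribʳ-+ t (length (arcs cs)) _ ⟩
    length (arcs cs) * t + length (allArcs F) * t ≡⟨ cong₂ _+_ (trans (cong (_* t) (length-zip-rotate cs)) (sym (All-length-concat (widths f)))) (length-allArcs fs) ⟩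
    length (concat cs) + length (vertices G F)    ≡⟨ length-++ (concat cs) ⟨
    length (vertices G (cs ∷ F))                  ∎
    where open ≡-Reasoning

  arc-cycle : ∀ {F : System G} {a} → a ∈ allArcs F → ∃₂ λ cs F′ → F ↭ cs ∷ F′ × a ∈ arcs cs
  arc-cycle {cs ∷ F} i with ∈-++⁻ (arcs cs) i
  ... | inj₁ j = cs , F , ↭-refl , j
  ... | inj₂ j with ds , F′ , p , k ← arc-cycle {F} j = ds , cs ∷ F′ , ↭-trans (prep cs p) (_↭_.swap cs ds ↭-refl) , k

  module _ (P′ w : ℕ) (1≤w : 1 ≤ w) where

    private
      P q′ t : ℕ
      P  = suc P′
      q′ = P′ + suc P′
      -- `suc q′` is `P + P`, so half of the surplus t / P is exactly w, the width to be cut out.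
      t  = suc q′ * w
      1≤t : 1 ≤ t
      1≤t = ≤-trans 1≤w (m≤m+n w (q′ * w))

    -- There are f / t arcs for the f vertices of the system, and each v in S spreads more than (1 +
    -- 1 / P) f edges over them. So on some arc the slots of the vertices in S average more than (1
    -- + 1 / P) t.
    popular-arc : ∀ {M F} S → All (Fat G t M) F → 1 ≤ length S →
      (∀ v → v ∈ S → suc P * length (vertices G F) < P * degreeIn G v (vertices G F)) →
      ∃ λ a → a ∈ allArcs F × suc P * t * length S < P * ∑ S (λ v → slot v a)
    popular-arc {F = F} S fats 1≤S heavy = ∑-<⇒∃< (allArcs F) (λ _ → suc P * t * length S) (λ a → P * ∑ S (λ v → slot v a)) (begin-strict
      ∑ (allArcs F) (λ _ → suc P * t * length S)              ≡⟨ ∑-const (allArcs F) _ ⟩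
      length (allArcs F) * (suc P * t * length S)             ≡⟨ arith (length (allArcs F)) (suc P) t (length S) ⟩
      length S * (suc P * (length (allArcs F) * t))           ≡⟨ cong (λ z → length S * (suc P * z)) (length-allArcs fats) ⟩
      length S * (suc P * f)                                  <⟨ m<m+n _ {length S} 1≤S ⟩
      length S * (suc P * f) + length S                       ≡⟨ trans (+-comm _ (length S)) (sym (*-suc (length S) (suc P * f))) ⟩
      length S * suc (suc P * f)                              ≡⟨ ∑-const S _ ⟨
      ∑ S (λ _ → suc (suc P * f))                             ≤⟨ ∑-mono-∈ S heavy ⟩
      ∑ S (λ v → P * degreeIn G v (vertices G F))             ≡⟨ ∑-*ˡ S P _ ⟩
      P * ∑ S (λ v → degreeIn G v (vertices G F))             ≡⟨ cong (P *_) (∑-cong S (λ v → sym (∑-slots v F))) ⟩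
      P * ∑ S (λ v → ∑ (allArcs F) (slot v))                  ≡⟨ cong (P *_) (∑-swap S (allArcs F) slot) ⟩
      P * ∑ (allArcs F) (λ a → ∑ S (λ v → slot v a))          ≡⟨ ∑-*ˡ (allArcs F) P _ ⟨
      ∑ (allArcs F) (λ a → P * ∑ S (λ v → slot v a))          ∎)
      where
      open ≤-Reasoning
      f = length (vertices G F)
      arith : ∀ a p t s → a * (p * t * s) ≡ s * (p * (a * t))
      arith = solve-∀

    -- Half of the average surplus is given up, so that a 1 / (4P) share of S qualifies; by `halves`
    -- the other half still yields w neighbours on either side.
    suited : List (Fin n) × List (Fin n) → Fin n → Bool
    suited a v = suc (P + P) * t ≤ᵈ (P + P) * slot v a

    suited-many : ∀ S X Y → length X ≡ t → length Y ≡ t → suc P * t * length S < P * ∑ S (λ v → slot v (X , Y)) →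
                  length S ≤ 4 * P * count (suited (X , Y)) S
    suited-many S X Y lX lY lt = *-cancelˡ-≤ t ⦃ >-nonZero 1≤t ⦄ (+-cancelˡ-≤ (length S * (suc (P + P) * t)) _ _ (begin
      length S * (suc (P + P) * t) + t * length S              ≡⟨ arith₁ (length S) P t ⟩
      suc P * t * length S + suc P * t * length S              ≤⟨ +-mono-≤ (<⇒≤ lt) (<⇒≤ lt) ⟩
      P * Σs + P * Σs                                          ≡⟨ *-distribʳ-+ Σs P P ⟨
      (P + P) * Σs                                             ≡⟨ ∑-*ˡ S (P + P) _ ⟨
      ∑ S (λ v → (P + P) * slot v (X , Y))                     ≤⟨ markov S _ (suc (P + P) * t) ((P + P) * (t + t)) (suited (X , Y)) pt ⟩
      length S * (suc (P + P) * t) + (P + P) * (t + t) * #g    ≡⟨ cong (length S * (suc (P + P) * t) +_) (arith₂ P t #g) ⟩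
      length S * (suc (P + P) * t) + t * (4 * P * #g)          ∎))
      where
      open ≤-Reasoning
      Σs = ∑ S (λ v → slot v (X , Y))
      #g = count (suited (X , Y)) S
      arith₁ : ∀ s P t → s * ((1 + (P + P)) * t) + t * s ≡ (1 + P) * t * s + (1 + P) * t * s
      arith₁ = solve-∀
      arith₂ : ∀ P t g → (P + P) * (t + t) * g ≡ t * (4 * P * g)
      arith₂ = solve-∀
      slot≤ : ∀ v → slot v (X , Y) ≤ t + t
      slot≤ v = +-mono-≤ (≤-trans (count≤length (λ u → adj G u v) X) (≤-reflexive lX)) (≤-trans (count≤length (adj G v) Y) (≤-reflexive lY))
      pt : ∀ v → (P + P) * slot v (X , Y) ≤ suc (P + P) * t + (P + P) * (t + t) * indicator (suited (X , Y) v)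
      pt v with suited (X , Y) v in e
      ... | true  = ≤-trans (*-monoʳ-≤ (P + P) (slot≤ v)) (≤-trans (≤-reflexive (sym (*-identityʳ _))) (m≤n+m _ (suc (P + P) * t)))
      ... | false = ≤-trans (<⇒≤ (≤ᵈ-false {suc (P + P) * t} {(P + P) * slot v (X , Y)} e)) (m≤m+n _ _)

    halves : ∀ a b → suc (P + P) * t ≤ (P + P) * (a + b) → b ≤ t → w ≤ a
    halves a b le b≤t = *-cancelˡ-≤ (P + P) (+-cancelˡ-≤ ((P + P) * t) _ _ (begin
      (P + P) * t + (P + P) * w    ≡⟨ +-comm ((P + P) * t) _ ⟩
      suc (P + P) * t              ≤⟨ le ⟩
      (P + P) * (a + b)            ≡⟨ *-distribˡ-+ (P + P) a b ⟩
      (P + P) * a + (P + P) * b    ≤⟨ +-monoʳ-≤ ((P + P) * a) (*-monoʳ-≤ (P + P) b≤t) ⟩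
      (P + P) * a + (P + P) * t    ≡⟨ +-comm ((P + P) * a) _ ⟩
      (P + P) * t + (P + P) * a    ∎))
      where open ≤-Reasoning

    -- The cycles in `fresh` keep the width t and remain available. `used-size` charges the cycle
    -- that was cut, with at most M t vertices, to the newly covered vertices, of which there are at
    -- least w.
    record Enlarged (M : ℕ) (F : System G) (L : List (Fin n)) : Set where
      field
        fresh used : System G
        new rest   : List (Fin n)
        fresh-fat  : All (Fat G t M) fresh
        used-fat   : All (Fat G w (suc M)) used
        taken      : L ↭ new ++ rest
        new-size   : w ≤ length new
        covered    : new ++ vertices G F ↭ vertices G used ++ vertices G fresh
        used-size  : length (vertices G used) ≤ suc (M * suc q′) * length new

    enlarge-by-insertion : ∀ {M F} S → All (Fat G t M) F → 1 ≤ length S → 4 * P * (2 ^ (t + t) * w) ≤ length S →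
      (∀ v → v ∈ S → suc P * length (vertices G F) < P * degreeIn G v (vertices G F)) → Enlarged M F S
    enlarge-by-insertion {M} {F} S fats 1≤S large heavy
      with (Xs , Ys) , a∈ , lt ← popular-arc S fats 1≤S heavy
      with cs , F′ , F↭ , a∈cs ← arc-cycle {F} a∈
      with f ∷ fats′ ← All-resp-↭ F↭ fats
      with rest , cyc , cs↭ ← rotate-to-arc cs (long f) (cyclic f) a∈cs
      with ws@(lX ∷ lY ∷ _) ← All-resp-↭ cs↭ (widths f)
      with S₁ , S₂ , S↭ , lS₁ , S₁-suited ← pick (suited (Xs , Ys)) S (2 ^ (t + t) * w)
             (*-cancelˡ-≤ (4 * P) (≤-trans large (suited-many S Xs Ys lX lY lt)))
      -- The tests are the adjacencies to all 2t vertices of the two clusters. The vertices of Z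
      -- agree on them, so X and Y can be read off from a single z.
      with pigeonhole (map (λ x v → adj G x v) Xs ++ map (λ y v → adj G v y) Ys) S₁ w
             (≤-reflexive (trans (cong (λ l → 2 ^ l * w) (trans (length-++ (map (λ x v → adj G x v) Xs)) (cong₂ _+_ (trans (length-map _ Xs) lX) (trans (length-map _ Ys) lY)))) (sym lS₁)))
    ... | []         , _  , _   , lZ , _    = contradiction (≤-trans 1≤w (≤-reflexive (sym lZ))) λ ()
    ... | Z@(z ∷ _) , S₃ , S₁↭ , lZ , same
      with enough ← ≤ᵈ-true {suc (P + P) * t} {(P + P) * slot z (Xs , Ys)} (All.lookup S₁-suited (∈-resp-↭ (↭-sym S₁↭) (here refl)))
      with X , R , X↭ , lx , X→z ← pick (λ x → adj G x z) Xs w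
             (halves (count (λ x → adj G x z) Xs) _ enough (≤-trans (count≤length (adj G z) Ys) (≤-reflexive lY)))
      with Y , T , Y↭ , ly , z→Y ← pick (adj G z) Ys w
             (halves (count (adj G z) Ys) _ (subst (λ s → suc (P + P) * t ≤ (P + P) * s) (+-comm (count (λ x → adj G x z) Xs) _) enough)
                (≤-trans (count≤length (λ x → adj G x z) Xs) (≤-reflexive lX)))
      = record
        { fresh = F′ ; used = proj₁ ins ; new = Z ; rest = S₃ ++ S₂ ; fresh-fat = fats′ ; used-fat = proj₁ (proj₂ ins)
        ; taken = ↭-trans S↭ (↭-trans (++⁺ʳ S₂ S₁↭) (↭-reflexive (++-assoc Z S₃ S₂)))
        ; new-size = ≤-reflexive (sym lZ)
        ; covered = ↭-trans (++⁺ˡ Z (vertices-↭ G F↭)) (↭-trans (↭-reflexive (sym (++-assoc Z (concat cs) _))) (++⁺ʳ (vertices G F′) used↭))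
        ; used-size = size }
      where
      com₁ : Complete G X Z
      com₁ {x} {z′} x∈ z∈ = trans (same (λ v → adj G x v) (∈-++⁺ˡ (∈-map⁺ (λ x v → adj G x v) (∈-resp-↭ (↭-sym X↭) (∈-++⁺ˡ x∈)))) z′ z z∈ (here refl)) (All.lookup X→z x∈)
      com₂ : Complete G Z Y
      com₂ {z′} {y} z∈ y∈ = trans (same (λ v → adj G v y) (∈-++⁺ʳ (map (λ x v → adj G x v) Xs) (∈-map⁺ (λ y v → adj G v y) (∈-resp-↭ (↭-sym Y↭) (∈-++⁺ˡ y∈)))) z′ z z∈ (here refl)) (All.lookup z→Y y∈)
      fat : Fat G t M ((X ++ R) ∷ (Y ++ T) ∷ rest)
      fat = record
        { cyclic = cyclic-⊑ G (∈-resp-↭ (↭-sym X↭) ∷ ∈-resp-↭ (↭-sym Y↭) ∷ Pointwise.refl (λ {_} {_} i → i)) cyc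
        ; widths = trans (sym (↭-length X↭)) lX ∷ trans (sym (↭-length Y↭)) lY ∷ All.tail (All.tail ws)
        ; long = s≤s (s≤s z≤n) ; bounded = subst (_≤ M) (↭-length cs↭) (bounded f) }
      ins = insert G q′ fat lx ly lZ com₁ com₂
      used↭ : Z ++ concat cs ↭ vertices G (proj₁ ins)
      used↭ = ↭-trans (++⁺ˡ Z (↭-trans (concat-↭ cs↭) (↭-++⁺ X↭ (↭-++⁺ Y↭ ↭-refl)))) (proj₂ (proj₂ ins))
      size : length (vertices G (proj₁ ins)) ≤ suc (M * suc q′) * length Z
      size = begin
        length (vertices G (proj₁ ins))     ≡⟨ ↭-length used↭ ⟨
        length (Z ++ concat cs)             ≡⟨ trans (length-++ Z) (cong₂ _+_ lZ (All-length-concat (widths f))) ⟩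
        w + length cs * t                   ≤⟨ +-monoʳ-≤ w (*-monoˡ-≤ t (bounded f)) ⟩
        w + M * (suc q′ * w)                ≡⟨ cong (w +_) (*-assoc M (suc q′) w) ⟨
        suc (M * suc q′) * w                ≡⟨ cong (suc (M * suc q′) *_) lZ ⟨
        suc (M * suc q′) * length Z         ∎
        where open ≤-Reasoning

open Enlarged public

-- When fewer than t vertices are inward, the first two summands leave enough of the others for an
-- insertion, and `suc` keeps these nonempty; the last summand is what the 2-cycle needs.
threshold : ℕ → ℕ → ℕ
threshold P′ w = suc (t + 4 * P * (2 ^ (t + t) * w) + (P + P) * (t + 2 ^ t * w))
  where
  P t : ℕ
  P = suc P′
  t = (P + P) * w

module _ {n} (G : Digraph n) where

  twoway : Fin n → Fin n → Bool
  twoway v u = adj G v u ∧ adj G u v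

  degreeIn≤twoway : ∀ v xs → degreeIn G v xs ≤ length xs + count (twoway v) xs
  degreeIn≤twoway v xs = ≤-trans (≤-reflexive (+-comm (count (λ u → adj G u v) xs) _)) (count-∧ (adj G v) (λ u → adj G u v) xs)

  module _ (P′ w : ℕ) (1≤w : 1 ≤ w) where

    private
      P t : ℕ
      P = suc P′
      t = (P + P) * w

    inward : List (Fin n) → Fin n → Bool
    inward L v = suc P * length L ≤ᵈ P * degreeIn G v L

    linked : List (Fin n) → Fin n → Bool
    linked T u = t ≤ᵈ (P + P) * count (λ v → twoway v u) T

    -- An inward v has at least |L| / P two-way neighbours in L. Counting such pairs between T and L
    -- gives many u linked to at least w vertices of T, of which at most t lie in T itself.
    linked-many : ∀ {L T L₁} → L ↭ T ++ L₁ → length T ≡ t → All (λ v → inward L v ≡ true) T →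
                  length L ≤ (P + P) * (t + count (linked T) L₁)
    linked-many {L} {T} {L₁} L↭ lT inw = begin
      length L                                         ≤⟨ popular L (λ u → count (λ v → twoway v u) T) t P (λ u _ → ≤-trans (count≤length (λ v → twoway v u) T) (≤-reflexive lT)) (s≤s z≤n) total ⟩
      (P + P) * count (linked T) L                     ≡⟨ cong ((P + P) *_) (trans (∑-↭ _ L↭) (∑-++ T L₁ _)) ⟩
      (P + P) * (count (linked T) T + count (linked T) L₁) ≤⟨ *-monoʳ-≤ (P + P) (+-monoˡ-≤ _ (≤-trans (count≤length (linked T) T) (≤-reflexive lT))) ⟩
      (P + P) * (t + count (linked T) L₁)              ∎
      where
      open ≤-Reasoning
      many : ∀ v → v ∈ T → length L ≤ P * count (twoway v) L
      many v v∈ = +-cancelʳ-≤ (P * length L) _ _ (begin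
        length L + P * length L                        ≤⟨ ≤ᵈ-true {suc P * length L} {P * degreeIn G v L} (All.lookup inw v∈) ⟩
        P * degreeIn G v L                             ≤⟨ *-monoʳ-≤ P (degreeIn≤twoway v L) ⟩
        P * (length L + count (twoway v) L)            ≡⟨ trans (*-distribˡ-+ P (length L) _) (+-comm (P * length L) _) ⟩
        P * count (twoway v) L + P * length L          ∎)
      total : length L * t ≤ P * ∑ L (λ u → count (λ v → twoway v u) T)
      total = begin
        length L * t                                   ≡⟨ trans (*-comm (length L) t) (cong (_* length L) (sym lT)) ⟩
        length T * length L                            ≡⟨ ∑-const T (length L) ⟨
        ∑ T (λ _ → length L)                           ≤⟨ ∑-mono-∈ T many ⟩
        ∑ T (λ v → P * count (twoway v) L)             ≡⟨ ∑-*ˡ T P _ ⟩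
        P * ∑ T (λ v → count (twoway v) L)             ≡⟨ cong (P *_) (∑-swap T L _) ⟩
        P * ∑ L (λ u → count (λ v → twoway v u) T)     ∎

    enlarge-by-2-cycle : ∀ {M F} L → All (Fat G t M) F → 1 ≤ M → t ≤ count (inward L) L → (P + P) * (t + 2 ^ t * w) ≤ length L →
                         Enlarged G P′ w 1≤w M F L
    enlarge-by-2-cycle {M} {F} L fats 1≤M many large
      with T , L₁ , L↭ , lT , inw ← pick (inward L) L t many
      with S , L₂ , L₁↭ , lS , S-linked ← pick (linked T) L₁ (2 ^ t * w)
             (+-cancelˡ-≤ t _ _ (*-cancelˡ-≤ (P + P) (≤-trans large (linked-many L↭ lT inw))))
      -- One test per vertex of T covers both directions, so two-way neighbours of a single z are
      -- joined to all of Z both ways.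
      with pigeonhole (map twoway T) S w (≤-reflexive (trans (cong (λ l → 2 ^ l * w) (trans (length-map twoway T) lT)) (sym lS)))
    ... | []        , _  , _  , lZ , _ = contradiction (≤-trans 1≤w (≤-reflexive (sym lZ))) λ ()
    ... | Z@(z ∷ _) , S′ , S↭ , lZ , same
      with X , T′ , T↭ , lX , X-z ← pick (λ v → twoway v z) T w
             (*-cancelˡ-≤ (P + P) (≤ᵈ-true {t} {(P + P) * count (λ v → twoway v z) T} (All.lookup S-linked (∈-resp-↭ (↭-sym S↭) (here refl)))))
      = record
        { fresh = F ; used = cycle ∷ [] ; new = X ++ Z ; rest = T′ ++ (S′ ++ L₂) ; fresh-fat = fats
        ; used-fat = record { cyclic = (λ x∈ z∈ → proj₁ (both x∈ z∈)) ∷ (λ z∈ x∈ → proj₂ (both x∈ z∈)) ∷ []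
                            ; widths = lX ∷ lZ ∷ [] ; long = ≤-refl ; bounded = s≤s 1≤M } ∷ []
        ; taken = ↭-trans L↭ (↭-trans (↭-++⁺ T↭ (↭-trans L₁↭ (↭-trans (++⁺ʳ L₂ S↭) (↭-reflexive (++-assoc Z S′ L₂)))))
                    (++-interchange X T′ Z (S′ ++ L₂)))
        ; new-size = ≤-trans (≤-reflexive (sym lX)) (≤-trans (m≤m+n (length X) (length Z)) (≤-reflexive (sym (length-++ X))))
        ; covered = ↭-reflexive (cong (_++ vertices G F) (sym cycle-vertices))
        ; used-size = ≤-trans (≤-reflexive (cong length cycle-vertices)) (m≤m+n (length (X ++ Z)) _) }
      where
      cycle : List (List (Fin n))
      cycle = X ∷ Z ∷ []
      cycle-vertices : vertices G (cycle ∷ []) ≡ X ++ Z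
      cycle-vertices = trans (++-identityʳ _) (cong (X ++_) (++-identityʳ Z))
      both : ∀ {x u} → x ∈ X → u ∈ Z → adj G x u ≡ true × adj G u x ≡ true
      both {x} {u} x∈ u∈ = ∧-true (trans (same (twoway x) (∈-map⁺ twoway (∈-resp-↭ (↭-sym T↭) (∈-++⁺ˡ x∈))) u z u∈ (here refl)) (All.lookup X-z x∈))

    enlarge : ∀ {M F} L → All (Fat G t M) F → 1 ≤ M → threshold P′ w ≤ length L → Dense P G (vertices G F ++ L) →
              Enlarged G P′ w 1≤w M F L
    enlarge {M} {F} L fats 1≤M large dense with t ≤? count (inward L) L
    ... | yes many = enlarge-by-2-cycle L fats 1≤M many (≤-trans (m≤n+m _ (suc (t + 4 * P * (2 ^ (t + t) * w)))) large)
    ... | no few = extend (enlarge-by-insertion G P′ w 1≤w S fats 1≤S large′ heavy)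
      where
      open ≤-Reasoning
      outward = pick (not ∘ inward L) L (count (not ∘ inward L) L) ≤-refl
      S = proj₁ outward
      S′ = proj₁ (proj₂ outward)
      L↭ = proj₁ (proj₂ (proj₂ outward))
      lS = proj₁ (proj₂ (proj₂ (proj₂ outward)))
      S-out = proj₂ (proj₂ (proj₂ (proj₂ outward)))
      big : suc (4 * P * (2 ^ (t + t) * w)) ≤ length S
      big = +-cancelˡ-≤ t _ _ (begin
        t + suc (4 * P * (2 ^ (t + t) * w))              ≡⟨ +-suc t _ ⟩
        suc (t + 4 * P * (2 ^ (t + t) * w))              ≤⟨ ≤-trans (s≤s (m≤m+n _ ((P + P) * (t + 2 ^ t * w)))) large ⟩
        length L                                         ≡⟨ not-count (inward L) L ⟨
        count (inward L) L + count (not ∘ inward L) L    ≤⟨ +-mono-≤ (<⇒≤ (≰⇒> few)) (≤-reflexive (sym lS)) ⟩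
        t + length S                                     ∎)
      1≤S : 1 ≤ length S
      1≤S = ≤-trans (s≤s z≤n) big
      large′ : 4 * P * (2 ^ (t + t) * w) ≤ length S
      large′ = ≤-trans (n≤1+n _) big
      -- Of at least (1 + 1 / P)(f + |L|) edges at v, fewer than (1 + 1 / P) |L| stay inside L,
      -- because v is not inward.
      heavy : ∀ v → v ∈ S → suc P * length (vertices G F) < P * degreeIn G v (vertices G F)
      heavy v v∈ = +-cancelʳ-< (suc P * length L) _ _ (begin-strict
        suc P * f + suc P * length L                     ≡⟨ trans (sym (*-distribˡ-+ (suc P) f (length L))) (cong (suc P *_) (sym (length-++ (vertices G F)))) ⟩
        suc P * length (vertices G F ++ L)               ≤⟨ min-degree dense v ⟩
        P * degreeIn G v (vertices G F ++ L)             ≡⟨ trans (cong (P *_) (degreeIn-++ G v (vertices G F) L)) (*-distribˡ-+ P (degreeIn G v (vertices G F)) _) ⟩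
        P * degreeIn G v (vertices G F) + P * degreeIn G v L <⟨ +-monoʳ-< (P * degreeIn G v (vertices G F)) (≤ᵈ-false {suc P * length L} {P * degreeIn G v L} (not-true (All.lookup S-out v∈))) ⟩
        P * degreeIn G v (vertices G F) + suc P * length L ∎)
        where
        f = length (vertices G F)
        not-true : ∀ {b} → not b ≡ true → b ≡ false
        not-true {false} _ = refl
      extend : Enlarged G P′ w 1≤w M F S → Enlarged G P′ w 1≤w M F L
      extend E = record
        { fresh = fresh E ; used = used E ; new = new E ; rest = rest E ++ S′ ; fresh-fat = fresh-fat E ; used-fat = used-fat E
        ; taken = ↭-trans L↭ (↭-trans (++⁺ʳ S′ (taken E)) (↭-reflexive (++-assoc (new E) (rest E) S′)))
        ; new-size = new-size E ; covered = covered E ; used-size = used-size E }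

-- Covering almost all vertices by blown-up cycles

module _ {n} (G : Digraph n) (p′ : ℕ) (xs : List (Fin n)) (dense : Dense (suc p′) G xs) where

  private
    p P′ q N : ℕ
    p  = suc p′
    P′ = p′ + suc p′
    q  = suc P′ + suc P′
    N  = length xs

  record Covering (w M l : ℕ) : Set where
    field
      system    : System G
      left      : List (Fin n)
      fats      : All (Fat G w M) system
      partition : xs ↭ vertices G system ++ left
      #left     : length left ≡ l
  open Covering public

  module _ (w : ℕ) (1≤w : 1 ≤ w) (M : ℕ) (1≤M : 1 ≤ M) (ℓ₀ : ℕ) (ℓ₀-large : threshold P′ w ≤ ℓ₀) where

    -- Thin cycles are set aside for the rest of the round, as insertions at this width need
    -- clusters of size q w. By `budget`, each vertex that leaves `loose` accounts for at most 1 + M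
    -- q vertices of thin cycles.
    record Stage (l₀ : ℕ) : Set where
      field
        thick thin : System G
        loose      : List (Fin n)
        thick-fat  : All (Fat G (q * w) M) thick
        thin-fat   : All (Fat G w (suc M)) thin
        divided    : xs ↭ vertices G thin ++ (vertices G thick ++ loose)
        budget     : length (vertices G thin) + suc (M * q) * length loose ≤ suc (M * q) * l₀
    open Stage public

    -- Once thin cycles hold more than N / (4p) vertices, `dense-rest` does not apply to the
    -- remainder; but then `budget` shows that the leftover has shrunk by a fixed share of N.
    Stops : ∀ {l₀} → Stage l₀ → Set
    Stops S = length (loose S) < ℓ₀ ⊎ N < 4 * p * length (vertices G (thin S))

    advance : ∀ {l₀} (S : Stage l₀) → Enlarged G P′ w 1≤w M (thick S) (loose S) → Stage l₀
    advance S E = record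
      { thick = fresh E ; thin = used E ++ thin S ; loose = rest E ; thick-fat = fresh-fat E
      ; thin-fat = Allₚ.++⁺ (used-fat E) (thin-fat S)
      ; divided = ↭-trans (divided S) (begin
          T ++ (vertices G (thick S) ++ loose S)                  ↭⟨ ++⁺ˡ T (++⁺ˡ (vertices G (thick S)) (taken E)) ⟩
          T ++ (vertices G (thick S) ++ (new E ++ rest E))        ↭⟨ ++⁺ˡ T (shifts (vertices G (thick S)) (new E)) ⟩
          T ++ (new E ++ (vertices G (thick S) ++ rest E))        ≡⟨ cong (T ++_) (sym (++-assoc (new E) (vertices G (thick S)) (rest E))) ⟩
          T ++ ((new E ++ vertices G (thick S)) ++ rest E)        ↭⟨ ++⁺ˡ T (++⁺ʳ (rest E) (covered E)) ⟩
          T ++ ((U ++ vertices G (fresh E)) ++ rest E)            ≡⟨ cong (T ++_) (++-assoc U (vertices G (fresh E)) (rest E)) ⟩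
          T ++ (U ++ (vertices G (fresh E) ++ rest E))            ↭⟨ shifts T U ⟩
          U ++ (T ++ (vertices G (fresh E) ++ rest E))            ≡⟨ sym (++-assoc U T _) ⟩
          (U ++ T) ++ (vertices G (fresh E) ++ rest E)            ≡⟨ cong (_++ (vertices G (fresh E) ++ rest E)) (sym (vertices-++ G (used E) (thin S))) ⟩
          vertices G (used E ++ thin S) ++ (vertices G (fresh E) ++ rest E) ∎)
      ; budget = ≤-trans spent (budget S) }
      where
      open PermutationReasoning
      T = vertices G (thin S)
      U = vertices G (used E)
      spent : length (vertices G (used E ++ thin S)) + suc (M * q) * length (rest E) ≤ length T + suc (M * q) * length (loose S)
      spent = ≤R.begin
        length (vertices G (used E ++ thin S)) + suc (M * q) * length (rest E)  ≤R.≡⟨ cong (_+ suc (M * q) * length (rest E)) (trans (cong length (vertices-++ G (used E) (thin S))) (length-++ U)) ⟩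
        length U + length T + suc (M * q) * length (rest E)                     ≤R.≤⟨ +-monoˡ-≤ (suc (M * q) * length (rest E)) (+-monoˡ-≤ (length T) (used-size E)) ⟩
        suc (M * q) * length (new E) + length T + suc (M * q) * length (rest E) ≤R.≡⟨ arith (suc (M * q)) (length (new E)) (length T) (length (rest E)) ⟩
        length T + suc (M * q) * (length (new E) + length (rest E))             ≤R.≡⟨ cong (λ l → length T + suc (M * q) * l) (sym (trans (↭-length (taken E)) (length-++ (new E)))) ⟩
        length T + suc (M * q) * length (loose S)                               ≤R.∎
        where
        module ≤R = ≤-Reasoning
        arith : ∀ c a t r → c * a + t + c * r ≡ t + c * (a + r)
        arith = solve-∀

    run : ∀ k {l₀} (S : Stage l₀) → length (loose S) ≤ k → ∃ λ (S′ : Stage l₀) → Stops S′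
    run zero    S small = S , inj₁ (≤-trans (s≤s small) (≤-trans (s≤s z≤n) ℓ₀-large))
    run (suc k) S small with length (loose S) <? ℓ₀ | N <? 4 * p * length (vertices G (thin S))
    ... | yes few | _        = S , inj₁ few
    ... | no _    | yes much = S , inj₂ much
    ... | no many | no  room = run k (advance S E) (≤-pred (≤-trans (≤-trans fewer (≤-reflexive (sym (trans (↭-length (taken E)) (length-++ (new E)))))) small))
      where
      E : Enlarged G P′ w 1≤w M (thick S) (loose S)
      E = enlarge G P′ w 1≤w (loose S) (thick-fat S) 1≤M (≤-trans ℓ₀-large (≮⇒≥ many))
            (dense-rest {us = vertices G (thin S)} dense (divided S) (≮⇒≥ room))
      fewer : suc (length (rest E)) ≤ length (new E) + length (rest E)
      fewer = +-monoˡ-≤ (length (rest E)) (≤-trans 1≤w (new-size E))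

    -- The second alternative is a gain of N / (4p (q + 1) M): the rate 1 + M q of `budget` is
    -- rounded up to (q + 1) M to make it proportional to M.
    Progress : ℕ → ℕ → Set
    Progress l l′ = l′ ≤ l × (l′ < ℓ₀ ⊎ N + 4 * p * suc q * M * l′ ≤ 4 * p * suc q * M * l)

    round : ∀ {l} → Covering (q * w) M l → ∃ λ l′ → Covering w (suc M) l′ × Progress l l′
    round {l} K = length (loose S) , covering , shrinks , progress (proj₂ outcome)
      where
      start : Stage l
      start = record
        { thick = system K ; thin = [] ; loose = left K ; thick-fat = fats K ; thin-fat = []
        ; divided = partition K ; budget = ≤-reflexive (cong (suc (M * q) *_) (#left K)) }
      outcome = run (length (left K)) start ≤-refl
      S = proj₁ outcome
      halved = split-system G q (thick-fat S)
      covering : Covering w (suc M) (length (loose S))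
      covering = record
        { system = thin S ++ proj₁ halved ; left = loose S
        ; fats = Allₚ.++⁺ (thin-fat S) (All.map (fat-weaken G) (proj₁ (proj₂ halved)))
        ; partition = ↭-trans (divided S) (↭-trans (++⁺ˡ (vertices G (thin S)) (++⁺ʳ (loose S) (proj₂ (proj₂ halved))))
            (↭-reflexive (trans (sym (++-assoc (vertices G (thin S)) _ (loose S))) (cong (_++ loose S) (sym (vertices-++ G (thin S) (proj₁ halved)))))))
        ; #left = refl }
      shrinks : length (loose S) ≤ l
      shrinks = *-cancelˡ-≤ (suc (M * q)) (≤-trans (m≤n+m _ (length (vertices G (thin S)))) (budget S))
      progress : Stops S → length (loose S) < ℓ₀ ⊎ N + 4 * p * suc q * M * length (loose S) ≤ 4 * p * suc q * M * l
      progress (inj₁ few)  = inj₁ few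
      progress (inj₂ much) = inj₂ (begin
        N + 4 * p * suc q * M * l′                        ≡⟨ cong (N +_) (arith₁ (4 * p) q M l′) ⟩
        N + (4 * p * (suc (M * q) * l′) + (M ∸ 1) * (4 * p * l′)) ≤⟨ +-monoˡ-≤ (4 * p * (suc (M * q) * l′) + (M ∸ 1) * (4 * p * l′)) (<⇒≤ much) ⟩
        4 * p * T + (4 * p * (suc (M * q) * l′) + (M ∸ 1) * (4 * p * l′)) ≡⟨ arith₂ (4 * p) T (suc (M * q) * l′) _ ⟩
        4 * p * (T + suc (M * q) * l′) + (M ∸ 1) * (4 * p * l′) ≤⟨ +-mono-≤ (*-monoʳ-≤ (4 * p) (budget S)) (*-monoʳ-≤ (M ∸ 1) (*-monoʳ-≤ (4 * p) shrinks)) ⟩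
        4 * p * (suc (M * q) * l) + (M ∸ 1) * (4 * p * l) ≡⟨ arith₁ (4 * p) q M l ⟨
        4 * p * suc q * M * l                             ∎)
        where
        open ≤-Reasoning
        l′ = length (loose S)
        T = length (vertices G (thin S))
        arith₃ : ∀ c q m l → c * (1 + q) * (1 + m) * l ≡ c * ((1 + (1 + m) * q) * l) + m * (c * l)
        arith₃ = solve-∀
        arith₁ : ∀ c q M .⦃ _ : NonZero M ⦄ l → c * suc q * M * l ≡ c * (suc (M * q) * l) + (M ∸ 1) * (c * l)
        arith₁ c q (suc m) l = arith₃ c q m l
        arith₂ : ∀ c t a b → c * t + (c * a + b) ≡ c * (t + a) + b
        arith₂ = solve-∀
        instance
          M≢0 : NonZero M
          M≢0 = >-nonZero 1≤M

-- Widths and thresholds for rounds and phases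

factor : ℕ → ℕ
factor p′ = suc P′ + suc P′
  where P′ = p′ + suc p′

slowness : ℕ → ℕ
slowness p′ = 4 * suc p′ * suc (factor p′)

-- Computed backwards from the final width, since each round divides the width by `factor p′`; the
-- initial width is therefore independent of n.
roundWidth : ℕ → ℕ → ℕ → ℕ
roundWidth p′ zero    w = w
roundWidth p′ (suc j) w = factor p′ * roundWidth p′ j w

roundThreshold : ℕ → ℕ → ℕ → ℕ
roundThreshold p′ zero    w = 0
roundThreshold p′ (suc j) w = threshold (p′ + suc p′) (roundWidth p′ j w) + roundThreshold p′ j w

-- Starting from cycles of length at most M, phase i makes 2ⁱM rounds, so that the length bound doubles in each phase.
phaseWidth : ℕ → ℕ → ℕ → ℕ → ℕ
phaseWidth p′ zero    M w = w
phaseWidth p′ (suc i) M w = roundWidth p′ M (phaseWidth p′ i (M + M) w)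

phaseThreshold : ℕ → ℕ → ℕ → ℕ → ℕ
phaseThreshold p′ zero    M w = 0
phaseThreshold p′ (suc i) M w = roundThreshold p′ M (phaseWidth p′ i (M + M) w) + phaseThreshold p′ i (M + M) w

roundWidth>0 : ∀ p′ j {w} → 1 ≤ w → 1 ≤ roundWidth p′ j w
roundWidth>0 p′ zero    1≤w = 1≤w
roundWidth>0 p′ (suc j) 1≤w = *-mono-≤ {1} {factor p′} (s≤s z≤n) (roundWidth>0 p′ j 1≤w)

phaseWidth>0 : ∀ p′ i M {w} → 1 ≤ w → 1 ≤ phaseWidth p′ i M w
phaseWidth>0 p′ zero    M 1≤w = 1≤w
phaseWidth>0 p′ (suc i) M 1≤w = roundWidth>0 p′ M (phaseWidth>0 p′ i (M + M) 1≤w)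

-- `N + a * l′ ≤ a * l` expresses l - l′ ≥ N / a without subtraction; enlarging a weakens it.
raise-slope : ∀ N {a b l l′} → a ≤ b → l′ ≤ l → N + a * l′ ≤ a * l → N + b * l′ ≤ b * l
raise-slope N {a} {b} {l} {l′} a≤b l′≤l le = begin
  N + b * l′                         ≡⟨ cong (λ z → N + z * l′) (m+[n∸m]≡n a≤b) ⟨
  N + (a + (b ∸ a)) * l′             ≡⟨ trans (cong (N +_) (*-distribʳ-+ l′ a (b ∸ a))) (sym (+-assoc N (a * l′) _)) ⟩
  N + a * l′ + (b ∸ a) * l′          ≤⟨ +-mono-≤ le (*-monoʳ-≤ (b ∸ a) l′≤l) ⟩
  a * l + (b ∸ a) * l                ≡⟨ *-distribʳ-+ l a (b ∸ a) ⟨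
  (a + (b ∸ a)) * l                  ≡⟨ cong (_* l) (m+[n∸m]≡n a≤b) ⟩
  b * l                              ∎
  where open ≤-Reasoning

chain-slopes : ∀ {N A c l l₁ l₂} → N + c * l₁ ≤ c * l → A + c * l₂ ≤ c * l₁ → (N + A) + c * l₂ ≤ c * l
chain-slopes {N} {A} {c} {l} {l₁} {l₂} le₁ le₂ = begin
  N + A + c * l₂     ≡⟨ +-assoc N A _ ⟩
  N + (A + c * l₂)   ≤⟨ +-monoʳ-≤ N le₂ ⟩
  N + c * l₁         ≤⟨ le₁ ⟩
  c * l              ∎
  where open ≤-Reasoning

module _ {n} (G : Digraph n) (p′ : ℕ) (xs : List (Fin n)) (dense : Dense (suc p′) G xs) where

  private
    N κ : ℕ
    N = length xs
    κ = slowness p′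

  -- Mₓ bounds the cycle lengths of all j rounds, so that each of them gains at least N / (κ Mₓ) and
  -- the gains add up.
  rounds : ∀ j w → 1 ≤ w → ∀ M → 1 ≤ M → ∀ Mₓ ℓ₀ → j + M ≤ Mₓ → roundThreshold p′ j w ≤ ℓ₀ →
    ∀ {l} → Covering G p′ xs dense (roundWidth p′ j w) M l →
    ∃ λ l′ → Covering G p′ xs dense w (j + M) l′ × l′ ≤ l × (l′ < ℓ₀ ⊎ j * N + κ * Mₓ * l′ ≤ κ * Mₓ * l)
  rounds zero    w 1≤w M 1≤M Mₓ ℓ₀ M≤ large {l} K = l , K , ≤-refl , inj₂ ≤-refl
  rounds (suc j) w 1≤w M 1≤M Mₓ ℓ₀ M≤ large {l} K =
    l₂ , subst (λ m → Covering G p′ xs dense w m l₂) (+-suc j M) (proj₁ (proj₂ later)) , ≤-trans l₂≤l₁ l₁≤l ,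
    combine (proj₂ (proj₂ (proj₂ first))) (proj₂ (proj₂ (proj₂ later)))
    where
    W = roundWidth p′ j w
    first = round G p′ xs dense W (roundWidth>0 p′ j 1≤w) M 1≤M ℓ₀ (≤-trans (m≤m+n _ (roundThreshold p′ j w)) large) K
    l₁ = proj₁ first
    l₁≤l = proj₁ (proj₂ (proj₂ first))
    later = rounds j w 1≤w (suc M) (s≤s z≤n) Mₓ ℓ₀ (subst (_≤ Mₓ) (sym (+-suc j M)) M≤) (≤-trans (m≤n+m _ (threshold (p′ + suc p′) W)) large) (proj₁ (proj₂ first))
    l₂ = proj₁ later
    l₂≤l₁ = proj₁ (proj₂ (proj₂ later))
    combine : l₁ < ℓ₀ ⊎ N + κ * M * l₁ ≤ κ * M * l → l₂ < ℓ₀ ⊎ j * N + κ * Mₓ * l₂ ≤ κ * Mₓ * l₁ →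
              l₂ < ℓ₀ ⊎ suc j * N + κ * Mₓ * l₂ ≤ κ * Mₓ * l
    combine (inj₁ lt)  _          = inj₁ (≤-<-trans l₂≤l₁ lt)
    combine (inj₂ _)   (inj₁ lt)  = inj₁ lt
    combine (inj₂ le₁) (inj₂ le₂) = inj₂ (chain-slopes {N} {j * N} {κ * Mₓ} {l} {l₁} {l₂} (raise-slope N {κ * M} {κ * Mₓ} {l} {l₁} (*-monoʳ-≤ κ (≤-trans (m≤n+m M (suc j)) M≤)) l₁≤l le₁) le₂)

  -- M rounds with cycle lengths up to 2M gain M · N / (2 κ M) = N / (2κ), whatever M is: the dyadic
  -- proof that the harmonic series diverges.
  phases : ∀ i w → 1 ≤ w → ∀ M → 1 ≤ M → ∀ ℓ₀ → phaseThreshold p′ i M w ≤ ℓ₀ →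
    ∀ {l} → Covering G p′ xs dense (phaseWidth p′ i M w) M l →
    ∃₂ λ M′ l′ → Covering G p′ xs dense w M′ l′ × l′ ≤ l × (l′ < ℓ₀ ⊎ i * N + (κ + κ) * l′ ≤ (κ + κ) * l)
  phases zero    w 1≤w M 1≤M ℓ₀ large {l} K = M , l , K , ≤-refl , inj₂ ≤-refl
  phases (suc i) w 1≤w M 1≤M ℓ₀ large {l} K =
    proj₁ later , l₂ , proj₁ (proj₂ (proj₂ later)) , ≤-trans l₂≤l₁ l₁≤l ,
    combine (proj₂ (proj₂ (proj₂ first))) (proj₂ (proj₂ (proj₂ (proj₂ later))))
    where
    W = phaseWidth p′ i (M + M) w
    first = rounds M W (phaseWidth>0 p′ i (M + M) 1≤w) M 1≤M (M + M) ℓ₀ ≤-refl (≤-trans (m≤m+n _ (phaseThreshold p′ i (M + M) w)) large) K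
    l₁ = proj₁ first
    l₁≤l = proj₁ (proj₂ (proj₂ first))
    later = phases i w 1≤w (M + M) (≤-trans 1≤M (m≤m+n M M)) ℓ₀ (≤-trans (m≤n+m _ (roundThreshold p′ M W)) large) (proj₁ (proj₂ first))
    l₂ = proj₁ (proj₂ later)
    l₂≤l₁ = proj₁ (proj₂ (proj₂ (proj₂ later)))
    cancel : M * N + κ * (M + M) * l₁ ≤ κ * (M + M) * l → N + (κ + κ) * l₁ ≤ (κ + κ) * l
    cancel le = *-cancelˡ-≤ M ⦃ >-nonZero 1≤M ⦄ (≤-trans (≤-reflexive (trans (*-distribˡ-+ M N _) (cong (M * N +_) (arith κ M l₁)))) (≤-trans le (≤-reflexive (sym (arith κ M l)))))
      where
      arith : ∀ k m l → m * ((k + k) * l) ≡ k * (m + m) * l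
      arith = solve-∀
    combine : l₁ < ℓ₀ ⊎ M * N + κ * (M + M) * l₁ ≤ κ * (M + M) * l → l₂ < ℓ₀ ⊎ i * N + (κ + κ) * l₂ ≤ (κ + κ) * l₁ →
              l₂ < ℓ₀ ⊎ suc i * N + (κ + κ) * l₂ ≤ (κ + κ) * l
    combine (inj₁ lt)  _          = inj₁ (≤-<-trans l₂≤l₁ lt)
    combine (inj₂ _)   (inj₁ lt)  = inj₁ lt
    combine (inj₂ le₁) (inj₂ le₂) = inj₂ (chain-slopes {N} {i * N} {κ + κ} {l} {l₁} {l₂} (cancel le₁) le₂)

  -- More than 2κ phases that never reach ℓ₀ would gain more than N, the whole initial leftover.
  -- With ℓ₀ = 1 + N / E at most N / E vertices remain.
  cover : ∀ i w → 1 ≤ w → slowness p′ + slowness p′ < i → ∀ E → 1 ≤ E → suc (phaseThreshold p′ i 1 w * E) ≤ N →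
          ∃₂ λ M l → Covering G p′ xs dense w M l × l * E ≤ N
  cover i w 1≤w κ+κ<i E 1≤E large = proj₁ end , l , proj₁ (proj₂ (proj₂ end)) , ≤-trans (*-monoˡ-≤ E l≤) (m/n*n≤m N E)
    where
    instance
      E≢0 : NonZero E
      E≢0 = >-nonZero 1≤E
    start : Covering G p′ xs dense (phaseWidth p′ i 1 w) 1 N
    start = record { system = [] ; left = xs ; fats = [] ; partition = ↭-refl ; #left = refl }
    end = phases i w 1≤w 1 ≤-refl (suc (N / E)) (≤-trans (m*d≤n⇒m≤n/d _ E N (≤-trans (n≤1+n _) large)) (n≤1+n _)) start
    l = proj₁ (proj₂ end)
    bounded-left : l < suc (N / E) ⊎ i * N + (κ + κ) * l ≤ (κ + κ) * N → l ≤ N / E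
    bounded-left (inj₁ lt) = ≤-pred lt
    bounded-left (inj₂ le) = contradiction (≤-trans (m≤m+n (i * N) _) le)
      (<⇒≱ (*-monoˡ-< N ⦃ >-nonZero (≤-trans (s≤s z≤n) large) ⦄ κ+κ<i))
    l≤ : l ≤ N / E
    l≤ = bounded-left (proj₂ (proj₂ (proj₂ (proj₂ end))))

almost-cover : ∀ p′ w → 1 ≤ w → ∀ E → 1 ≤ E → ∃ λ n₀ → ∀ {n} (G : Digraph n) xs (dense : Dense (suc p′) G xs) → n₀ ≤ length xs →
               ∃₂ λ M l → Covering G p′ xs dense w M l × l * E ≤ length xs
almost-cover p′ w 1≤w E 1≤E = with-phases (suc (slowness p′ + slowness p′)) ≤-refl
  where
  with-phases : ∀ i → slowness p′ + slowness p′ < i → ∃ λ n₀ → ∀ {n} (G : Digraph n) xs (dense : Dense (suc p′) G xs) → n₀ ≤ length xs →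
                ∃₂ λ M l → Covering G p′ xs dense w M l × l * E ≤ length xs
  with-phases i κ+κ<i = suc (phaseThreshold p′ i 1 w * E) , λ G xs dense → cover G p′ xs dense i w 1≤w κ+κ<i E 1≤E

-- From tilings to factors

chunks : ∀ {w} j (xs : List A) → length xs ≡ j * w → ∃ λ (vs : List (Vec A w)) → length vs ≡ j × concat (map toList vs) ≡ xs
chunks zero    []         e = [] , refl , refl
chunks {A} {w} (suc j) xs e = v ∷ proj₁ ih , cong suc (proj₁ (proj₂ ih)) ,
  trans (cong₂ _++_ toList-v (proj₂ (proj₂ ih))) (take++drop≡id w xs)
  where
  ih = chunks j (List.drop w xs) (trans (length-drop w xs) (trans (cong (_∸ w) e) (m+n∸m≡n w (j * w))))
  w≡ : length (List.take w xs) ≡ w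
  w≡ = trans (length-take w xs) (m≤n⇒m⊓n≡m (≤-trans (m≤m+n w (j * w)) (≤-reflexive (sym e))))
  fromList′ : ∀ (ys : List A) {k} → length ys ≡ k → ∃ λ (v : Vec A k) → toList v ≡ ys
  fromList′ ys refl = Vec.fromList ys , Vecₚ.toList∘fromList ys
  v = proj₁ (fromList′ (List.take w xs) w≡)
  toList-v = proj₂ (fromList′ (List.take w xs) w≡)

module _ {h n} (H : Digraph h) (G : Digraph n) where

  tileable⇒∣ : ∀ {xs} → Tileable H G xs → h ∣ length xs
  tileable⇒∣ (ts , _ , p) = subst (h ∣_) (↭-length p) (divides (length ts) (total ts))
    where
    total : ∀ (ts : List (Vec (Fin n) h)) → length (concat (map toList ts)) ≡ length ts * h
    total []       = refl
    total (t ∷ ts) = trans (length-++ (toList t)) (cong₂ _+_ (Vecₚ.length-toList t) (total ts))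

  simple-lookup : ∀ {k} (v : Vec (Fin n) k) → Simple (toList v) → ∀ i j → lookup v i ≡ lookup v j → i ≡ j
  simple-lookup (x ∷ v) simple zero    zero    e = refl
  simple-lookup (x ∷ v) simple (suc i) (suc j) e = cong suc (simple-lookup v (λ y → ≤-trans (m≤n+m _ _) (simple y)) i j e)
  simple-lookup (x ∷ v) simple zero    (suc j) e = contradiction (≤-trans (twice x v j e) (simple x)) λ { (s≤s ()) }
    where
    twice : ∀ {k} x (v : Vec (Fin n) k) j → x ≡ lookup v j → 2 ≤ occurrences x (x ∷ toList v)
    twice x v j e = +-mono-≤ (≤-reflexive (sym (cong indicator (dec-true (x Fin.≟ x) refl)))) (occurs (subst (_∈ toList v) (sym e) (∈-toList⁺ (∈-lookup j v))))
  simple-lookup (x ∷ v) simple (suc i) zero    e = sym (simple-lookup (x ∷ v) simple zero (suc i) (sym e))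

  tile : (ts : List (Vec (Fin n) h)) → Fin (length ts) → Fin h → Fin n
  tile ts i u = lookup (List.lookup ts i) u

  tile∈ : ∀ ts i u → tile ts i u ∈ concat (map toList ts)
  tile∈ (t ∷ ts) zero    u = ∈-++⁺ˡ (∈-toList⁺ (∈-lookup u t))
  tile∈ (t ∷ ts) (suc i) u = ∈-++⁺ʳ (toList t) (tile∈ ts i u)

  tile-injective : ∀ ts → Simple (concat (map toList ts)) → ∀ i u j v → tile ts i u ≡ tile ts j v → (i , u) ≡ (j , v)
  tile-injective (t ∷ ts) simple zero u zero v e =
    cong (zero ,_) (simple-lookup t (λ y → ≤-trans (≤-trans (m≤m+n _ _) (≤-reflexive (sym (∑-++ (toList t) _ _)))) (simple y)) u v e)
  tile-injective (t ∷ ts) simple (suc i) u (suc j) v e =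
    cong (λ { (a , b) → suc a , b }) (tile-injective ts (simple-rest (toList t) simple ↭-refl) i u j v e)
  tile-injective (t ∷ ts) simple zero u (suc j) v e = contradiction
    (≤-trans (+-mono-≤ (occurs (∈-toList⁺ (∈-lookup u t))) (occurs (subst (_∈ concat (map toList ts)) (sym e) (tile∈ ts j v))))
      (≤-trans (≤-reflexive (sym (∑-++ (toList t) (concat (map toList ts)) _))) (simple (lookup t u)))) λ { (s≤s ()) }
  tile-injective (t ∷ ts) simple (suc i) u zero v e = sym (tile-injective (t ∷ ts) simple zero v (suc i) u (sym e))

  tile-surjective : ∀ ts {y} → y ∈ concat (map toList ts) → ∃₂ λ i u → tile ts i u ≡ y
  tile-surjective (t ∷ ts) y∈ with ∈-++⁻ (toList t) y∈
  ... | inj₁ y∈t  = zero , position t y∈t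
    where
    position : ∀ {k y} (v : Vec (Fin n) k) → y ∈ toList v → ∃ λ u → lookup v u ≡ y
    position (x ∷ v) (here refl) = zero , refl
    position (x ∷ v) (there y∈)  with u , e ← position v y∈ = suc u , e
  ... | inj₂ y∈ts with i , u , e ← tile-surjective ts y∈ts = suc i , u , e

  tileable⇒factor : Tileable H G (allFin n) → HasFactor H G
  tileable⇒factor (ts , copies , p) = length ts , tile ts , (λ i → All.lookup copies (∈-list-lookup ts i)) ,
    (λ { {i , u} {j , v} e → tile-injective ts (simple-rest [] (simple-allFin n) (↭-sym p)) i u j v e }) ,
    λ y → onto y (tile-surjective ts (∈-resp-↭ (↭-sym p) (∈-allFin y)))
    where
    ∈-list-lookup : ∀ (ts : List (Vec (Fin n) h)) i → List.lookup ts i ∈ ts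
    ∈-list-lookup (t ∷ ts) zero    = here refl
    ∈-list-lookup (t ∷ ts) (suc i) = there (∈-list-lookup ts i)
    onto : ∀ y → (∃₂ λ i u → tile ts i u ≡ y) → ∃ λ x → ∀ {z} → z ≡ x → uncurry (tile ts) z ≡ y
    onto y (i , u , e) = (i , u) , λ { refl → e }

module _ {h} (H : Digraph (suc h)) (path : HomToDirectedPath H) where

  dense⇒tileable : ∀ p′ → ∃ λ n₀ → ∀ {n} (G : Digraph n) → n₀ ≤ n → suc h ∣ n → Dense (suc p′) G (allFin n) → Tileable H G (allFin n)
  dense⇒tileable p′ = n₁ + 2 * n₂ , tiling
    where
    ab = absorbers H path (suc p′) (s≤s z≤n)
    D n₁ n₂ : ℕ
    D  = proj₁ ab
    n₁ = proj₁ (proj₂ ab)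
    -- `p′ + suc p′` is the predecessor of the parameter p + p left by the gadgets. With E = D at
    -- most n / D vertices stay uncovered, so there are no more tuples than the gadgets can absorb.
    ac = almost-cover (p′ + suc p′) (suc h) (s≤s z≤n) D (proj₁ (proj₂ (proj₂ ab)))
    n₂ = proj₁ ac
    tiling : ∀ {n} (G : Digraph n) → n₁ + 2 * n₂ ≤ n → suc h ∣ n → Dense (suc p′) G (allFin n) → Tileable H G (allFin n)
    tiling {n} G large h∣n dense =
      finish (proj₂ (proj₂ (proj₂ ab)) G (≤-trans (m≤m+n n₁ (2 * n₂)) large) dense)
      where
      finish : (∃₂ λ gs xs → allFin n ↭ supports H G gs ++ xs × All (Absorbing H G) gs × Dense (suc p′ + suc p′) G xs ×
                 n ≤ 2 * length xs × (∀ Q s → s * D ≤ n → s ≤ count (absorbs H G Q) gs)) → Tileable H G (allFin n)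
      finish (gs , xs , split , valid , dense-xs , n≤2xs , hits) =
        conclude (proj₂ ac G xs dense-xs (*-cancelˡ-≤ 2 (≤-trans (≤-trans (m≤n+m (2 * n₂) n₁) large) n≤2xs)))
        where
        xs≤n : length xs ≤ n
        xs≤n = ≤-trans (m≤n+m _ (length (supports H G gs))) (≤-reflexive (trans (sym (trans (↭-length split) (length-++ (supports H G gs)))) (length-tabulate {n = n} id)))
        conclude : (∃₂ λ M l → Covering G (p′ + suc p′) xs dense-xs (suc h) M l × l * D ≤ length xs) → Tileable H G (allFin n)
        conclude (M , l , K , few) = tileable-↭ H G
          (↭-sym (↭-trans whole (shifts S U)))
          (tileable-++ H G tiled-U (subst (λ L → Tileable H G (S ++ L)) (proj₂ (proj₂ groups)) (absorb H G Qs gs valid enough)))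
          where
          S = supports H G gs
          U = vertices G (system K)
          L = left K
          whole : allFin n ↭ S ++ (U ++ L)
          whole = ↭-trans split (++⁺ˡ S (partition K))
          -- Absorbing nothing tiles S; with `tiled-U` this makes |L| divisible by |H|.
          tiled-S : Tileable H G S
          tiled-S = tileable-↭ H G (↭-reflexive (++-identityʳ S)) (absorb H G [] gs valid (λ _ → z≤n))
          tiled-U : Tileable H G U
          tiled-U = tileable-concat H G (Allₚ.map⁺ (All.map (λ {cs} f → cycle-tileable G H path cs (widths f) (cyclic f)) (fats K)))
          h∣L : suc h ∣ length L
          h∣L = ∣m+n∣m⇒∣n (subst (suc h ∣_) (length-++ U) (∣m+n∣m⇒∣n (subst (suc h ∣_) total h∣n) (tileable⇒∣ H G tiled-S))) (tileable⇒∣ H G tiled-U)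
            where
            total : n ≡ length S + length (U ++ L)
            total = trans (sym (length-tabulate {n = n} id)) (trans (↭-length whole) (length-++ S))
          -- Any partition of L into tuples will do, as every tuple is absorbed by many gadgets.
          groups : ∃ λ (Qs : List (Vec (Fin n) (suc h))) → length Qs ≡ quotient h∣L × concat (map toList Qs) ≡ L
          groups = chunks (quotient h∣L) L (_∣_.equality h∣L)
          Qs = proj₁ groups
          Qs≤l : length Qs ≤ l
          Qs≤l = ≤-trans (≤-reflexive (proj₁ (proj₂ groups))) (≤-trans (m≤m*n (quotient h∣L) (suc h)) (≤-reflexive (trans (sym (_∣_.equality h∣L)) (#left K))))
          enough : ∀ Q → length Qs ≤ count (absorbs H G Q) gs
          enough Q = hits Q (length Qs) (≤-trans (*-monoˡ-≤ D Qs≤l) (≤-trans few xs≤n))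

-- The witness p′ satisfies η ≥ 1 / (1 + p′).
integral-degree : ∀ η → ℚ.0ℚ ℚ.< η → ∃ λ p′ → ∀ n d → (ℚ.1ℚ ℚ.+ η) ℚ.* (ℤ.+ n ℚ./ 1) ℚ.≤ (ℤ.+ d ℚ./ 1) → suc (suc p′) * n ≤ suc p′ * d
integral-degree η@(ℚ.mkℚ (ℤ.+ suc a) p′ _) _ = p′ , bound
  where
  bound : ∀ n d → (ℚ.1ℚ ℚ.+ η) ℚ.* (ℤ.+ n ℚ./ 1) ℚ.≤ (ℤ.+ d ℚ./ 1) → suc (suc p′) * n ≤ suc p′ * d
  bound n d le = begin
    suc (suc p′) * n                       ≤⟨ *-monoˡ-≤ n (s≤s (≤-trans (m≤m+n (suc p′) a) (≤-reflexive (+-comm (suc p′) a)))) ⟩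
    suc (a + suc p′) * n                   ≡⟨ arith₁ a p′ n ⟩
    (1 * suc p′ + suc a * 1) * n * 1       ≤⟨ ℤₚ.drop‿+≤+ (subst₂ ℤ._≤_ numerators (sym (ℤₚ.pos-* d (ℚᵘ.↧ₙ x))) (ℚᵘₚ.drop-*≤* unnormalised)) ⟩
    d * ℚᵘ.↧ₙ x                            ≡⟨ trans (cong (λ k → d * suc k) (trans (*-identityʳ (p′ + 0)) (+-identityʳ p′))) (*-comm d (suc p′)) ⟩
    suc p′ * d                             ∎
    where
    open ≤-Reasoning
    x : ℚᵘ.ℚᵘ
    x = (ℚᵘ.1ℚᵘ ℚᵘ.+ ℚ.toℚᵘ η) ℚᵘ.* ℚᵘ.mkℚᵘ (ℤ.+ n) 0
    toℚᵘ-x : ℚ.toℚᵘ ((ℚ.1ℚ ℚ.+ η) ℚ.* (ℤ.+ n ℚ./ 1)) ℚᵘ.≃ x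
    toℚᵘ-x = ℚᵘₚ.≃-trans (ℚₚ.toℚᵘ-homo-* (ℚ.1ℚ ℚ.+ η) (ℤ.+ n ℚ./ 1))
      (ℚᵘₚ.*-cong (ℚₚ.toℚᵘ-homo-+ ℚ.1ℚ η) (ℚₚ.toℚᵘ-fromℚᵘ (ℚᵘ.mkℚᵘ (ℤ.+ n) 0)))
    unnormalised : x ℚᵘ.≤ ℚᵘ.mkℚᵘ (ℤ.+ d) 0
    unnormalised = ℚᵘₚ.≤-respˡ-≃ toℚᵘ-x (ℚᵘₚ.≤-respʳ-≃ (ℚₚ.toℚᵘ-fromℚᵘ (ℚᵘ.mkℚᵘ (ℤ.+ d) 0)) (ℚₚ.toℚᵘ-mono-≤ le))
    arith₁ : ∀ a p n → (1 + (a + (1 + p))) * n ≡ (1 * (1 + p) + (1 + a) * 1) * n * 1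
    arith₁ = solve-∀
    numerators : ℚᵘ.↥ x ℤ.* ℤ.+ 1 ≡ ℤ.+ ((1 * suc p′ + suc a * 1) * n * 1)
    numerators = sym (trans (ℤₚ.pos-* ((1 * suc p′ + suc a * 1) * n) 1) (cong (ℤ._* ℤ.+ 1) (ℤₚ.pos-* (1 * suc p′ + suc a * 1) n)))
integral-degree (ℚ.mkℚ (ℤ.+ zero) _ _)  (ℚ.*<* (ℤ.+<+ ()))
integral-degree (ℚ.mkℚ ℤ.-[1+ _ ] _ _) (ℚ.*<* ())

theorem1p2 : ∀ {h} (H : Digraph h) → HomToDirectedPath H →
    (η : ℚ) → 0ℚ ℚ.< η →
    Σ ℕ λ n₀ → ∀ n → n ≥ n₀ → h ∣ n →
    (G : Digraph n) →
    (∀ v → (1ℚ ℚ.+ η) ℚ.* (ℤ.+ n ℚ./ 1) ℚ.≤ (ℤ.+ deg G v ℚ./ 1)) →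
    HasFactor H G
-- `0 ∣ n` forces n = 0, which n₀ = 1 excludes.
theorem1p2 {zero}  H path η 0<η = 1 , λ n n≥1 0∣n → contradiction (0∣⇒≡0 0∣n) (>⇒≢ n≥1)
theorem1p2 {suc h} H path η 0<η = proj₁ tiling , λ n n≥n₀ h∣n G degrees → tileable⇒factor H G
  (proj₂ tiling G n≥n₀ h∣n (mkDense λ v →
    subst (λ l → suc (suc p′) * l ≤ suc p′ * deg G v) (sym (length-tabulate {n = n} id)) (proj₂ (integral-degree η 0<η) n (deg G v) (degrees v))))
  where
  p′ = proj₁ (integral-degree η 0<η)
  tiling = dense⇒tileable H path p′
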